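{- There exists a constant $c$ such that the following holds for all natural numbers $d$, $r$ and $n$ satisfying $n \ge 2^{d^2 2^{cr}}$. For every edge two-coloring of the complete graph on at least $2^{d2^{cr}}n$ vertices, one of the colors is universal for the family of $d$-degenerate $r$-colorable graphs on at most $n$ vertices.
   Context: A graph is $d$-degenerate if every subgraph of it has a vertex of degree at most $d$. A graph is $r$-colorable if it admits a proper vertex coloring with $r$ colors. A graph $G$ is universal for a family $\mathcal{F}$ of graphs if it contains every $F \in \mathcal{F}$ as a (not necessarily induced) subgraph. In an edge coloring, a color is universal for $\mathcal{F}$ if the graph formed by the edges of that color (on the whole vertex set) is universal for $\mathcal{F}$. -}

module Defs where

open import Data.Nat using (ℕ; _≤_)
open import Data.Bool using (Bool; true; false; T)
open import Data.Fin using (Fin)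
open import Data.Fin.Subset using (Subset; _∈_; _⊆_)
open import Data.Vec using (Vec; lookup)
open import Data.Vec.Functional using () renaming (Vector to FVec)
open import Data.List using (List; length; filterᵇ; allFin)
open import Data.Product using (Σ; ∃; _×_; _,_)
open import Relation.Binary.PropositionalEquality using (_≡_; _≢_)
open import Relation.Nullary using (¬_)
open import Function.Definitions using (Injective)
open import Data.Bool using (_∧_)

record Graph (k : ℕ) : Set where
  field
    adj   : Fin k → Fin k → Bool
    adjSym : ∀ u v → adj u v ≡ adj v u
    irref : ∀ u → adj u u ≡ false
open Graph public

record Subgraph {k : ℕ} (G : Graph k) : Set where
  field
    verts   : Subset k
    edges   : Fin k → Fin k → Bool
    e-sym   : ∀ u v → edges u v ≡ edges v u
    e-sub   : ∀ u v → T (edges u v) → T (adj G u v)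
    e-verts : ∀ u v → T (edges u v) → (u ∈ verts × v ∈ verts)
open Subgraph public

degIn : {k : ℕ} {G : Graph k} → Subgraph G → Fin k → ℕ
degIn H u = length (filterᵇ (λ w → edges H u w) (allFin _))

Degenerate : ℕ → {k : ℕ} → Graph k → Set
Degenerate d {k} G =
  (H : Subgraph G) → (∃ λ v → v ∈ verts H) →
  ∃ λ v → v ∈ verts H × degIn H v ≤ d

Colorable : ℕ → {k : ℕ} → Graph k → Set
Colorable r {k} G =
  Σ (Fin k → Fin r) λ χ → ∀ u v → T (adj G u v) → χ u ≢ χ v

_⊑_ : {k m : ℕ} → Graph k → Graph m → Set
_⊑_ {k} {m} F G =
  Σ (Fin k → Fin m) λ f → Injective _≡_ _≡_ f ×
    (∀ u v → T (adj F u v) → T (adj G (f u) (f v)))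

-- A red/blue edge colouring of the complete graph on Fin m:
-- a symmetric Boolean function (diagonal values irrelevant).
record EdgeColoring2 (m : ℕ) : Set where
  field
    col    : Fin m → Fin m → Bool
    colSym : ∀ u v → col u v ≡ col v u
open EdgeColoring2 public

open import Data.Fin using (_≟_)
open import Relation.Nullary.Decidable using (⌊_⌋)
open import Data.Bool using (not; if_then_else_)
open import Relation.Binary.PropositionalEquality using (refl; cong; trans; sym)

colorClass : {m : ℕ} → EdgeColoring2 m → Bool → Graph m
colorClass {m} c b = record
  { adj   = λ u v → not ⌊ u ≟ v ⌋ ∧ sel u v
  ; adjSym = λ u v → symLemma u v
  ; irref = λ u → irrLemma u
  }
  where
  open import Relation.Nullary using (yes; no)
  sel : Fin m → Fin m → Bool
  sel u v = if b then col c u v else not (col c u v)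
  ≟-sym : ∀ (u v : Fin m) → ⌊ u ≟ v ⌋ ≡ ⌊ v ≟ u ⌋
  ≟-sym u v with u ≟ v | v ≟ u
  ... | yes _ | yes _ = refl
  ... | no _  | no _  = refl
  ... | yes p | no q  = Data.Empty.⊥-elim (q (sym p)) where import Data.Empty
  ... | no p  | yes q = Data.Empty.⊥-elim (p (sym q)) where import Data.Empty
  symLemma : ∀ u v → (not ⌊ u ≟ v ⌋ ∧ sel u v) ≡ (not ⌊ v ≟ u ⌋ ∧ sel v u)
  symLemma u v rewrite ≟-sym u v | colSym c u v = refl
  irrLemma : ∀ u → (not ⌊ u ≟ u ⌋ ∧ sel u u) ≡ false
  irrLemma u with u ≟ u
  ... | yes _ = refl
  ... | no q  = Data.Empty.⊥-elim (q refl) where import Data.Empty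

UniversalDegCol : ℕ → ℕ → ℕ → {m : ℕ} → Graph m → Set
UniversalDegCol d r n G =
  ∀ {k} → k ≤ n → (F : Graph k) → Degenerate d F → Colorable r F → F ⊑ G

{-# OPTIONS --safe #-}
-- Fix the colour class b that contains at least N^m / 2^(2m²) sequences forming a clique of size
-- m = r t, and cut a uniformly random such sequence into r blocks of t vertices.  Let the i-th part
-- be the set of vertices adjacent to all blocks but the i-th.  Given the other blocks, the i-th
-- block is uniform in the t-th power of the i-th part, and a tuple from the other parts can only
-- occur if the block falls into its common neighbourhood in the i-th part.  Hence tuples with c
-- common neighbours are penalised by a factor c^t, simultaneously for all i (dependent random choice).
--
-- A d-degenerate graph is embedded vertex by vertex, each vertex into a random unused common
-- neighbour (in its part) of the images of its at most d earlier neighbours.  Let h_v = θ/c_v,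
-- where c_v is the number of these candidates.  Dividing by the h_w of the earlier neighbours w of v
-- turns their images into independent uniform vertices, so the arithmetic-geometric mean inequality
-- 2 h_v^s ≤ s h_v^(2s) / ∏ h_w + ∏ h_w / s and ∏ h_w ≤ 1 + ∑ h_w^s give 𝔼 h_v^s ≤ 1 by induction.
-- Consequently all candidate sets are large and ∑ 1/c_v is small; an exponential supermartingale
-- then shows that no candidate set is ever half used up, so the embedding is injective.
module Submission where

open import Defs
open import Algebra.Bundles using (CommutativeSemiring)
open import Algebra.Structures using (IsCommutativeSemiring)
open import Data.Bool using (Bool; true; false; T; not; _∧_; _∨_; if_then_else_)
import Data.Bool.Properties as Bool
open import Data.Empty using (⊥; ⊥-elim)
open import Data.Fin using (Fin; zero; suc; inject≤; _≟_)
open import Data.Fin.Properties using (inject≤-injective)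
open import Data.Fin.Subset as Subset using (Subset)
import Data.Fin.Subset.Properties as Subset
open import Data.List as List using (List; []; _∷_; _++_; length; map; filterᵇ; allFin; cartesianProductWith)
open import Data.List.Membership.Propositional using (_∈_)
open import Data.List.Membership.Propositional.Properties
  using (∈-allFin; ∈-∃++; ∈-++⁺ˡ; ∈-++⁺ʳ; ∈-++⁻; ∈-filter⁺; ∈-filter⁻; ∈-cartesianProductWith⁺)
open import Data.List.Properties using (length-++; length-map; length-tabulate)
open import Data.List.Relation.Unary.All as All using (All; []; _∷_)
open import Data.List.Relation.Unary.AllPairs using ([]; _∷_)
open import Data.List.Relation.Unary.Any as Any using (here; there)
open import Data.List.Relation.Unary.Any.Properties using (lookup-index)
open import Data.List.Relation.Unary.Unique.Propositional using (Unique)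
import Data.List.Relation.Unary.Unique.Propositional.Properties as Unique
open import Data.Nat as ℕ using (ℕ; zero; suc; _≤_; _<_; z≤n; s≤s; _+_; _*_; _^_; _⊔_; _≤ᵇ_)
open import Data.Nat.ListAction using (sum)
import Data.Nat.Properties as ℕ
open import Data.Nat.Tactic.RingSolver using (solve-∀)
open import Data.Product using (∃; Σ; _×_; _,_; proj₁; proj₂)
open import Data.Rational as ℚ using (ℚ; 0ℚ; 1ℚ)
import Data.Rational.Properties as ℚ
open import Data.Sum as Sum using (_⊎_; inj₁; inj₂)
open import Data.Unit using (⊤; tt)
open import Data.Vec as Vec using (Vec; []; _∷_; lookup; _[_]≔_)
open import Data.Vec.Properties using (lookup⇒[]=; []=⇒lookup; lookup-allFin; lookup∘update; lookup∘update′)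
open import Function using (_∘_; id; Equivalence)
open import Function.Definitions using (Injective)
open import Level using (0ℓ)
open import Relation.Binary.Bundles using (Preorder)
open import Relation.Binary.Definitions using (DecidableEquality)
open import Relation.Binary.PropositionalEquality
import Relation.Binary.Reasoning.Preorder as PreorderReasoning
open import Relation.Nullary using (¬_; yes; no)
open import Relation.Nullary.Decidable using (⌊_⌋; recompute; toWitness)

-- The exponents interlock. With s = d + 1, a product of at most d factors h_w is at most 1 + ∑
-- h_w^s, whose mean is at most 1 + d = s, and this is cancelled by the weight 1/s. The other half
-- of the inequality contains h_v^(2s), hence blocks of t = 2s entries. The density of cliques then
-- costs 2^(8 r² s²), which the surplus R^s of a host with R θ vertices repays once log R has order
-- r² d: linear in d.
--
-- The obstacle is circularity: large candidate sets need nearly uniform images, and conditioning on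
-- past success would destroy this. So nothing is conditioned on. The process continues even when
-- injectivity is lost, all bounds hold for the unconditional expectation, and one outcome that
-- satisfies all of them is picked at the end.
--
-- Crowding needs a set determined by the blocks alone, but candidate sets depend on the embedding.
-- Therefore the union bound runs over all parts and all tuples of at most d vertices. It costs
-- about r N^d, against a gain of 2^m₀ with m₀ of order √n; this is where the lower bound on n is
-- mainly spent.

-- Non-negative rational weights

-- Restricting to non-negative rationals makes multiplication monotone without side conditions.
infixl 6 _⊕_
infixl 7 _⊗_
infix 4 _≼_

record ℚ⁺ : Set where
  constructor mk
  field
    val     : ℚ
    .nonNeg : 0ℚ ℚ.≤ val

abstract
  val-injective : ∀ {a b : ℚ⁺} → ℚ⁺.val a ≡ ℚ⁺.val b → a ≡ b
  val-injective {mk _ _} {mk _ _} refl = refl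

  _⊕_ _⊗_ : ℚ⁺ → ℚ⁺ → ℚ⁺
  mk p p≥0 ⊕ mk q q≥0 = mk (p ℚ.+ q) (ℚ.+-mono-≤ p≥0 q≥0)
  mk p p≥0 ⊗ mk q q≥0 = mk (p ℚ.* q)
    (subst (ℚ._≤ p ℚ.* q) (ℚ.*-zeroʳ p) (ℚ.*-monoˡ-≤-nonNeg p {{ℚ.nonNegative p≥0}} q≥0))

  𝟘 𝟙 : ℚ⁺
  𝟘 = mk 0ℚ ℚ.≤-refl
  𝟙 = mk 1ℚ (ℚ.<⇒≤ (ℚ.positive⁻¹ 1ℚ))

  _≼_ : ℚ⁺ → ℚ⁺ → Set
  a ≼ b = ℚ⁺.val a ℚ.≤ ℚ⁺.val b

  ⊕-⊗-isCommutativeSemiring : IsCommutativeSemiring _≡_ _⊕_ _⊗_ 𝟘 𝟙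
  ⊕-⊗-isCommutativeSemiring = record
    { isSemiring = record
      { isSemiringWithoutAnnihilatingZero = record
        { +-isCommutativeMonoid = record
          { isMonoid = record
            { isSemigroup = record
              { isMagma = record { isEquivalence = isEquivalence ; ∙-cong = cong₂ _⊕_ }
              ; assoc = λ (mk p _) (mk q _) (mk r _) → val-injective (ℚ.+-assoc p q r) }
            ; identity = (λ (mk p _) → val-injective (ℚ.+-identityˡ p))
                       , (λ (mk p _) → val-injective (ℚ.+-identityʳ p)) }
          ; comm = λ (mk p _) (mk q _) → val-injective (ℚ.+-comm p q) }
        ; *-cong = cong₂ _⊗_
        ; *-assoc = λ (mk p _) (mk q _) (mk r _) → val-injective (ℚ.*-assoc p q r)
        ; *-identity = (λ (mk p _) → val-injective (ℚ.*-identityˡ p))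
                     , (λ (mk p _) → val-injective (ℚ.*-identityʳ p))
        ; distrib = (λ (mk p _) (mk q _) (mk r _) → val-injective (ℚ.*-distribˡ-+ p q r))
                  , (λ (mk p _) (mk q _) (mk r _) → val-injective (ℚ.*-distribʳ-+ p q r)) }
      ; zero = (λ (mk p _) → val-injective (ℚ.*-zeroˡ p))
             , (λ (mk p _) → val-injective (ℚ.*-zeroʳ p)) }
    ; *-comm = λ (mk p _) (mk q _) → val-injective (ℚ.*-comm p q) }

  ≼-refl : ∀ {a} → a ≼ a
  ≼-refl = ℚ.≤-refl

  ≼-trans : ∀ {a b c} → a ≼ b → b ≼ c → a ≼ c
  ≼-trans = ℚ.≤-trans

  ≼-total : ∀ a b → a ≼ b ⊎ b ≼ a
  ≼-total a b = ℚ.≤-total (ℚ⁺.val a) (ℚ⁺.val b)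

  𝟘≼ : ∀ a → 𝟘 ≼ a
  𝟘≼ (mk p p≥0) = recompute (0ℚ ℚ.≤? p) p≥0

  ⊕-mono : ∀ {a b c d} → a ≼ b → c ≼ d → a ⊕ c ≼ b ⊕ d
  ⊕-mono = ℚ.+-mono-≤

  ⊗-monoʳ : ∀ c {a b} → a ≼ b → c ⊗ a ≼ c ⊗ b
  ⊗-monoʳ c@(mk r r≥0) a≼b = ℚ.*-monoˡ-≤-nonNeg r {{ℚ.nonNegative (𝟘≼ c)}} a≼b

  ⊕-cancelˡ : ∀ a {b c} → a ⊕ b ≼ a ⊕ c → b ≼ c
  ⊕-cancelˡ (mk p _) {mk q _} {mk r _} p+q≤p+r =
    subst₂ ℚ._≤_ (drop q) (drop r) (ℚ.+-monoʳ-≤ (ℚ.- p) p+q≤p+r)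
    where
    drop : ∀ x → (ℚ.- p) ℚ.+ (p ℚ.+ x) ≡ x
    drop x = trans (sym (ℚ.+-assoc (ℚ.- p) p x))
      (trans (cong (ℚ._+ x) (ℚ.+-inverseˡ p)) (ℚ.+-identityˡ x))

  𝟙⋠𝟘 : ¬ 𝟙 ≼ 𝟘
  𝟙⋠𝟘 1≤0 = ℚ.<-irrefl refl (ℚ.<-≤-trans (ℚ.positive⁻¹ 1ℚ) 1≤0)

  difference : ∀ {a b} → a ≼ b → ∃ λ δ → b ≡ a ⊕ δ
  difference {mk p _} {mk q _} p≤q =
    mk (q ℚ.- p) (subst (ℚ._≤ q ℚ.- p) (ℚ.+-inverseʳ p) (ℚ.+-monoˡ-≤ (ℚ.- p) p≤q)) ,
    val-injective (sym (trans (cong (p ℚ.+_) (ℚ.+-comm q (ℚ.- p)))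
      (trans (sym (ℚ.+-assoc p (ℚ.- p) q))
        (trans (cong (ℚ._+ q) (ℚ.+-inverseʳ p)) (ℚ.+-identityˡ q)))))

ι : ℕ → ℚ⁺
ι zero    = 𝟘
ι (suc n) = 𝟙 ⊕ ι n

abstract
  inverse : ∀ n → ∃ λ a → ι (suc n) ⊗ a ≡ 𝟙
  inverse n = mk r (ℚ.<⇒≤ r>0) , val-injective (ℚ.*-inverseʳ q)
    where
    q : ℚ
    q = ℚ⁺.val (ι (suc n))
    instance
      q-positive : ℚ.Positive q
      q-positive = ℚ.positive (ℚ.+-mono-<-≤ (ℚ.positive⁻¹ 1ℚ) (𝟘≼ (ι n)))
      q-nonZero : ℚ.NonZero q
      q-nonZero = ℚ.pos⇒nonZero q
    r : ℚ
    r = ℚ.1/ q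
    r>0 : 0ℚ ℚ.< r
    r>0 = ℚ.positive⁻¹ r {{ℚ.1/pos⇒pos q}}

-- 1/n, with 1/0 = 0.
inv : ℕ → ℚ⁺
inv zero    = 𝟘
inv (suc n) = proj₁ (inverse n)

ι-inv : ∀ n → 1 ≤ n → ι n ⊗ inv n ≡ 𝟙
ι-inv (suc n) _ = proj₂ (inverse n)

⊕-⊗-commutativeSemiring : CommutativeSemiring 0ℓ 0ℓ
⊕-⊗-commutativeSemiring = record { isCommutativeSemiring = ⊕-⊗-isCommutativeSemiring }

open CommutativeSemiring ⊕-⊗-commutativeSemiring public
  using ()
  renaming
    ( +-assoc to ⊕-assoc ; +-comm to ⊕-comm ; +-identityˡ to ⊕-identityˡ ; +-identityʳ to ⊕-identityʳ
    ; *-assoc to ⊗-assoc ; *-comm to ⊗-comm ; *-identityˡ to ⊗-identityˡ ; *-identityʳ to ⊗-identityʳ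
    ; distribˡ to ⊗-distribˡ ; distribʳ to ⊗-distribʳ ; zeroˡ to ⊗-zeroˡ ; zeroʳ to ⊗-zeroʳ )

open import Algebra.Solver.Ring.NaturalCoefficients.Default ⊕-⊗-commutativeSemiring public
  using (solve; _:=_; _:+_; _:*_; con)

≼-preorder : Preorder 0ℓ 0ℓ 0ℓ
≼-preorder = record
  { Carrier = ℚ⁺ ; _≈_ = _≡_ ; _≲_ = _≼_
  ; isPreorder = record
    { isEquivalence = isEquivalence ; reflexive = λ { refl → ≼-refl } ; trans = ≼-trans } }

module ≼-Reasoning = PreorderReasoning ≼-preorder

≼-reflexive : ∀ {a b} → a ≡ b → a ≼ b
≼-reflexive refl = ≼-refl

⊗-mono : ∀ {a b c d} → a ≼ b → c ≼ d → a ⊗ c ≼ b ⊗ d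
⊗-mono {a} {b} {c} {d} a≼b c≼d =
  ≼-trans (⊗-monoʳ a c≼d) (subst₂ _≼_ (⊗-comm d a) (⊗-comm d b) (⊗-monoʳ d a≼b))

⊗-monoˡ : ∀ c {a b} → a ≼ b → a ⊗ c ≼ b ⊗ c
⊗-monoˡ c a≼b = ⊗-mono a≼b ≼-refl

⊕-monoʳ : ∀ c {a b} → a ≼ b → c ⊕ a ≼ c ⊕ b
⊕-monoʳ c = ⊕-mono ≼-refl

a≼a⊕b : ∀ a b → a ≼ a ⊕ b
a≼a⊕b a b = subst (_≼ a ⊕ b) (⊕-identityʳ a) (⊕-monoʳ a (𝟘≼ b))

b≼a⊕b : ∀ a b → b ≼ a ⊕ b
b≼a⊕b a b = subst (b ≼_) (⊕-comm b a) (a≼a⊕b b a)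

𝟘≼𝟙 : 𝟘 ≼ 𝟙
𝟘≼𝟙 = 𝟘≼ 𝟙

ι-+ : ∀ m n → ι (m + n) ≡ ι m ⊕ ι n
ι-+ zero    n = sym (⊕-identityˡ (ι n))
ι-+ (suc m) n = trans (cong (𝟙 ⊕_) (ι-+ m n)) (sym (⊕-assoc 𝟙 (ι m) (ι n)))

ι-* : ∀ m n → ι (m * n) ≡ ι m ⊗ ι n
ι-* zero    n = sym (⊗-zeroˡ (ι n))
ι-* (suc m) n = begin
  ι (n + m * n)          ≡⟨ ι-+ n (m * n) ⟩
  ι n ⊕ ι (m * n)        ≡⟨ cong₂ _⊕_ (sym (⊗-identityˡ (ι n))) (ι-* m n) ⟩
  𝟙 ⊗ ι n ⊕ ι m ⊗ ι n    ≡⟨ sym (⊗-distribʳ (ι n) 𝟙 (ι m)) ⟩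
  (𝟙 ⊕ ι m) ⊗ ι n        ∎
  where open ≡-Reasoning

ι-1 : ι 1 ≡ 𝟙
ι-1 = ⊕-identityʳ 𝟙

ι-mono : ∀ {m n} → m ≤ n → ι m ≼ ι n
ι-mono z≤n       = 𝟘≼ _
ι-mono (s≤s m≤n) = ⊕-monoʳ 𝟙 (ι-mono m≤n)

ι-cancel : ∀ m n → ι m ≼ ι n → m ≤ n
ι-cancel zero    n       _   = z≤n
ι-cancel (suc m) zero    1+m≼0 = ⊥-elim (𝟙⋠𝟘 (≼-trans (a≼a⊕b 𝟙 (ι m)) 1+m≼0))
ι-cancel (suc m) (suc n) le  = s≤s (ι-cancel m n (⊕-cancelˡ 𝟙 le))

inv-ι-≼ : ∀ n → ι n ⊗ inv n ≼ 𝟙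
inv-ι-≼ zero    = subst (_≼ 𝟙) (sym (⊗-zeroˡ 𝟘)) 𝟘≼𝟙
inv-ι-≼ (suc n) = ≼-reflexive (ι-inv (suc n) (s≤s z≤n))

infixr 8 _↑_
_↑_ : ℚ⁺ → ℕ → ℚ⁺
a ↑ zero  = 𝟙
a ↑ suc n = a ⊗ a ↑ n

↑-+ : ∀ a m n → a ↑ (m + n) ≡ a ↑ m ⊗ a ↑ n
↑-+ a zero    n = sym (⊗-identityˡ _)
↑-+ a (suc m) n = trans (cong (a ⊗_) (↑-+ a m n)) (sym (⊗-assoc a _ _))

↑-⊗ : ∀ a b n → (a ⊗ b) ↑ n ≡ a ↑ n ⊗ b ↑ n
↑-⊗ a b zero    = sym (⊗-identityˡ 𝟙)
↑-⊗ a b (suc n) = trans (cong ((a ⊗ b) ⊗_) (↑-⊗ a b n))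
  (solve 4 (λ x y u v → (x :* y) :* (u :* v) := (x :* u) :* (y :* v)) refl a b (a ↑ n) (b ↑ n))

𝟙-↑ : ∀ n → 𝟙 ↑ n ≡ 𝟙
𝟙-↑ zero    = refl
𝟙-↑ (suc n) = trans (⊗-identityˡ _) (𝟙-↑ n)

↑-mono : ∀ {a b} n → a ≼ b → a ↑ n ≼ b ↑ n
↑-mono zero    a≼b = ≼-refl
↑-mono (suc n) a≼b = ⊗-mono a≼b (↑-mono n a≼b)

↑-monoʳ : ∀ {a m n} → 𝟙 ≼ a → m ≤ n → a ↑ m ≼ a ↑ n
↑-monoʳ {a} {n = n} 1≼a z≤n       = subst (_≼ a ↑ n) (𝟙-↑ n) (↑-mono n 1≼a)
↑-monoʳ {a} 1≼a (s≤s m≤n) = ⊗-monoʳ a (↑-monoʳ 1≼a m≤n)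

ι-^ : ∀ m n → ι (m ^ n) ≡ ι m ↑ n
ι-^ m zero    = ι-1
ι-^ m (suc n) = trans (ι-* m (m ^ n)) (cong (ι m ⊗_) (ι-^ m n))

1≼ι : ∀ {n} → 1 ≤ n → 𝟙 ≼ ι n
1≼ι {n} 1≤n = subst (_≼ ι n) ι-1 (ι-mono 1≤n)

bernoulli : ∀ n y → 𝟙 ⊕ ι n ⊗ y ≼ (𝟙 ⊕ y) ↑ n
bernoulli zero    y = ≼-reflexive (trans (cong (𝟙 ⊕_) (⊗-zeroˡ y)) (⊕-identityʳ 𝟙))
bernoulli (suc n) y = begin
  𝟙 ⊕ (𝟙 ⊕ ι n) ⊗ y                    ≲⟨ a≼a⊕b _ (ι n ⊗ y ⊗ y) ⟩
  𝟙 ⊕ (𝟙 ⊕ ι n) ⊗ y ⊕ ι n ⊗ y ⊗ y      ≡⟨ expand ⟩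
  (𝟙 ⊕ y) ⊗ (𝟙 ⊕ ι n ⊗ y)              ≲⟨ ⊗-monoʳ (𝟙 ⊕ y) (bernoulli n y) ⟩
  (𝟙 ⊕ y) ⊗ (𝟙 ⊕ y) ↑ n                ∎
  where
  open ≼-Reasoning
  expand : 𝟙 ⊕ (𝟙 ⊕ ι n) ⊗ y ⊕ ι n ⊗ y ⊗ y ≡ (𝟙 ⊕ y) ⊗ (𝟙 ⊕ ι n ⊗ y)
  expand =
    solve 2 (λ m z → con 1 :+ (con 1 :+ m) :* z :+ m :* z :* z
                   := (con 1 :+ z) :* (con 1 :+ m :* z)) refl (ι n) y

⊗-exchange : ∀ a b c → a ⊗ (b ⊗ c) ≡ b ⊗ (a ⊗ c)
⊗-exchange = solve 3 (λ a b c → a :* (b :* c) := b :* (a :* c)) refl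

⊗-cancelˡ-ι : ∀ n → 1 ≤ n → ∀ {a b} → ι n ⊗ a ≼ ι n ⊗ b → a ≼ b
⊗-cancelˡ-ι n 1≤n {a} {b} le = subst₂ _≼_ (drop a) (drop b) (⊗-monoʳ (inv n) le)
  where
  drop : ∀ x → inv n ⊗ (ι n ⊗ x) ≡ x
  drop x = trans (sym (⊗-assoc _ _ _)) (trans (cong (_⊗ x) (trans (⊗-comm _ _) (ι-inv n 1≤n))) (⊗-identityˡ x))

-- Sums and means over lists

∑ : {A : Set} → List A → (A → ℚ⁺) → ℚ⁺
∑ []       f = 𝟘
∑ (x ∷ xs) f = f x ⊕ ∑ xs f

⟪_⟫ : Bool → ℚ⁺
⟪ true ⟫  = 𝟙
⟪ false ⟫ = 𝟘

count : {A : Set} → (A → Bool) → List A → ℕ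
count p xs = length (filterᵇ p xs)

⟪⟫≼𝟙 : ∀ b → ⟪ b ⟫ ≼ 𝟙
⟪⟫≼𝟙 true  = ≼-refl
⟪⟫≼𝟙 false = 𝟘≼𝟙

⟪⟫-mono : ∀ {b c} → (T b → T c) → ⟪ b ⟫ ≼ ⟪ c ⟫
⟪⟫-mono {false} {c}     _  = 𝟘≼ ⟪ c ⟫
⟪⟫-mono {true}  {true}  _  = ≼-refl
⟪⟫-mono {true}  {false} bc = ⊥-elim (bc tt)

⟪⟫-∧ : ∀ b c → ⟪ b ∧ c ⟫ ≡ ⟪ b ⟫ ⊗ ⟪ c ⟫
⟪⟫-∧ true  c = sym (⊗-identityˡ _)
⟪⟫-∧ false c = sym (⊗-zeroˡ _)

module _ {A : Set} where

  ∑-cong : ∀ xs {f g : A → ℚ⁺} → (∀ x → f x ≡ g x) → ∑ xs f ≡ ∑ xs g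
  ∑-cong []       f≡g = refl
  ∑-cong (x ∷ xs) f≡g = cong₂ _⊕_ (f≡g x) (∑-cong xs f≡g)

  ∑-mono : ∀ xs {f g : A → ℚ⁺} → (∀ x → f x ≼ g x) → ∑ xs f ≼ ∑ xs g
  ∑-mono []       f≼g = ≼-refl
  ∑-mono (x ∷ xs) f≼g = ⊕-mono (f≼g x) (∑-mono xs f≼g)

  ∑-⊕ : ∀ xs (f g : A → ℚ⁺) → ∑ xs (λ x → f x ⊕ g x) ≡ ∑ xs f ⊕ ∑ xs g
  ∑-⊕ []       f g = sym (⊕-identityˡ 𝟘)
  ∑-⊕ (x ∷ xs) f g = trans (cong ((f x ⊕ g x) ⊕_) (∑-⊕ xs f g))
    (solve 4 (λ a b c d → (a :+ b) :+ (c :+ d) := (a :+ c) :+ (b :+ d)) refl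
      (f x) (g x) (∑ xs f) (∑ xs g))

  ∑-⊗ˡ : ∀ xs c (f : A → ℚ⁺) → ∑ xs (λ x → c ⊗ f x) ≡ c ⊗ ∑ xs f
  ∑-⊗ˡ []       c f = sym (⊗-zeroʳ c)
  ∑-⊗ˡ (x ∷ xs) c f = trans (cong (c ⊗ f x ⊕_) (∑-⊗ˡ xs c f)) (sym (⊗-distribˡ c (f x) (∑ xs f)))

  ∑-const : ∀ (xs : List A) c → ∑ xs (λ _ → c) ≡ ι (length xs) ⊗ c
  ∑-const []       c = sym (⊗-zeroˡ c)
  ∑-const (x ∷ xs) c = trans (cong₂ _⊕_ (sym (⊗-identityˡ c)) (∑-const xs c))
    (sym (⊗-distribʳ c 𝟙 (ι (length xs))))

  ∑-++ : ∀ xs ys (f : A → ℚ⁺) → ∑ (xs ++ ys) f ≡ ∑ xs f ⊕ ∑ ys f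
  ∑-++ []       ys f = sym (⊕-identityˡ _)
  ∑-++ (x ∷ xs) ys f = trans (cong (f x ⊕_) (∑-++ xs ys f)) (sym (⊕-assoc (f x) _ _))

  ∑-map : ∀ {B : Set} (g : B → A) xs (f : A → ℚ⁺) → ∑ (map g xs) f ≡ ∑ xs (λ x → f (g x))
  ∑-map g []       f = refl
  ∑-map g (x ∷ xs) f = cong (f (g x) ⊕_) (∑-map g xs f)

  ∑-⟪⟫ : ∀ (p : A → Bool) xs → ∑ xs (λ x → ⟪ p x ⟫) ≡ ι (count p xs)
  ∑-⟪⟫ p []       = refl
  ∑-⟪⟫ p (x ∷ xs) with p x
  ... | true  = cong (𝟙 ⊕_) (∑-⟪⟫ p xs)
  ... | false = trans (⊕-identityˡ _) (∑-⟪⟫ p xs)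

  ∑-filter : ∀ (p : A → Bool) xs (f : A → ℚ⁺) → ∑ (filterᵇ p xs) f ≡ ∑ xs (λ x → ⟪ p x ⟫ ⊗ f x)
  ∑-filter p []       f = refl
  ∑-filter p (x ∷ xs) f with p x
  ... | true  = cong₂ _⊕_ (sym (⊗-identityˡ (f x))) (∑-filter p xs f)
  ... | false = trans (∑-filter p xs f) (sym (trans (cong (_⊕ _) (⊗-zeroˡ (f x))) (⊕-identityˡ _)))

  ∈-≼-∑ : ∀ {xs x} (f : A → ℚ⁺) → x ∈ xs → f x ≼ ∑ xs f
  ∈-≼-∑ f (here refl) = a≼a⊕b _ _
  ∈-≼-∑ f (there x∈)  = ≼-trans (∈-≼-∑ f x∈) (b≼a⊕b _ _)

  ι-sum : ∀ (f : A → ℕ) xs → ι (sum (map f xs)) ≡ ∑ xs (λ x → ι (f x))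
  ι-sum f []       = refl
  ι-sum f (x ∷ xs) = trans (ι-+ (f x) _) (cong (ι (f x) ⊕_) (ι-sum f xs))

  minimiser : ∀ x xs (f : A → ℚ⁺) → ∃ λ y → y ∈ x ∷ xs × ι (length (x ∷ xs)) ⊗ f y ≼ ∑ (x ∷ xs) f
  minimiser x []       f = x , here refl ,
    ≼-reflexive (trans (cong (_⊗ f x) ι-1) (trans (⊗-identityˡ _) (sym (⊕-identityʳ _))))
  minimiser x (x′ ∷ xs) f with minimiser x′ xs f
  ... | y , y∈ , bound with ≼-total (f x) (f y)
  ...   | inj₁ fx≼fy = x , here refl , (begin
          (𝟙 ⊕ ι (length (x′ ∷ xs))) ⊗ f x           ≡⟨ ⊗-distribʳ (f x) 𝟙 _ ⟩
          𝟙 ⊗ f x ⊕ ι (length (x′ ∷ xs)) ⊗ f x       ≲⟨ ⊕-mono (≼-reflexive (⊗-identityˡ (f x)))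
                                                          (≼-trans (⊗-monoʳ _ fx≼fy) bound) ⟩
          f x ⊕ ∑ (x′ ∷ xs) f                        ∎)
          where open ≼-Reasoning
  ...   | inj₂ fy≼fx = y , there y∈ , (begin
          (𝟙 ⊕ ι (length (x′ ∷ xs))) ⊗ f y           ≡⟨ ⊗-distribʳ (f y) 𝟙 _ ⟩
          𝟙 ⊗ f y ⊕ ι (length (x′ ∷ xs)) ⊗ f y       ≲⟨ ⊕-mono (≼-trans (≼-reflexive (⊗-identityˡ (f y))) fy≼fx)
                                                          bound ⟩
          f x ⊕ ∑ (x′ ∷ xs) f                        ∎)
          where open ≼-Reasoning

∑-swap : ∀ {A B : Set} (xs : List A) (ys : List B) (f : A → B → ℚ⁺) →
  ∑ xs (λ x → ∑ ys (f x)) ≡ ∑ ys (λ y → ∑ xs (λ x → f x y))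
∑-swap []       ys f = sym (trans (∑-const ys 𝟘) (⊗-zeroʳ _))
∑-swap (x ∷ xs) ys f = trans (cong (∑ ys (f x) ⊕_) (∑-swap xs ys f))
  (sym (∑-⊕ ys (f x) (λ y → ∑ xs (λ x′ → f x′ y))))

∑-cartesianProductWith : ∀ {A B C : Set} (g : A → B → C) xs ys f →
  ∑ (cartesianProductWith g xs ys) f ≡ ∑ xs (λ x → ∑ ys (λ y → f (g x y)))
∑-cartesianProductWith g []       ys f = refl
∑-cartesianProductWith g (x ∷ xs) ys f = trans (∑-++ (map (g x) ys) _ f)
  (cong₂ _⊕_ (∑-map (g x) ys f) (∑-cartesianProductWith g xs ys f))

vecs : {A : Set} → List A → ∀ m → List (Vec A m)
vecs xs zero    = [] ∷ []
vecs xs (suc m) = cartesianProductWith _∷_ xs (vecs xs m)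

length-cartesianProductWith : ∀ {A B C : Set} (g : A → B → C) xs ys →
  length (cartesianProductWith g xs ys) ≡ length xs * length ys
length-cartesianProductWith g []       ys = refl
length-cartesianProductWith g (x ∷ xs) ys = trans (length-++ (map (g x) ys))
  (cong₂ _+_ (length-map (g x) ys) (length-cartesianProductWith g xs ys))

length-vecs : ∀ {A : Set} (xs : List A) m → length (vecs xs m) ≡ length xs ^ m
length-vecs xs zero    = refl
length-vecs xs (suc m) = trans (length-cartesianProductWith _∷_ xs (vecs xs m))
  (cong (length xs *_) (length-vecs xs m))

∑-vecs-suc : ∀ {A : Set} (xs : List A) m (f : Vec A (suc m) → ℚ⁺) →
  ∑ (vecs xs (suc m)) f ≡ ∑ xs (λ x → ∑ (vecs xs m) (λ v → f (x ∷ v)))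
∑-vecs-suc xs m f = ∑-cartesianProductWith _∷_ xs (vecs xs m) f

∑-vecs-+ : ∀ {A : Set} (xs : List A) m n (f : Vec A (m + n) → ℚ⁺) →
  ∑ (vecs xs (m + n)) f ≡ ∑ (vecs xs m) (λ u → ∑ (vecs xs n) (λ v → f (u Vec.++ v)))
∑-vecs-+ xs zero    n f = sym (⊕-identityʳ _)
∑-vecs-+ xs (suc m) n f = begin
  ∑ (vecs xs (suc m + n)) f                                              ≡⟨ ∑-vecs-suc xs (m + n) f ⟩
  ∑ xs (λ x → ∑ (vecs xs (m + n)) (λ w → f (x ∷ w)))
    ≡⟨ ∑-cong xs (λ x → ∑-vecs-+ xs m n (λ w → f (x ∷ w))) ⟩
  ∑ xs (λ x → ∑ (vecs xs m) (λ u → ∑ (vecs xs n) (λ v → f (x ∷ u Vec.++ v))))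
    ≡⟨ sym (∑-vecs-suc xs m _) ⟩
  ∑ (vecs xs (suc m)) (λ u → ∑ (vecs xs n) (λ v → f (u Vec.++ v)))        ∎
  where open ≡-Reasoning

∑-vecs-concat : ∀ {A : Set} (xs : List A) t r (f : Vec A (r * t) → ℚ⁺) →
  ∑ (vecs xs (r * t)) f ≡ ∑ (vecs (vecs xs t) r) (λ Z → f (Vec.concat Z))
∑-vecs-concat xs t zero    f = refl
∑-vecs-concat xs t (suc r) f = begin
  ∑ (vecs xs (t + r * t)) f                                                 ≡⟨ ∑-vecs-+ xs t (r * t) f ⟩
  ∑ (vecs xs t) (λ y → ∑ (vecs xs (r * t)) (λ w → f (y Vec.++ w)))
    ≡⟨ ∑-cong (vecs xs t) (λ y → ∑-vecs-concat xs t r (λ w → f (y Vec.++ w))) ⟩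
  ∑ (vecs xs t) (λ y → ∑ (vecs (vecs xs t) r) (λ Z → f (y Vec.++ Vec.concat Z)))
    ≡⟨ sym (∑-vecs-suc (vecs xs t) r _) ⟩
  ∑ (vecs (vecs xs t) (suc r)) (λ Z → f (Vec.concat Z))                     ∎
  where open ≡-Reasoning

-- On the right every vector arises once for each old value of its `i`-th entry. This is the
-- counting form of the fact that one block is uniform given the others.
∑-resample : ∀ {A : Set} (xs : List A) r (i : Fin r) (f : Vec A r → ℚ⁺) →
  ι (length xs) ⊗ ∑ (vecs xs r) f ≡ ∑ (vecs xs r) (λ Z → ∑ xs (λ y → f (Z [ i ]≔ y)))
∑-resample xs (suc r) zero f = sym (begin
  ∑ (vecs xs (suc r)) (λ Z → ∑ xs (λ y → f (Z [ zero ]≔ y)))        ≡⟨ ∑-vecs-suc xs r _ ⟩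
  ∑ xs (λ _ → ∑ (vecs xs r) (λ v → ∑ xs (λ y → f (y ∷ v))))         ≡⟨ ∑-const xs _ ⟩
  ι (length xs) ⊗ ∑ (vecs xs r) (λ v → ∑ xs (λ y → f (y ∷ v)))
    ≡⟨ cong (ι (length xs) ⊗_) (∑-swap (vecs xs r) xs (λ v y → f (y ∷ v))) ⟩
  ι (length xs) ⊗ ∑ xs (λ y → ∑ (vecs xs r) (λ v → f (y ∷ v)))
    ≡⟨ cong (ι (length xs) ⊗_) (sym (∑-vecs-suc xs r f)) ⟩
  ι (length xs) ⊗ ∑ (vecs xs (suc r)) f                             ∎)
  where open ≡-Reasoning
∑-resample xs (suc r) (suc i) f = begin
  ι (length xs) ⊗ ∑ (vecs xs (suc r)) f
    ≡⟨ cong (ι (length xs) ⊗_) (∑-vecs-suc xs r f) ⟩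
  ι (length xs) ⊗ ∑ xs (λ x → ∑ (vecs xs r) (λ v → f (x ∷ v)))
    ≡⟨ sym (∑-⊗ˡ xs _ _) ⟩
  ∑ xs (λ x → ι (length xs) ⊗ ∑ (vecs xs r) (λ v → f (x ∷ v)))
    ≡⟨ ∑-cong xs (λ x → ∑-resample xs r i (λ v → f (x ∷ v))) ⟩
  ∑ xs (λ x → ∑ (vecs xs r) (λ v → ∑ xs (λ y → f (x ∷ v [ i ]≔ y))))
    ≡⟨ sym (∑-vecs-suc xs r _) ⟩
  ∑ (vecs xs (suc r)) (λ Z → ∑ xs (λ y → f (Z [ suc i ]≔ y)))       ∎
  where open ≡-Reasoning

every : {A : Set} → (A → Bool) → ∀ {m} → Vec A m → Bool
every p []      = true
every p (x ∷ v) = p x ∧ every p v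

∑-vecs-every : ∀ {A : Set} (p : A → Bool) (xs : List A) t →
  ∑ (vecs xs t) (λ v → ⟪ every p v ⟫) ≡ ι (count p xs) ↑ t
∑-vecs-every p xs zero    = ⊕-identityʳ 𝟙
∑-vecs-every p xs (suc t) = begin
  ∑ (vecs xs (suc t)) (λ v → ⟪ every p v ⟫)                  ≡⟨ ∑-vecs-suc xs t _ ⟩
  ∑ xs (λ x → ∑ (vecs xs t) (λ v → ⟪ p x ∧ every p v ⟫))
    ≡⟨ ∑-cong xs (λ x → trans (∑-cong (vecs xs t) (λ v → ⟪⟫-∧ (p x) (every p v)))
                              (∑-⊗ˡ (vecs xs t) ⟪ p x ⟫ _)) ⟩
  ∑ xs (λ x → ⟪ p x ⟫ ⊗ ∑ (vecs xs t) (λ v → ⟪ every p v ⟫))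
    ≡⟨ ∑-cong xs (λ x → trans (cong (⟪ p x ⟫ ⊗_) (∑-vecs-every p xs t)) (⊗-comm _ _)) ⟩
  ∑ xs (λ x → ι (count p xs) ↑ t ⊗ ⟪ p x ⟫)                  ≡⟨ ∑-⊗ˡ xs _ _ ⟩
  ι (count p xs) ↑ t ⊗ ∑ xs (λ x → ⟪ p x ⟫)                  ≡⟨ cong (ι (count p xs) ↑ t ⊗_) (∑-⟪⟫ p xs) ⟩
  ι (count p xs) ↑ t ⊗ ι (count p xs)                        ≡⟨ ⊗-comm _ _ ⟩
  ι (count p xs) ↑ suc t                                     ∎
  where open ≡-Reasoning

filterᵇ-true : ∀ {A : Set} (xs : List A) → filterᵇ (λ _ → true) xs ≡ xs
filterᵇ-true []       = refl
filterᵇ-true (x ∷ xs) = cong (x ∷_) (filterᵇ-true xs)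

-- The value is 0 if no element satisfies p.
mean : {A : Set} → List A → (A → Bool) → (A → ℚ⁺) → ℚ⁺
mean xs p F = inv (count p xs) ⊗ ∑ xs (λ x → ⟪ p x ⟫ ⊗ F x)

module _ {A : Set} (xs : List A) (p : A → Bool) where

  mean-mono : ∀ {F G} → (∀ x → F x ≼ G x) → mean xs p F ≼ mean xs p G
  mean-mono F≼G = ⊗-monoʳ _ (∑-mono xs λ x → ⊗-monoʳ ⟪ p x ⟫ (F≼G x))

  mean-cong : ∀ {F G} → (∀ x → F x ≡ G x) → mean xs p F ≡ mean xs p G
  mean-cong F≡G = cong (inv (count p xs) ⊗_) (∑-cong xs λ x → cong (⟪ p x ⟫ ⊗_) (F≡G x))

  mean-⊕ : ∀ F G → mean xs p (λ x → F x ⊕ G x) ≡ mean xs p F ⊕ mean xs p G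
  mean-⊕ F G = trans
    (cong (inv (count p xs) ⊗_) (trans (∑-cong xs λ x → ⊗-distribˡ ⟪ p x ⟫ (F x) (G x)) (∑-⊕ xs _ _)))
    (⊗-distribˡ _ _ _)

  mean-⊗ : ∀ c F → mean xs p (λ x → c ⊗ F x) ≡ c ⊗ mean xs p F
  mean-⊗ c F = trans
    (cong (inv (count p xs) ⊗_) (trans (∑-cong xs λ x → ⊗-exchange ⟪ p x ⟫ c (F x)) (∑-⊗ˡ xs c _)))
    (⊗-exchange _ c _)

  -- Equality can fail, since the mean is zero when nothing satisfies `p`. Such lost mass does no
  -- harm to upper bounds; it matters only when an outcome is extracted.
  mean-const : ∀ c → mean xs p (λ _ → c) ≼ c
  mean-const c = begin
    inv (count p xs) ⊗ ∑ xs (λ x → ⟪ p x ⟫ ⊗ c)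
      ≡⟨ cong (inv (count p xs) ⊗_) (trans (∑-cong xs λ x → ⊗-comm ⟪ p x ⟫ c)
           (trans (∑-⊗ˡ xs c _) (cong (c ⊗_) (∑-⟪⟫ p xs)))) ⟩
    inv (count p xs) ⊗ (c ⊗ ι (count p xs))
      ≡⟨ solve 3 (λ u v w → u :* (v :* w) := (w :* u) :* v) refl (inv (count p xs)) c (ι (count p xs)) ⟩
    ι (count p xs) ⊗ inv (count p xs) ⊗ c
      ≲⟨ ⊗-monoˡ c (inv-ι-≼ (count p xs)) ⟩
    𝟙 ⊗ c ≡⟨ ⊗-identityˡ c ⟩
    c ∎
    where open ≼-Reasoning

  mean-attained : ∀ F → 1 ≤ count p xs → ∃ λ x → T (p x) × F x ≼ mean xs p F
  mean-attained F 1≤c with filterᵇ p xs in eq | 1≤c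
  ... | z ∷ zs | _ with minimiser z zs F
  ...   | y , y∈ , bound = y , py , ⊗-cancelˡ-ι (length (z ∷ zs)) (s≤s z≤n) (begin
          ι m ⊗ F y                          ≲⟨ bound ⟩
          ∑ (z ∷ zs) F                       ≡⟨ trans (cong (λ l → ∑ l F) (sym eq)) (∑-filter p xs F) ⟩
          ∑ xs (λ x → ⟪ p x ⟫ ⊗ F x)         ≡⟨ sym (trans (cong (_⊗ _) (ι-inv m (s≤s z≤n))) (⊗-identityˡ _)) ⟩
          ι m ⊗ inv m ⊗ ∑ xs (λ x → ⟪ p x ⟫ ⊗ F x)   ≡⟨ ⊗-assoc _ _ _ ⟩
          ι m ⊗ (inv m ⊗ ∑ xs (λ x → ⟪ p x ⟫ ⊗ F x)) ∎)
    where
    open ≼-Reasoning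
    m = length (z ∷ zs)
    py : T (p y)
    py = proj₂ (∈-filter⁻ (Bool.T? ∘ p) {xs = xs} (subst (y ∈_) (sym eq) y∈))

-- Counting cliques

T-∧ˡ : ∀ {x y} → T (x ∧ y) → T x
T-∧ˡ = proj₁ ∘ Equivalence.to Bool.T-∧

T-∧ʳ : ∀ {x y} → T (x ∧ y) → T y
T-∧ʳ {x} = proj₂ ∘ Equivalence.to (Bool.T-∧ {x})

T-∧⁺ : ∀ {x y} → T x → T y → T (x ∧ y)
T-∧⁺ p q = Equivalence.from Bool.T-∧ (p , q)

filterᵇ-∧ : ∀ {A : Set} (p q : A → Bool) xs →
  filterᵇ p (filterᵇ q xs) ≡ filterᵇ (λ x → q x ∧ p x) xs
filterᵇ-∧ p q []       = refl
filterᵇ-∧ p q (x ∷ xs) with q x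
... | false = filterᵇ-∧ p q xs
... | true with p x
...   | true  = cong (x ∷_) (filterᵇ-∧ p q xs)
...   | false = filterᵇ-∧ p q xs

filterᵇ-cong : ∀ {A : Set} {p q : A → Bool} → (∀ x → p x ≡ q x) → ∀ xs → filterᵇ p xs ≡ filterᵇ q xs
filterᵇ-cong         p≡q []       = refl
filterᵇ-cong {q = q} p≡q (x ∷ xs) rewrite p≡q x with q x
... | true  = cong (x ∷_) (filterᵇ-cong p≡q xs)
... | false = filterᵇ-cong p≡q xs

filterᵇ-comm : ∀ {A : Set} (p q : A → Bool) xs →
  filterᵇ p (filterᵇ q xs) ≡ filterᵇ q (filterᵇ p xs)
filterᵇ-comm p q xs = trans (filterᵇ-∧ p q xs)
  (trans (filterᵇ-cong (λ x → Bool.∧-comm (q x) (p x)) xs) (sym (filterᵇ-∧ q p xs)))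

count-complement : ∀ {A : Set} (p : A → Bool) xs → count p xs + count (not ∘ p) xs ≡ length xs
count-complement p []       = refl
count-complement p (x ∷ xs) with p x
... | true  = cong suc (count-complement p xs)
... | false = trans (ℕ.+-suc _ _) (cong suc (count-complement p xs))

sum-map-mono : ∀ {A : Set} {f g : A → ℕ} → (∀ x → f x ≤ g x) → ∀ xs → sum (map f xs) ≤ sum (map g xs)
sum-map-mono f≤g []       = z≤n
sum-map-mono f≤g (x ∷ xs) = ℕ.+-mono-≤ (f≤g x) (sum-map-mono f≤g xs)

sum-map-filter : ∀ {A : Set} (f : A → ℕ) p xs → sum (map f (filterᵇ p xs)) ≤ sum (map f xs)
sum-map-filter f p []       = z≤n
sum-map-filter f p (x ∷ xs) with p x
... | true  = ℕ.+-monoʳ-≤ (f x) (sum-map-filter f p xs)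
... | false = ℕ.≤-trans (sum-map-filter f p xs) (ℕ.m≤n+m _ (f x))

*-^ : ∀ k m n → (m * n) ^ k ≡ m ^ k * n ^ k
*-^ zero    m n = refl
*-^ (suc k) m n = trans (cong (m * n *_) (*-^ k m n)) (interchange m n (m ^ k) (n ^ k))
  where
  interchange : ∀ a b c d → a * b * (c * d) ≡ a * c * (b * d)
  interchange = solve-∀

half-or-half : ∀ x y {n} → n ≤ x + y → n ≤ 2 * x ⊎ n ≤ 2 * y
half-or-half x y n≤x+y with ℕ.≤-total x y
... | inj₁ x≤y = inj₂ (ℕ.≤-trans n≤x+y
        (ℕ.≤-trans (ℕ.+-monoˡ-≤ y x≤y) (ℕ.≤-reflexive (cong (y +_) (sym (ℕ.+-identityʳ y))))))
... | inj₂ y≤x = inj₁ (ℕ.≤-trans n≤x+y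
        (ℕ.≤-trans (ℕ.+-monoʳ-≤ x y≤x) (ℕ.≤-reflexive (cong (x +_) (sym (ℕ.+-identityʳ x))))))

module _ {V : Set} (b : V → V → Bool) where

  -- Sequences are counted, so repetitions are allowed and the diagonal of b matters.
  cliques : ℕ → List V → ℕ
  cliques zero    S = 1
  cliques (suc m) S = sum (map (λ z → cliques m (filterᵇ (b z) S)) S)

  cliques-filter : ∀ m p S → cliques m (filterᵇ p S) ≤ cliques m S
  cliques-filter zero    p S = ℕ.≤-refl
  cliques-filter (suc m) p S = ℕ.≤-trans
    (sum-map-filter (λ z → cliques m (filterᵇ (b z) (filterᵇ p S))) p S)
    (sum-map-mono (λ z → subst (λ R → cliques m R ≤ cliques m (filterᵇ (b z) S))
      (filterᵇ-comm p (b z) S) (cliques-filter m p (filterᵇ (b z) S))) S)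

  -- The predicate `q` accumulates adjacency to the earlier entries, so that the test unfolds in
  -- step with `cliques`.
  clique : (V → Bool) → ∀ {m} → Vec V m → Bool
  clique q []      = true
  clique q (z ∷ v) = q z ∧ clique (λ x → q x ∧ b z x) v

  ι-cliques : ∀ m q xs → ι (cliques m (filterᵇ q xs)) ≡ ∑ (vecs xs m) (λ v → ⟪ clique q v ⟫)
  ι-cliques zero    q xs = refl
  ι-cliques (suc m) q xs = begin
    ι (sum (map (λ z → cliques m (filterᵇ (b z) (filterᵇ q xs))) (filterᵇ q xs)))
      ≡⟨ ι-sum _ (filterᵇ q xs) ⟩
    ∑ (filterᵇ q xs) (λ z → ι (cliques m (filterᵇ (b z) (filterᵇ q xs))))
      ≡⟨ ∑-filter q xs _ ⟩
    ∑ xs (λ z → ⟪ q z ⟫ ⊗ ι (cliques m (filterᵇ (b z) (filterᵇ q xs))))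
      ≡⟨ ∑-cong xs step ⟩
    ∑ xs (λ z → ∑ (vecs xs m) (λ v → ⟪ clique q (z ∷ v) ⟫))
      ≡⟨ sym (∑-vecs-suc xs m _) ⟩
    ∑ (vecs xs (suc m)) (λ v → ⟪ clique q v ⟫)                          ∎
    where
    open ≡-Reasoning
    step : ∀ z → ⟪ q z ⟫ ⊗ ι (cliques m (filterᵇ (b z) (filterᵇ q xs))) ≡
                 ∑ (vecs xs m) (λ v → ⟪ clique q (z ∷ v) ⟫)
    step z = begin
      ⟪ q z ⟫ ⊗ ι (cliques m (filterᵇ (b z) (filterᵇ q xs)))
        ≡⟨ cong (λ R → ⟪ q z ⟫ ⊗ ι (cliques m R)) (filterᵇ-∧ (b z) q xs) ⟩
      ⟪ q z ⟫ ⊗ ι (cliques m (filterᵇ (λ x → q x ∧ b z x) xs))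
        ≡⟨ cong (⟪ q z ⟫ ⊗_) (ι-cliques m _ xs) ⟩
      ⟪ q z ⟫ ⊗ ∑ (vecs xs m) (λ v → ⟪ clique (λ x → q x ∧ b z x) v ⟫)
        ≡⟨ sym (∑-⊗ˡ (vecs xs m) ⟪ q z ⟫ _) ⟩
      ∑ (vecs xs m) (λ v → ⟪ q z ⟫ ⊗ ⟪ clique (λ x → q x ∧ b z x) v ⟫)
        ≡⟨ ∑-cong (vecs xs m) (λ v → sym (⟪⟫-∧ (q z) _)) ⟩
      ∑ (vecs xs m) (λ v → ⟪ clique q (z ∷ v) ⟫) ∎

  clique-mono : ∀ {q q′ : V → Bool} → (∀ x → T (q x) → T (q′ x)) → ∀ {m} (v : Vec V m) →
    T (clique q v) → T (clique q′ v)
  clique-mono q⊆q′ []      _ = tt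
  clique-mono {q} {q′} q⊆q′ (z ∷ v) c = T-∧⁺ (q⊆q′ z (T-∧ˡ c))
    (clique-mono (λ x qx → T-∧⁺ (q⊆q′ x (T-∧ˡ qx)) (T-∧ʳ {q x} qx)) v (T-∧ʳ {q z} c))

  clique-++ʳ : ∀ q {m n} (u : Vec V m) (v : Vec V n) → T (clique q (u Vec.++ v)) → T (clique q v)
  clique-++ʳ q []      v c = c
  clique-++ʳ q (z ∷ u) v c = clique-mono (λ x → T-∧ˡ) v
    (clique-++ʳ (λ x → q x ∧ b z x) u v (T-∧ʳ {q z} c))

  clique-++-lookup : ∀ q {m n} (u : Vec V m) (v : Vec V n) → T (clique q (u Vec.++ v)) →
    ∀ k → T (q (lookup u k)) × T (clique (λ x → b (lookup u k) x) v)
  clique-++-lookup q (z ∷ u) v c zero = T-∧ˡ c ,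
    clique-mono (λ x → T-∧ʳ {q x}) v (clique-++ʳ _ u v (T-∧ʳ {q z} c))
  clique-++-lookup q (z ∷ u) v c (suc k) with clique-++-lookup _ u v (T-∧ʳ {q z} c) k
  ... | qk , ck = T-∧ˡ qk , ck

  clique-concat-lookup : ∀ q {t r} (Z : Vec (Vec V t) r) → T (clique q (Vec.concat Z)) →
    ∀ j l → T (q (lookup (lookup Z j) l))
  clique-concat-lookup q (y ∷ Z) c zero    l = proj₁ (clique-++-lookup q y (Vec.concat Z) c l)
  clique-concat-lookup q (y ∷ Z) c (suc j) l =
    clique-concat-lookup q Z (clique-++ʳ q y (Vec.concat Z) c) j l

  -- A clique sequence records adjacency only from earlier to later entries; symmetry supplies the
  -- pairs of blocks in the other order.
  clique-blocks : (∀ x y → b x y ≡ b y x) → ∀ q {t r} (Z : Vec (Vec V t) r) →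
    T (clique q (Vec.concat Z)) → ∀ i j → i ≢ j → ∀ k l →
    T (b (lookup (lookup Z i) k) (lookup (lookup Z j) l))
  clique-blocks b-sym q (y ∷ Z) c zero    zero    0≢0 k l = ⊥-elim (0≢0 refl)
  clique-blocks b-sym q (y ∷ Z) c zero    (suc j) _   k l =
    clique-concat-lookup _ Z (proj₂ (clique-++-lookup q y (Vec.concat Z) c k)) j l
  clique-blocks b-sym q (y ∷ Z) c (suc i) zero    _   k l = subst T (b-sym (lookup y l) _)
    (clique-concat-lookup _ Z (proj₂ (clique-++-lookup q y (Vec.concat Z) c l)) i k)
  clique-blocks b-sym q (y ∷ Z) c (suc i) (suc j) i≢j k l =
    clique-blocks b-sym q Z (clique-++ʳ q y (Vec.concat Z) c) i j (i≢j ∘ cong suc) k l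

module _ {V : Set} (a : V → V → Bool) (M : ℕ) where

  ā : V → V → Bool
  ā u v = not (a u v)

  1≤2^x*1 : ∀ x → 1 ≤ 2 ^ x * 1
  1≤2^x*1 x = ℕ.≤-trans (ℕ.m^n>0 2 x) (ℕ.≤-reflexive (sym (ℕ.*-identityʳ (2 ^ x))))

  -- The Erdős–Szekeres recursion, keeping track of the number of cliques it produces.
  many-cliques : ∀ m₁ m₂ → m₁ ≤ suc M → m₂ ≤ suc M → ∀ S →
    length S ^ m₁ ≤ 2 ^ (suc M * (m₁ + m₂)) * cliques a m₁ S ⊎
    length S ^ m₂ ≤ 2 ^ (suc M * (m₁ + m₂)) * cliques ā m₂ S
  many-cliques zero     m₂      _ _ S = inj₁ (1≤2^x*1 (suc M * (zero + m₂)))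
  many-cliques (suc m₁) zero    _ _ S = inj₂ (1≤2^x*1 (suc M * (suc m₁ + zero)))
  many-cliques (suc m₁) (suc m₂) (s≤s m₁≤M) (s≤s m₂≤M) S = conclude (collect S)
    where
    e = suc M * (m₁ + suc m₂)
    -- Passing to a neighbourhood of half the size costs 2^M for cliques one shorter, and keeping
    -- the more frequent kind of first vertex costs another 2. Together with `e` this is the
    -- exponent of the conclusion.
    H = 2 ^ (M + e)

    Enough : (V → V → Bool) → ℕ → Set
    Enough b m = length S ^ suc m ≤ 2 * H * cliques b (suc m) S

    scale : ∀ b z m m′ → length S ≤ 2 * count (b z) S → m ≤ m′ → ∀ {c} →
      count (b z) S ^ m ≤ 2 ^ e * c → length S ^ m ≤ 2 ^ (m′ + e) * c
    scale b z m m′ S≤2x m≤m′ {c} bound = begin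
      length S ^ m                 ≤⟨ ℕ.^-monoˡ-≤ m S≤2x ⟩
      (2 * x) ^ m                  ≡⟨ *-^ m 2 x ⟩
      2 ^ m * x ^ m                ≤⟨ ℕ.*-mono-≤ (ℕ.^-monoʳ-≤ 2 m≤m′) bound ⟩
      2 ^ m′ * (2 ^ e * c)         ≡⟨ sym (ℕ.*-assoc (2 ^ m′) _ _) ⟩
      2 ^ m′ * 2 ^ e * c           ≡⟨ cong (_* c) (sym (ℕ.^-distribˡ-+-* 2 m′ e)) ⟩
      2 ^ (m′ + e) * c             ∎
      where open ℕ.≤-Reasoning
            x = count (b z) S

    double : ∀ g m {c} → length S ≤ 2 * g → g * length S ^ m ≤ H * c → length S ^ suc m ≤ 2 * H * c
    double g m {c} S≤2g bound = begin
      length S * length S ^ m      ≤⟨ ℕ.*-monoˡ-≤ (length S ^ m) S≤2g ⟩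
      2 * g * length S ^ m         ≡⟨ ℕ.*-assoc 2 g _ ⟩
      2 * (g * length S ^ m)       ≤⟨ ℕ.*-monoʳ-≤ 2 bound ⟩
      2 * (H * c)                  ≡⟨ sym (ℕ.*-assoc 2 H c) ⟩
      2 * H * c                    ∎
      where open ℕ.≤-Reasoning

    -- The recursion runs in the majority neighbourhood of `z`. Either it finds cliques of the
    -- opposite colour, at full length and already enough, or cliques of the majority colour that
    -- `z` extends.
    classify : ∀ z →
      (Enough a m₁ ⊎ Enough ā m₂) ⊎
      (length S ^ m₁ ≤ H * cliques a m₁ (filterᵇ (a z) S) ⊎
       length S ^ m₂ ≤ H * cliques ā m₂ (filterᵇ (ā z) S))
    classify z with half-or-half (count (a z) S) (count (ā z) S)
        (ℕ.≤-reflexive (sym (count-complement (a z) S)))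
    ... | inj₁ S≤2x with many-cliques m₁ (suc m₂) (ℕ.m≤n⇒m≤1+n m₁≤M) (s≤s m₂≤M) (filterᵇ (a z) S)
    ...   | inj₁ bound = inj₂ (inj₁ (scale a z m₁ M S≤2x m₁≤M bound))
    ...   | inj₂ bound = inj₁ (inj₂ (scale a z (suc m₂) (suc M) S≤2x (s≤s m₂≤M)
              (ℕ.≤-trans bound (ℕ.*-monoʳ-≤ (2 ^ e) (cliques-filter ā (suc m₂) (a z) S)))))
    classify z | inj₂ S≤2y with many-cliques (suc m₁) m₂ (s≤s m₁≤M) (ℕ.m≤n⇒m≤1+n m₂≤M) (filterᵇ (ā z) S)
    ...   | inj₂ bound = inj₂ (inj₂ (scale ā z m₂ M S≤2y m₂≤M
              (subst (λ k → count (ā z) S ^ m₂ ≤ 2 ^ (suc M * k) * cliques ā m₂ (filterᵇ (ā z) S))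
                (sym (ℕ.+-suc m₁ m₂)) bound)))
    ...   | inj₁ bound = inj₁ (inj₁ (scale ā z (suc m₁) (suc M) S≤2y (s≤s m₁≤M) {cliques a (suc m₁) S}
              (ℕ.≤-trans
                (subst (λ k → count (ā z) S ^ suc m₁ ≤ 2 ^ (suc M * k) * cliques a (suc m₁) (filterᵇ (ā z) S))
                  (sym (ℕ.+-suc m₁ m₂)) bound)
                (ℕ.*-monoʳ-≤ (2 ^ e) (cliques-filter a (suc m₁) (ā z) S)))))

    -- As `cliques` is a sum over first vertices, it suffices to tally the vertices of each kind:
    -- one kind makes up at least half of `S`.
    collect : ∀ zs → (Enough a m₁ ⊎ Enough ā m₂) ⊎ (∃ λ g₁ → ∃ λ g₂ → g₁ + g₂ ≡ length zs ×
      g₁ * length S ^ m₁ ≤ H * sum (map (λ z → cliques a m₁ (filterᵇ (a z) S)) zs) ×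
      g₂ * length S ^ m₂ ≤ H * sum (map (λ z → cliques ā m₂ (filterᵇ (ā z) S)) zs))
    collect []       = inj₂ (0 , 0 , refl , z≤n , z≤n)
    collect (z ∷ zs) with classify z
    ... | inj₁ enough = inj₁ enough
    ... | inj₂ good with collect zs
    ...   | inj₁ enough = inj₁ enough
    ...   | inj₂ (g₁ , g₂ , g≡ , bound₁ , bound₂) with good
    ...     | inj₁ p = inj₂ (suc g₁ , g₂ , cong suc g≡ ,
                ℕ.≤-trans (ℕ.+-mono-≤ p bound₁) (ℕ.≤-reflexive (sym (ℕ.*-distribˡ-+ H _ _))) ,
                ℕ.≤-trans bound₂ (ℕ.*-monoʳ-≤ H (ℕ.m≤n+m _ _)))
    ...     | inj₂ p = inj₂ (g₁ , suc g₂ , trans (ℕ.+-suc g₁ g₂) (cong suc g≡) ,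
                ℕ.≤-trans bound₁ (ℕ.*-monoʳ-≤ H (ℕ.m≤n+m _ _)) ,
                ℕ.≤-trans (ℕ.+-mono-≤ p bound₂) (ℕ.≤-reflexive (sym (ℕ.*-distribˡ-+ H _ _))))

    conclude : (Enough a m₁ ⊎ Enough ā m₂) ⊎ (∃ λ g₁ → ∃ λ g₂ → g₁ + g₂ ≡ length S ×
        g₁ * length S ^ m₁ ≤ H * cliques a (suc m₁) S × g₂ * length S ^ m₂ ≤ H * cliques ā (suc m₂) S) →
      length S ^ suc m₁ ≤ 2 ^ (suc M * (suc m₁ + suc m₂)) * cliques a (suc m₁) S ⊎
      length S ^ suc m₂ ≤ 2 ^ (suc M * (suc m₁ + suc m₂)) * cliques ā (suc m₂) S
    conclude result rewrite cong (2 ^_) (ℕ.*-suc (suc M) (m₁ + suc m₂)) with result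
    ... | inj₁ (inj₁ p) = inj₁ p
    ... | inj₁ (inj₂ p) = inj₂ p
    ... | inj₂ (g₁ , g₂ , g≡ , bound₁ , bound₂) with half-or-half g₁ g₂ (ℕ.≤-reflexive (sym g≡))
    ...   | inj₁ S≤2g = inj₁ (double g₁ m₁ S≤2g bound₁)
    ...   | inj₂ S≤2g = inj₂ (double g₂ m₂ S≤2g bound₂)

-- Degeneracy orders

unique-⊆-length : ∀ {A : Set} {xs ys : List A} → Unique xs → (∀ {x} → x ∈ xs → x ∈ ys) →
  length xs ≤ length ys
unique-⊆-length []                xs⊆ys = z≤n
unique-⊆-length {xs = x ∷ xs} (x∉xs ∷ xs!) xs⊆ys with ∈-∃++ (xs⊆ys (here refl))
... | as , bs , refl = ℕ.≤-trans (s≤s (unique-⊆-length xs! xs⊆as++bs)) (ℕ.≤-reflexive size)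
  where
  xs⊆as++bs : ∀ {y} → y ∈ xs → y ∈ as ++ bs
  xs⊆as++bs y∈xs with ∈-++⁻ as (xs⊆ys (there y∈xs))
  ... | inj₁ y∈as         = ∈-++⁺ˡ y∈as
  ... | inj₂ (here y≡x)   = ⊥-elim (All.lookup x∉xs y∈xs (sym y≡x))
  ... | inj₂ (there y∈bs) = ∈-++⁺ʳ as y∈bs
  size : suc (length (as ++ bs)) ≡ length (as ++ x ∷ bs)
  size = trans (cong suc (length-++ as)) (trans (sym (ℕ.+-suc _ _)) (sym (length-++ as)))

-- The tail holds the vertices embedded earlier, so only earlier neighbours are counted.
BackDegree : {W : Set} → (W → W → Bool) → ℕ → List W → Set
BackDegree E d []      = ⊤
BackDegree E d (v ∷ L) = count (E v) L ≤ d × BackDegree E d L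

module _ {k : ℕ} (F : Graph k) where

  induced : Subset k → Subgraph F
  induced S = record
    { verts   = S
    ; edges   = λ u v → (lookup S u ∧ lookup S v) ∧ adj F u v
    ; e-sym   = λ u v → cong₂ _∧_ (Bool.∧-comm (lookup S u) (lookup S v)) (adjSym F u v)
    ; e-sub   = λ u v → T-∧ʳ {lookup S u ∧ lookup S v}
    ; e-verts = λ u v e → member u (T-∧ˡ (T-∧ˡ e)) , member v (T-∧ʳ {lookup S u} (T-∧ˡ e)) }
    where
    member : ∀ u → T (lookup S u) → u Subset.∈ S
    member u t = lookup⇒[]= u S (Equivalence.to Bool.T-≡ t)

  DegeneracyOrder : ℕ → Subset k → List (Fin k) → Set
  DegeneracyOrder d S L =
    (∀ {v} → v Subset.∈ S → v ∈ L) × (∀ {v} → v ∈ L → v Subset.∈ S) × Unique L × BackDegree (adj F) d L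

  -- A vertex of small degree in the subgraph induced on `S` can be embedded last, after all the
  -- others. The number `m` serves termination only.
  degeneracyOrder : ∀ {d} → Degenerate d F → ∀ m S → Subset.∣ S ∣ ≤ m → ∃ (DegeneracyOrder d S)
  degeneracyOrder {d} deg m S ∣S∣≤m with Subset.nonempty? S
  ... | no  empty = [] , (λ v∈S → ⊥-elim (empty (_ , v∈S))) , (λ ()) , [] , tt
  ... | yes nonempty with deg (induced S) nonempty
  ...   | v , v∈S , degree≤d = extend m ∣S∣≤m
    where
    S′ = S Subset.- v

    v∉S′ : v Subset.∉ S′
    -- Removing `v` a second time would shrink `S′` strictly, yet it changes nothing.
    v∉S′ v∈S′ = ℕ.<-irrefl (cong Subset.∣_∣ (Subset.p─q─q≡p─q S Subset.⁅ v ⁆)) (Subset.x∈p⇒∣p-x∣<∣p∣ v∈S′)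

    lookup-T : ∀ {u} → u Subset.∈ S → T (lookup S u)
    lookup-T u∈S = Equivalence.from Bool.T-≡ ([]=⇒lookup u∈S)

    extend : ∀ m → Subset.∣ S ∣ ≤ m → ∃ (DegeneracyOrder d S)
    extend zero    ∣S∣≤0 = ⊥-elim (ℕ.n≮0 (ℕ.<-≤-trans (Subset.x∈p⇒∣p-x∣<∣p∣ v∈S) ∣S∣≤0))
    extend (suc m) ∣S∣≤1+m
      with degeneracyOrder deg m S′ (ℕ.≤-pred (ℕ.≤-trans (Subset.x∈p⇒∣p-x∣<∣p∣ v∈S) ∣S∣≤1+m))
    ... | L , complete , sound , L! , back = v ∷ L , complete′ , sound′ , fresh ∷ L! , back-degree , back
      where
      sound′ : ∀ {u} → u ∈ v ∷ L → u Subset.∈ S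
      sound′ (here refl) = v∈S
      sound′ (there u∈L) = Subset.p─q⊆p S _ (sound u∈L)

      complete′ : ∀ {u} → u Subset.∈ S → u ∈ v ∷ L
      complete′ {u} u∈S with u ≟ v
      ... | yes u≡v = here u≡v
      ... | no  u≢v = there (complete (Subset.x∈p∧x≢y⇒x∈p-y u∈S u≢v))

      fresh : All (v ≢_) L
      fresh = All.tabulate λ u∈L v≡u → v∉S′ (subst (Subset._∈ S′) (sym v≡u) (sound u∈L))

      back-degree : count (adj F v) L ≤ d
      back-degree = ℕ.≤-trans
        (unique-⊆-length (Unique.filter⁺ (Bool.T? ∘ adj F v) L!) λ u∈ →
          let u∈L , v~u = ∈-filter⁻ (Bool.T? ∘ adj F v) {xs = L} u∈ in
          ∈-filter⁺ (Bool.T? ∘ edges (induced S) v) (∈-allFin _)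
            (T-∧⁺ (T-∧⁺ (lookup-T v∈S) (lookup-T (sound′ (there u∈L)))) v~u))
        degree≤d

  degenerate⇒order : ∀ {d} → Degenerate d F →
    ∃ λ L → (∀ v → v ∈ L) × Unique L × BackDegree (adj F) d L
  degenerate⇒order deg with degeneracyOrder deg _ Subset.⊤ ℕ.≤-refl
  ... | L , complete , _ , L! , back = L , (λ v → complete Subset.∈⊤) , L! , back

-- Complete blocks and dependent random choice

every-lookup : ∀ {A : Set} (p : A → Bool) {m} (v : Vec A m) → T (every p v) → ∀ l → T (p (lookup v l))
every-lookup p (x ∷ v) h zero    = T-∧ˡ h
every-lookup p (x ∷ v) h (suc l) = every-lookup p v (T-∧ʳ {p x} h) l

every-intro : ∀ {A : Set} (p : A → Bool) {m} (v : Vec A m) → (∀ l → T (p (lookup v l))) → T (every p v)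
every-intro p []      h = tt
every-intro p (x ∷ v) h = T-∧⁺ (h zero) (every-intro p v (h ∘ suc))

every-cong : ∀ {A : Set} {p q : A → Bool} → (∀ x → p x ≡ q x) → ∀ {m} (v : Vec A m) → every p v ≡ every q v
every-cong p≡q []      = refl
every-cong p≡q (x ∷ v) = cong₂ _∧_ (p≡q x) (every-cong p≡q v)

count-cong : ∀ {A : Set} {p q : A → Bool} → (∀ x → p x ≡ q x) → ∀ xs → count p xs ≡ count q xs
count-cong p≡q xs = cong length (filterᵇ-cong p≡q xs)

-- A variant of `vecs` with the length forgotten, because the tuples passed to `candidate` vary in
-- length.
lists : {A : Set} → List A → ℕ → List (List A)
lists xs zero    = [] ∷ []
lists xs (suc m) = cartesianProductWith _∷_ xs (lists xs m)

length-lists : ∀ {A : Set} (xs : List A) m → length (lists xs m) ≡ length xs ^ m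
length-lists xs zero    = refl
length-lists xs (suc m) = trans (length-cartesianProductWith _∷_ xs (lists xs m))
  (cong (length xs *_) (length-lists xs m))

module Blocks {V : Set} (xs : List V) (b : V → V → Bool) (b-sym : ∀ x y → b x y ≡ b y x) (t r : ℕ) where

  Z-type : Set
  Z-type = Vec (Vec V t) r

  adjacentTo : List V → V → Bool
  adjacentTo []      x = true
  adjacentTo (y ∷ T) x = b x y ∧ adjacentTo T x

  complete : Z-type → Bool
  complete Z = clique b (λ _ → true) (Vec.concat Z)

  outside : Fin r → Z-type → V → Fin r → Bool
  outside i Z x j = ⌊ j ≟ i ⌋ ∨ every (b x) (lookup Z j)

  part : Fin r → Z-type → V → Bool
  part i Z x = every (outside i Z x) (Vec.allFin r)

  candidate : Fin r → Z-type → List V → V → Bool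
  candidate i Z T x = part i Z x ∧ adjacentTo T x

  part-lookup : ∀ i Z x → T (part i Z x) → ∀ j → j ≢ i → ∀ l → T (b x (lookup (lookup Z j) l))
  part-lookup i Z x h j j≢i l with every-lookup (outside i Z x) (Vec.allFin r) h j
  ... | hj rewrite lookup-allFin j with j ≟ i
  ...   | yes j≡i = ⊥-elim (j≢i j≡i)
  ...   | no  _   = every-lookup (b x) (lookup Z j) hj l

  part-intro : ∀ i Z x → (∀ j → j ≢ i → ∀ l → T (b x (lookup (lookup Z j) l))) → T (part i Z x)
  part-intro i Z x h = every-intro (outside i Z x) (Vec.allFin r) λ j →
    subst (T ∘ outside i Z x) (sym (lookup-allFin j)) (at j)
    where
    at : ∀ j → T (outside i Z x j)
    at j with j ≟ i
    ... | yes _  = tt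
    ... | no j≢i = every-intro (b x) (lookup Z j) (h j j≢i)

  -- The `i`-th part looks only at the other blocks. Hence candidate sets stay fixed while the
  -- `i`-th block is resampled.
  part-update : ∀ i Z y x → part i (Z [ i ]≔ y) x ≡ part i Z x
  part-update i Z y x = every-cong at (Vec.allFin r)
    where
    at : ∀ j → outside i (Z [ i ]≔ y) x j ≡ outside i Z x j
    at j with j ≟ i
    ... | yes _  = refl
    ... | no j≢i = cong (every (b x)) (lookup∘update′ j≢i Z y)

  candidate-update : ∀ i Z y T x → candidate i (Z [ i ]≔ y) T x ≡ candidate i Z T x
  candidate-update i Z y T x = cong (_∧ adjacentTo T x) (part-update i Z y x)

  inParts : List (Fin r) → Z-type → List V → Bool
  inParts []       Z []      = true
  inParts (j ∷ js) Z (x ∷ T) = part j Z x ∧ inParts js Z T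
  inParts _        Z _       = false

  -- This makes tuples with few candidates unlikely: the i-th block would have to lie among them.
  block-candidates : ∀ i Z → T (complete Z) → ∀ js → All (_≢ i) js → ∀ U → T (inParts js Z U) →
    ∀ l → T (candidate i Z U (lookup (lookup Z i) l))
  block-candidates i Z c js js≢i U h l = T-∧⁺
    (part-intro i Z _ λ j j≢i l′ → clique-blocks b b-sym _ Z c i j (j≢i ∘ sym) l l′)
    (adjacent js js≢i U h)
    where
    z = lookup (lookup Z i) l
    adjacent : ∀ js → All (_≢ i) js → ∀ U → T (inParts js Z U) → T (adjacentTo U z)
    adjacent []       _              []      _ = tt
    adjacent (j ∷ js) (j≢i ∷ js≢i) (x ∷ U) h = T-∧⁺
      (subst T (b-sym x z) (part-lookup j Z x (T-∧ˡ h) i (j≢i ∘ sym) l))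
      (adjacent js js≢i U (T-∧ʳ {part j Z x} h))

  -- The floor of one is essential: `inv 0` is zero and would remove the penalty exactly where there
  -- are no candidates.
  positive-count : Fin r → Z-type → List V → ℕ
  positive-count i Z U = count (candidate i Z U) xs ⊔ 1

  inv-count : Fin r → Z-type → List V → ℚ⁺
  inv-count i Z U = inv (positive-count i Z U) ↑ t

  Zs : List Z-type
  Zs = vecs (vecs xs t) r

  -- After resampling, completeness forces all `t` entries of the new block into the candidate set
  -- of `U`. With c candidates this leaves at most c^t blocks, and the weight cancels that number,
  -- so each pair of `Z` and `U` contributes at most one.
  dependent-random-choice : ∀ i js → All (_≢ i) js →
    ι (length (vecs xs t)) ⊗
      ∑ Zs (λ Z → ⟪ complete Z ⟫ ⊗ ∑ (lists xs (length js)) (λ U → ⟪ inParts js Z U ⟫ ⊗ inv-count i Z U))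
    ≼ ι (length Zs) ⊗ ι (length (lists xs (length js)))
  dependent-random-choice i js js≢i = begin
    ι (length ys) ⊗ ∑ Zs F
      ≡⟨ ∑-resample ys r i F ⟩
    ∑ Zs (λ Z → ∑ ys (λ y → F (Z [ i ]≔ y)))
      ≲⟨ ∑-mono Zs (λ Z → ∑-mono ys (λ y → resampled Z y)) ⟩
    ∑ Zs (λ Z → ∑ ys (λ y → ∑ Us (λ U → inv-count i Z U ⊗ ⟪ every (candidate i Z U) y ⟫)))
      ≡⟨ ∑-cong Zs (λ Z → ∑-swap ys Us _) ⟩
    ∑ Zs (λ Z → ∑ Us (λ U → ∑ ys (λ y → inv-count i Z U ⊗ ⟪ every (candidate i Z U) y ⟫)))
      ≲⟨ ∑-mono Zs (λ Z → ∑-mono Us (λ U → total Z U)) ⟩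
    ∑ Zs (λ Z → ∑ Us (λ U → 𝟙))
      ≡⟨ ∑-const Zs _ ⟩
    ι (length Zs) ⊗ ∑ Us (λ U → 𝟙)
      ≡⟨ cong (ι (length Zs) ⊗_) (trans (∑-const Us 𝟙) (⊗-identityʳ _)) ⟩
    ι (length Zs) ⊗ ι (length Us) ∎
    where
    open ≼-Reasoning
    ys = vecs xs t
    Us = lists xs (length js)
    F : Z-type → ℚ⁺
    F Z = ⟪ complete Z ⟫ ⊗ ∑ Us (λ U → ⟪ inParts js Z U ⟫ ⊗ inv-count i Z U)

    total : ∀ Z U → ∑ ys (λ y → inv-count i Z U ⊗ ⟪ every (candidate i Z U) y ⟫) ≼ 𝟙
    total Z U = begin
      ∑ ys (λ y → inv-count i Z U ⊗ ⟪ every (candidate i Z U) y ⟫)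
        ≡⟨ ∑-⊗ˡ ys _ _ ⟩
      inv-count i Z U ⊗ ∑ ys (λ y → ⟪ every (candidate i Z U) y ⟫)
        ≡⟨ cong (inv-count i Z U ⊗_) (∑-vecs-every (candidate i Z U) xs t) ⟩
      inv c⁺ ↑ t ⊗ ι c ↑ t             ≡⟨ sym (↑-⊗ (inv c⁺) (ι c) t) ⟩
      (inv c⁺ ⊗ ι c) ↑ t               ≲⟨ ↑-mono t (⊗-monoʳ (inv c⁺) (ι-mono (ℕ.m≤m⊔n c 1))) ⟩
      (inv c⁺ ⊗ ι c⁺) ↑ t              ≲⟨ ↑-mono t (≼-trans (≼-reflexive (⊗-comm _ _)) (inv-ι-≼ c⁺)) ⟩
      𝟙 ↑ t                            ≡⟨ 𝟙-↑ t ⟩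
      𝟙                                ∎
      where c  = count (candidate i Z U) xs
            c⁺ = positive-count i Z U

    resampled : ∀ Z y → F (Z [ i ]≔ y) ≼ ∑ Us (λ U → inv-count i Z U ⊗ ⟪ every (candidate i Z U) y ⟫)
    resampled Z y = begin
      ⟪ complete Z′ ⟫ ⊗ ∑ Us (λ U → ⟪ inParts js Z′ U ⟫ ⊗ inv-count i Z′ U)
        ≡⟨ sym (∑-⊗ˡ Us _ _) ⟩
      ∑ Us (λ U → ⟪ complete Z′ ⟫ ⊗ (⟪ inParts js Z′ U ⟫ ⊗ inv-count i Z′ U))
        ≲⟨ ∑-mono Us at ⟩
      ∑ Us (λ U → inv-count i Z U ⊗ ⟪ every (candidate i Z U) y ⟫) ∎
      where
      Z′ = Z [ i ]≔ y
      hits : ∀ U → T (complete Z′ ∧ inParts js Z′ U) → T (every (candidate i Z U) y)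
      hits U h = every-intro (candidate i Z U) y λ l →
        subst T (candidate-update i Z y U _)
          (subst (λ w → T (candidate i Z′ U (lookup w l))) (lookup∘update i Z y)
            (block-candidates i Z′ (T-∧ˡ h) js js≢i U (T-∧ʳ {complete Z′} h) l))
      at : ∀ U → ⟪ complete Z′ ⟫ ⊗ (⟪ inParts js Z′ U ⟫ ⊗ inv-count i Z′ U) ≼
                 inv-count i Z U ⊗ ⟪ every (candidate i Z U) y ⟫
      at U = begin
        ⟪ complete Z′ ⟫ ⊗ (⟪ inParts js Z′ U ⟫ ⊗ inv-count i Z′ U)
          ≡⟨ sym (⊗-assoc _ _ _) ⟩
        ⟪ complete Z′ ⟫ ⊗ ⟪ inParts js Z′ U ⟫ ⊗ inv-count i Z′ U
          ≡⟨ cong₂ _⊗_ (sym (⟪⟫-∧ (complete Z′) _))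
               (cong (λ c → inv (c ⊔ 1) ↑ t) (count-cong (candidate-update i Z y U) xs)) ⟩
        ⟪ complete Z′ ∧ inParts js Z′ U ⟫ ⊗ inv-count i Z U
          ≲⟨ ⊗-monoˡ _ (⟪⟫-mono {complete Z′ ∧ inParts js Z′ U} (hits U)) ⟩
        ⟪ every (candidate i Z U) y ⟫ ⊗ inv-count i Z U
          ≡⟨ ⊗-comm _ _ ⟩
        inv-count i Z U ⊗ ⟪ every (candidate i Z U) y ⟫ ∎

-- The random embedding

2ab≼a²+b² : ∀ a b → a ⊗ b ⊕ a ⊗ b ≼ a ⊗ a ⊕ b ⊗ b
2ab≼a²+b² a b with ≼-total a b
... | inj₁ a≼b with difference a≼b
...   | δ , refl = ≼-trans (a≼a⊕b _ (δ ⊗ δ)) (≼-reflexive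
          (solve 2 (λ x y → x :* (x :+ y) :+ x :* (x :+ y) :+ y :* y := x :* x :+ (x :+ y) :*
              (x :+ y)) refl a δ))
2ab≼a²+b² a b | inj₂ b≼a with difference b≼a
...   | δ , refl = ≼-trans (a≼a⊕b _ (δ ⊗ δ)) (≼-reflexive
          (solve 2 (λ x y → (x :+ y) :* x :+ (x :+ y) :* x :+ y :* y := (x :+ y) :*
              (x :+ y) :+ x :* x) refl b δ))
∏ : List ℚ⁺ → ℚ⁺
∏ []       = 𝟙
∏ (a ∷ as) = a ⊗ ∏ as

-- The witness is the maximum of one and all factors. Being at least one, it can be raised to a
-- larger exponent; being one of these values, its power is a single term of the right-hand sum.
∏-≼-max : ∀ as → ∃ λ m → 𝟙 ≼ m × ∏ as ≼ m ↑ length as × (∀ s → m ↑ s ≼ 𝟙 ⊕ ∑ as (_↑ s))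
∏-≼-max []       = 𝟙 , ≼-refl , ≼-refl , λ s → ≼-reflexive (trans (𝟙-↑ s) (sym (⊕-identityʳ 𝟙)))
∏-≼-max (a ∷ as) with ∏-≼-max as
... | m , 𝟙≼m , ∏≼ , bound with ≼-total a m
...   | inj₁ a≼m = m , 𝟙≼m , ⊗-mono a≼m ∏≼ , λ s → ≼-trans (bound s) (⊕-monoʳ 𝟙 (b≼a⊕b _ _))
...   | inj₂ m≼a = a , ≼-trans 𝟙≼m m≼a , ⊗-monoʳ a (≼-trans ∏≼ (↑-mono (length as) m≼a)) ,
          λ s → ≼-trans (a≼a⊕b (a ↑ s) _) (b≼a⊕b 𝟙 _)

∏≼𝟙+∑↑ : ∀ as s → length as ≤ s → ∏ as ≼ 𝟙 ⊕ ∑ as (_↑ s)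
∏≼𝟙+∑↑ as s len≤s with ∏-≼-max as
... | m , 𝟙≼m , ∏≼ , bound = ≼-trans ∏≼ (≼-trans (↑-monoʳ 𝟙≼m len≤s) (bound s))

-- The arithmetic-geometric mean inequality for s α²/P and P/s.
weighted-am-gm : ∀ s → 1 ≤ s → ∀ α P P⁻¹ → P ⊗ P⁻¹ ≡ 𝟙 →
  α ⊕ α ≼ ι s ⊗ (α ⊗ α ⊗ P⁻¹) ⊕ inv s ⊗ P
weighted-am-gm s 1≤s α P P⁻¹ PP⁻¹≡𝟙 = begin
  α ⊕ α
    ≡⟨ sym (trans (cong₂ (λ u v → u ⊗ v ⊗ (α ⊕ α)) (ι-inv s 1≤s) PP⁻¹≡𝟙)
         (trans (cong (_⊗ (α ⊕ α)) (⊗-identityˡ 𝟙)) (⊗-identityˡ _))) ⟩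
  (σ ⊗ σ⁻¹) ⊗ (P ⊗ P⁻¹) ⊗ (α ⊕ α)
    ≡⟨ solve 5 (λ σ σ′ p p′ a → (σ :* σ′) :* (p :* p′) :* (a :+ a) :=
         (σ′ :* p′) :* ((σ :* a) :* p :+ (σ :* a) :* p)) refl σ σ⁻¹ P P⁻¹ α ⟩
  (σ⁻¹ ⊗ P⁻¹) ⊗ ((σ ⊗ α) ⊗ P ⊕ (σ ⊗ α) ⊗ P)
    ≲⟨ ⊗-monoʳ (σ⁻¹ ⊗ P⁻¹) (2ab≼a²+b² (σ ⊗ α) P) ⟩
  (σ⁻¹ ⊗ P⁻¹) ⊗ ((σ ⊗ α) ⊗ (σ ⊗ α) ⊕ P ⊗ P)
    ≡⟨ solve 5 (λ σ σ′ p p′ a → (σ′ :* p′) :* ((σ :* a) :* (σ :* a) :+ p :* p) :=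
         (σ :* σ′) :* (σ :* (a :* a :* p′)) :+ (p :* p′) :* (σ′ :* p)) refl σ σ⁻¹ P P⁻¹ α ⟩
  (σ ⊗ σ⁻¹) ⊗ (σ ⊗ (α ⊗ α ⊗ P⁻¹)) ⊕ (P ⊗ P⁻¹) ⊗ (σ⁻¹ ⊗ P)
    ≡⟨ cong₂ (λ u v → u ⊗ (σ ⊗ (α ⊗ α ⊗ P⁻¹)) ⊕ v ⊗ (σ⁻¹ ⊗ P)) (ι-inv s 1≤s) PP⁻¹≡𝟙 ⟩
  𝟙 ⊗ (σ ⊗ (α ⊗ α ⊗ P⁻¹)) ⊕ 𝟙 ⊗ (σ⁻¹ ⊗ P)
    ≡⟨ cong₂ _⊕_ (⊗-identityˡ _) (⊗-identityˡ _) ⟩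
  σ ⊗ (α ⊗ α ⊗ P⁻¹) ⊕ σ⁻¹ ⊗ P ∎
  where
  open ≼-Reasoning
  σ = ι s
  σ⁻¹ = inv s

module Process {V : Set} (xs : List V) (_≟_ : DecidableEquality V)
  (b : V → V → Bool) (b-sym : ∀ x y → b x y ≡ b y x) (t r : ℕ)
  {W : Set} (E : W → W → Bool) (χ : W → Fin r) (χ-proper : ∀ u v → T (E u v) → χ u ≢ χ v) where

  open Blocks xs b b-sym t r public

  select : (W → Bool) → (L : List W) → Vec V (length L) → List V
  select p []      []      = []
  select p (w ∷ L) (x ∷ f) = if p w then x ∷ select p L f else select p L f

  colours : (W → Bool) → List W → List (Fin r)
  colours p L = map χ (filterᵇ p L)

  colours-proper : ∀ w L → All (_≢ χ w) (colours (E w) L)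
  colours-proper w []      = []
  colours-proper w (u ∷ L) with E w u in eq
  ... | true  = (λ χu≡χw → χ-proper w u (Equivalence.from Bool.T-≡ eq) (sym χu≡χw)) ∷ colours-proper w L
  ... | false = colours-proper w L

  candidates : W → (L : List W) → Z-type → Vec V (length L) → V → Bool
  candidates w L Z f = candidate (χ w) Z (select (E w) L f)

  unused : ∀ {m} → Vec V m → V → Bool
  unused f x = every (λ y → not ⌊ x ≟ y ⌋) f

  enoughUnused : W → (L : List W) → Z-type → Vec V (length L) → Bool
  enoughUnused w L Z f =
    count (candidates w L Z f) xs ≤ᵇ 2 * count (λ x → candidates w L Z f x ∧ unused f x) xs

  -- The image of w is chosen among the unused candidates as long as these are at least half of
  -- all candidates; otherwise injectivity is given up.
  choices : W → (L : List W) → Z-type → Vec V (length L) → V → Bool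
  choices w L Z f x =
    if enoughUnused w L Z f then candidates w L Z f x ∧ unused f x else candidates w L Z f x

  choices⊆candidates : ∀ w L Z f x → T (choices w L Z f x) → T (candidates w L Z f x)
  choices⊆candidates w L Z f x h with enoughUnused w L Z f
  ... | true  = T-∧ˡ h
  ... | false = h

  many-choices : ∀ w L Z f → count (candidates w L Z f) xs ≤ 2 * count (choices w L Z f) xs
  many-choices w L Z f with enoughUnused w L Z f in eq
  ... | true  = ℕ.≤ᵇ⇒≤ _ _ (Equivalence.from Bool.T-≡ eq)
  ... | false = ℕ.m≤m+n _ _

  -- The expectation over a uniformly random complete Z and the random embedding of L, whose last
  -- element is embedded first.
  𝔼 : (L : List W) → (Z-type → Vec V (length L) → ℚ⁺) → ℚ⁺
  𝔼 []      F = mean Zs complete (λ Z → F Z [])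
  𝔼 (w ∷ L) F = 𝔼 L (λ Z f → mean xs (choices w L Z f) (λ x → F Z (x ∷ f)))

  𝔼-mono : ∀ L {F G} → (∀ Z f → F Z f ≼ G Z f) → 𝔼 L F ≼ 𝔼 L G
  𝔼-mono []      F≼G = mean-mono Zs complete λ Z → F≼G Z []
  𝔼-mono (w ∷ L) F≼G = 𝔼-mono L λ Z f → mean-mono xs (choices w L Z f) λ x → F≼G Z (x ∷ f)

  𝔼-cong : ∀ L {F G} → (∀ Z f → F Z f ≡ G Z f) → 𝔼 L F ≡ 𝔼 L G
  𝔼-cong []      F≡G = mean-cong Zs complete λ Z → F≡G Z []
  𝔼-cong (w ∷ L) F≡G = 𝔼-cong L λ Z f → mean-cong xs (choices w L Z f) λ x → F≡G Z (x ∷ f)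

  𝔼-⊕ : ∀ L F G → 𝔼 L (λ Z f → F Z f ⊕ G Z f) ≡ 𝔼 L F ⊕ 𝔼 L G
  𝔼-⊕ []      F G = mean-⊕ Zs complete _ _
  𝔼-⊕ (w ∷ L) F G = trans (𝔼-cong L λ Z f → mean-⊕ xs (choices w L Z f) _ _) (𝔼-⊕ L _ _)

  𝔼-⊗ : ∀ L c F → 𝔼 L (λ Z f → c ⊗ F Z f) ≡ c ⊗ 𝔼 L F
  𝔼-⊗ []      c F = mean-⊗ Zs complete c _
  𝔼-⊗ (w ∷ L) c F = trans (𝔼-cong L λ Z f → mean-⊗ xs (choices w L Z f) c _) (𝔼-⊗ L c _)

  𝔼-tail : ∀ w L F → 𝔼 (w ∷ L) (λ Z f → F Z (Vec.tail f)) ≼ 𝔼 L F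
  𝔼-tail w L F = 𝔼-mono L λ Z f → mean-const xs (choices w L Z f) (F Z f)

  𝔼-const : ∀ L c → 𝔼 L (λ _ _ → c) ≼ c
  𝔼-const []      c = mean-const Zs complete c
  𝔼-const (w ∷ L) c = ≼-trans (𝔼-tail w L (λ _ _ → c)) (𝔼-const L c)

  𝔼-∑ : ∀ L {A : Set} (ys : List A) (F : A → Z-type → Vec V (length L) → ℚ⁺) →
    𝔼 L (λ Z f → ∑ ys (λ y → F y Z f)) ≼ ∑ ys (λ y → 𝔼 L (F y))
  𝔼-∑ L []       F = 𝔼-const L 𝟘
  𝔼-∑ L (y ∷ ys) F = ≼-trans (≼-reflexive (𝔼-⊕ L (F y) _)) (⊕-monoʳ _ (𝔼-∑ L ys F))

  size : W → (L : List W) → Z-type → Vec V (length L) → ℕ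
  size w L Z f = positive-count (χ w) Z (select (E w) L f)

  sizes : (W → Bool) → (L : List W) → Z-type → Vec V (length L) → List ℕ
  sizes p []      Z []      = []
  sizes p (w ∷ L) Z (x ∷ f) = if p w then size w L Z f ∷ sizes p L Z f else sizes p L Z f

  sizes-length : ∀ p L Z f → length (sizes p L Z f) ≡ count p L
  sizes-length p []      Z []      = refl
  sizes-length p (w ∷ L) Z (x ∷ f) with p w
  ... | true  = cong suc (sizes-length p L Z f)
  ... | false = sizes-length p L Z f

  sizes-positive : ∀ p L Z f → All (1 ≤_) (sizes p L Z f)
  sizes-positive p []      Z []      = []
  sizes-positive p (w ∷ L) Z (x ∷ f) with p w
  ... | true  = ℕ.m≤n⊔m _ 1 ∷ sizes-positive p L Z f
  ... | false = sizes-positive p L Z f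

  -- No vertex is chosen with more than twice its probability under a uniform candidate. This factor
  -- is the whole price of avoiding used vertices, and it holds also in the fallback case.
  inv-choices : ∀ w L Z f → inv (count (choices w L Z f) xs) ⊗ ι (size w L Z f) ≼ ι 2
  inv-choices w L Z f = go (count (choices w L Z f) xs) (many-choices w L Z f)
    where
    c = count (candidates w L Z f) xs
    go : ∀ n → c ≤ 2 * n → inv n ⊗ ι (c ⊔ 1) ≼ ι 2
    go zero    _    = subst (_≼ ι 2) (sym (⊗-zeroˡ _)) (𝟘≼ (ι 2))
    go (suc n) c≤2n = begin
      inv (suc n) ⊗ ι (c ⊔ 1)
        ≲⟨ ⊗-monoʳ _ (ι-mono (ℕ.⊔-lub c≤2n (s≤s z≤n))) ⟩
      inv (suc n) ⊗ ι (2 * suc n)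
        ≡⟨ cong (inv (suc n) ⊗_) (ι-* 2 (suc n)) ⟩
      inv (suc n) ⊗ (ι 2 ⊗ ι (suc n))
        ≡⟨ solve 3 (λ u v w → u :* (v :* w) := (w :* u) :* v) refl (inv (suc n)) (ι 2) (ι (suc n)) ⟩
      ι (suc n) ⊗ inv (suc n) ⊗ ι 2
        ≡⟨ trans (cong (_⊗ ι 2) (ι-inv (suc n) (s≤s z≤n))) (⊗-identityˡ _) ⟩
      ι 2 ∎
      where open ≼-Reasoning

  module Moments (θ : ℕ) (θ≥1 : 1 ≤ θ) where

    h h⁻¹ : ℕ → ℚ⁺
    h c   = ι θ ⊗ inv c
    h⁻¹ c = ι c ⊗ inv θ

    h-h⁻¹ : ∀ c → 1 ≤ c → h c ⊗ h⁻¹ c ≡ 𝟙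
    h-h⁻¹ c c≥1 = begin
      ι θ ⊗ inv c ⊗ (ι c ⊗ inv θ)
        ≡⟨ solve 4 (λ p q u v → p :* q :* (u :* v) := (p :* v) :* (u :* q)) refl (ι θ) (inv c) (ι c) (inv θ) ⟩
      (ι θ ⊗ inv θ) ⊗ (ι c ⊗ inv c)
        ≡⟨ trans (cong₂ _⊗_ (ι-inv θ θ≥1) (ι-inv c c≥1)) (⊗-identityˡ 𝟙) ⟩
      𝟙 ∎
      where open ≡-Reasoning

    ∏h-∏h⁻¹ : ∀ {cs} → All (1 ≤_) cs → ∏ (map h cs) ⊗ ∏ (map h⁻¹ cs) ≡ 𝟙
    ∏h-∏h⁻¹ []                    = ⊗-identityˡ 𝟙
    ∏h-∏h⁻¹ {c ∷ cs} (c≥1 ∷ cs≥1) = trans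
      (solve 4 (λ p q u v → p :* q :* (u :* v) := (p :* u) :* (q :* v)) refl (h c) (∏ (map h cs)) (h⁻¹ c)
          (∏ (map h⁻¹ cs)))
      (trans (cong₂ _⊗_ (h-h⁻¹ c c≥1) (∏h-∏h⁻¹ cs≥1)) (⊗-identityˡ 𝟙))

    -- Only `Z` is averaged, the tuples are summed. Their normalisation is the power of `inv θ` in
    -- `change-of-measure`.
    uniform : List (Fin r) → (Z-type → List V → ℚ⁺) → ℚ⁺
    uniform js G = 𝔼 [] (λ Z _ → ∑ (lists xs (length js)) (λ U → ⟪ inParts js Z U ⟫ ⊗ G Z U))

    -- Weighted by the factors h⁻¹, the images of the selected vertices are dominated by independent
    -- uniformly random vertices.
    change-of-measure : ∀ p L G →
      𝔼 L (λ Z f → G Z (select p L f) ⊗ ∏ (map h⁻¹ (sizes p L Z f))) ≼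
      (ι 2 ⊗ inv θ) ↑ length (colours p L) ⊗ uniform (colours p L) G
    change-of-measure p [] G = ≼-reflexive (trans (𝔼-cong [] pointwise) (sym (⊗-identityˡ _)))
      where
      pointwise : ∀ Z f → G Z (select p [] f) ⊗ ∏ (map h⁻¹ (sizes p [] Z f)) ≡ 𝟙 ⊗ G Z [] ⊕ 𝟘
      pointwise Z [] = trans (⊗-identityʳ _) (sym (trans (⊕-identityʳ _) (⊗-identityˡ _)))
    change-of-measure p (w ∷ L) G with p w
    ... | false = ≼-trans (𝔼-tail w L (λ Z f → G Z (select p L f) ⊗ ∏ (map h⁻¹ (sizes p L Z f))))
                    (change-of-measure p L G)
    ... | true  = begin
      𝔼 L (λ Z f → mean xs (choices w L Z f) (λ x → G Z (x ∷ select p L f) ⊗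
          (h⁻¹ (size w L Z f) ⊗ ∏ (map h⁻¹ (sizes p L Z f)))))
        ≲⟨ 𝔼-mono L pointwise ⟩
      𝔼 L (λ Z f → G′ Z (select p L f) ⊗ ∏ (map h⁻¹ (sizes p L Z f)))
        ≲⟨ change-of-measure p L G′ ⟩
      ρ ↑ m ⊗ 𝔼 [] (λ Z _ → ∑ (lists xs m) (λ U → ⟪ inParts js Z U ⟫ ⊗ G′ Z U))
        ≡⟨ cong (ρ ↑ m ⊗_) (𝔼-cong [] (λ Z _ → recombine Z)) ⟩
      ρ ↑ m ⊗ 𝔼 [] (λ Z _ → ρ ⊗ ∑ (lists xs (suc m)) (λ U → ⟪ inParts (χ w ∷ js) Z U ⟫ ⊗ G Z U))
        ≡⟨ cong (ρ ↑ m ⊗_) (𝔼-⊗ [] ρ (λ Z _ → ∑ (lists xs (suc m))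
             (λ U → ⟪ inParts (χ w ∷ js) Z U ⟫ ⊗ G Z U))) ⟩
      ρ ↑ m ⊗ (ρ ⊗ uniform (χ w ∷ js) G)
        ≡⟨ solve 3 (λ u v z → u :* (v :* z) := (v :* u) :* z) refl (ρ ↑ m) ρ (uniform (χ w ∷ js) G) ⟩
      ρ ↑ suc m ⊗ uniform (χ w ∷ js) G ∎
      where
      open ≼-Reasoning
      ρ = ι 2 ⊗ inv θ
      js = colours p L
      m = length js
      G′ : Z-type → List V → ℚ⁺
      G′ Z U = ρ ⊗ ∑ xs (λ x → ⟪ part (χ w) Z x ⟫ ⊗ G Z (x ∷ U))

      pointwise : ∀ Z f → mean xs (choices w L Z f) (λ x → G Z (x ∷ select p L f) ⊗
          (h⁻¹ (size w L Z f) ⊗ ∏ (map h⁻¹ (sizes p L Z f)))) ≼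
        G′ Z (select p L f) ⊗ ∏ (map h⁻¹ (sizes p L Z f))
      pointwise Z f = begin
        inv d ⊗ ∑ xs (λ x → ⟪ D x ⟫ ⊗ (G Z (x ∷ U) ⊗ (ι c ⊗ inv θ ⊗ P)))
          ≡⟨ cong (inv d ⊗_) (∑-cong xs λ x →
               solve 4 (λ u v y z → u :* (v :* (y :* z)) := (y :* z) :* (u :* v)) refl ⟪ D x ⟫ (G Z (x ∷ U))
                   (ι c ⊗ inv θ) P) ⟩
        inv d ⊗ ∑ xs (λ x → ι c ⊗ inv θ ⊗ P ⊗ (⟪ D x ⟫ ⊗ G Z (x ∷ U)))
          ≡⟨ cong (inv d ⊗_) (∑-⊗ˡ xs _ _) ⟩
        inv d ⊗ (ι c ⊗ inv θ ⊗ P ⊗ ∑ xs (λ x → ⟪ D x ⟫ ⊗ G Z (x ∷ U)))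
          ≡⟨ solve 5 (λ u v y z q → u :* (v :* y :* z :* q) := (u :* v) :* y :* q :* z) refl
               (inv d) (ι c) (inv θ) P (∑ xs (λ x → ⟪ D x ⟫ ⊗ G Z (x ∷ U))) ⟩
        (inv d ⊗ ι c) ⊗ inv θ ⊗ ∑ xs (λ x → ⟪ D x ⟫ ⊗ G Z (x ∷ U)) ⊗ P
          -- The normalisation 1/d of the choice meets the weight c/θ. What is left is 2/θ times a
          -- sum over the whole part, in which the candidate set no longer occurs.
          ≲⟨ ⊗-monoˡ P (⊗-mono (⊗-monoˡ (inv θ) (inv-choices w L Z f))
               (∑-mono xs λ x → ⊗-monoˡ (G Z (x ∷ U)) (⟪⟫-mono {D x} {part (χ w) Z x} λ Dx →
                 T-∧ˡ {part (χ w) Z x} (choices⊆candidates w L Z f x Dx)))) ⟩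
        ι 2 ⊗ inv θ ⊗ ∑ xs (λ x → ⟪ part (χ w) Z x ⟫ ⊗ G Z (x ∷ U)) ⊗ P ∎
        where
        D = choices w L Z f
        d = count D xs
        c = size w L Z f
        U = select p L f
        P = ∏ (map h⁻¹ (sizes p L Z f))

      recombine : ∀ Z → ∑ (lists xs m) (λ U → ⟪ inParts js Z U ⟫ ⊗ G′ Z U) ≡
        ρ ⊗ ∑ (lists xs (suc m)) (λ U → ⟪ inParts (χ w ∷ js) Z U ⟫ ⊗ G Z U)
      recombine Z = begin-equality
        ∑ Us (λ U → ⟪ inParts js Z U ⟫ ⊗ (ρ ⊗ ∑ xs (λ x → ⟪ part (χ w) Z x ⟫ ⊗ G Z (x ∷ U))))
          ≡⟨ ∑-cong Us (λ U → trans
               (⊗-exchange ⟪ inParts js Z U ⟫ ρ _)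
               (cong (ρ ⊗_) (sym (∑-⊗ˡ xs ⟪ inParts js Z U ⟫ _)))) ⟩
        ∑ Us (λ U → ρ ⊗ ∑ xs (λ x → ⟪ inParts js Z U ⟫ ⊗ (⟪ part (χ w) Z x ⟫ ⊗ G Z (x ∷ U))))
          ≡⟨ ∑-⊗ˡ Us ρ _ ⟩
        ρ ⊗ ∑ Us (λ U → ∑ xs (λ x → ⟪ inParts js Z U ⟫ ⊗ (⟪ part (χ w) Z x ⟫ ⊗ G Z (x ∷ U))))
          ≡⟨ cong (ρ ⊗_) (∑-swap Us xs _) ⟩
        ρ ⊗ ∑ xs (λ x → ∑ Us (λ U → ⟪ inParts js Z U ⟫ ⊗ (⟪ part (χ w) Z x ⟫ ⊗ G Z (x ∷ U))))
          ≡⟨ cong (ρ ⊗_) (∑-cong xs λ x → ∑-cong Us λ U → trans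
               (solve 3 (λ u v y → u :* (v :* y) := (v :* u) :* y) refl ⟪ inParts js Z U ⟫ ⟪ part
                   (χ w) Z x ⟫ (G Z (x ∷ U)))
               (cong (_⊗ G Z (x ∷ U)) (sym (⟪⟫-∧ (part (χ w) Z x) (inParts js Z U))))) ⟩
        ρ ⊗ ∑ xs (λ x → ∑ Us (λ U → ⟪ inParts (χ w ∷ js) Z (x ∷ U) ⟫ ⊗ G Z (x ∷ U)))
          ≡⟨ cong (ρ ⊗_) (sym (∑-cartesianProductWith _∷_ xs Us _)) ⟩
        ρ ⊗ ∑ (lists xs (suc m)) (λ U → ⟪ inParts (χ w ∷ js) Z U ⟫ ⊗ G Z U) ∎
        where
        Us = lists xs m

    module _ (d : ℕ) where

      private
        s : ℕ
        s = suc d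

      moments : (W → Bool) → (L : List W) → Z-type → Vec V (length L) → ℚ⁺
      moments p L Z f = ∑ (map h (sizes p L Z f)) (_↑ s)

      -- The hypothesis on the host, in the weighted form that change-of-measure produces.
      Rare : Set
      Rare = ∀ i js → All (_≢ i) js → length js ≤ d →
        ι s ⊗ ((ι 2 ⊗ inv θ) ↑ length js ⊗
          uniform js (λ Z U → h (positive-count i Z U) ↑ s ⊗ h (positive-count i Z U) ↑ s)) ≼ 𝟙

      length-colours : ∀ p L → length (colours p L) ≡ count p L
      length-colours p L = length-map χ (filterᵇ p L)

      moment-step : Rare → ∀ w L → count (E w) L ≤ d → 𝔼 L (moments (E w) L) ≼ ι (count (E w) L) →
        𝔼 L (λ Z f → h (size w L Z f) ↑ s) ≼ 𝟙
      moment-step rare w L deg≤d ih = ⊗-cancelˡ-ι 2 (s≤s z≤n) (begin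
        ι 2 ⊗ 𝔼 L α
          ≡⟨ trans (⊗-distribʳ (𝔼 L α) 𝟙 (𝟙 ⊕ 𝟘)) (trans (cong₂ _⊕_ (⊗-identityˡ _)
               (trans (cong (_⊗ 𝔼 L α) ι-1) (⊗-identityˡ _))) (sym (𝔼-⊕ L α α))) ⟩
        𝔼 L (λ Z f → α Z f ⊕ α Z f)
          ≲⟨ 𝔼-mono L pointwise ⟩
        𝔼 L (λ Z f → ι s ⊗ X Z f ⊕ inv s ⊗ (𝟙 ⊕ moments (E w) L Z f))
          ≡⟨ trans (𝔼-⊕ L _ _) (cong₂ _⊕_ (𝔼-⊗ L (ι s) X) (𝔼-⊗ L (inv s) _)) ⟩
        ι s ⊗ 𝔼 L X ⊕ inv s ⊗ 𝔼 L (λ Z f → 𝟙 ⊕ moments (E w) L Z f)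
          -- The first summand is at most 1 by `rare`. The second is at most (1 + d)/s, and s = d +
          -- 1 makes this exactly 1, so the induction loses nothing.
          ≲⟨ ⊕-mono
               (≼-trans (⊗-monoʳ (ι s) (change-of-measure (E w) L G))
                 (rare (χ w) (colours (E w) L) (colours-proper w L)
                   (subst (_≤ d) (sym (length-colours (E w) L)) deg≤d)))
               (⊗-monoʳ (inv s) (≼-trans (≼-reflexive (𝔼-⊕ L (λ _ _ → 𝟙) _))
                 (⊕-mono (𝔼-const L 𝟙) (≼-trans ih (ι-mono deg≤d))))) ⟩
        𝟙 ⊕ inv s ⊗ ι s
          ≡⟨ cong (𝟙 ⊕_) (trans (⊗-comm _ _) (ι-inv s (s≤s z≤n))) ⟩
        𝟙 ⊕ 𝟙
          ≡⟨ sym (trans (⊗-identityʳ (ι 2)) (cong (𝟙 ⊕_) ι-1)) ⟩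
        ι 2 ⊗ 𝟙 ∎)
        where
        open ≼-Reasoning
        G : Z-type → List V → ℚ⁺
        G Z U = h (positive-count (χ w) Z U) ↑ s ⊗ h (positive-count (χ w) Z U) ↑ s
        α X : Z-type → Vec V (length L) → ℚ⁺
        α Z f = h (size w L Z f) ↑ s
        X Z f = G Z (select (E w) L f) ⊗ ∏ (map h⁻¹ (sizes (E w) L Z f))
        pointwise : ∀ Z f → α Z f ⊕ α Z f ≼ ι s ⊗ X Z f ⊕ inv s ⊗ (𝟙 ⊕ moments (E w) L Z f)
        pointwise Z f = ≼-trans
          (weighted-am-gm s (s≤s z≤n) (α Z f) (∏ (map h cs)) (∏ (map h⁻¹ cs))
              (∏h-∏h⁻¹ (sizes-positive (E w) L Z f)))
          (⊕-monoʳ _ (⊗-monoʳ (inv s) (∏≼𝟙+∑↑ (map h cs) s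
            (ℕ.≤-trans (ℕ.≤-reflexive (trans (length-map h cs) (sizes-length (E w) L Z f)))
              (ℕ.m≤n⇒m≤1+n deg≤d)))))
          where cs = sizes (E w) L Z f

      -- The predicate is arbitrary because the step for a vertex `w` needs the bound for its
      -- earlier neighbours, whereas the application sums over all vertices.
      moment-bound : Rare → ∀ L → BackDegree E d L → ∀ p → 𝔼 L (moments p L) ≼ ι (count p L)
      moment-bound rare []      _               p = ≼-trans
          (𝔼-mono [] {F = moments p []} {G = λ _ _ → 𝟘} λ { Z [] → ≼-refl }) (𝔼-const [] 𝟘)
      moment-bound rare (w ∷ L) (deg≤d , back) p with p w
      ... | false = ≼-trans (𝔼-tail w L (moments p L)) (moment-bound rare L back p)
      ... | true  = begin
        𝔼 (w ∷ L) (λ Z f → F Z (Vec.tail f))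
          ≲⟨ 𝔼-tail w L F ⟩
        𝔼 L F
          ≡⟨ 𝔼-⊕ L _ _ ⟩
        𝔼 L (λ Z f → h (size w L Z f) ↑ s) ⊕ 𝔼 L (moments p L)
          ≲⟨ ⊕-mono (moment-step rare w L deg≤d (moment-bound rare L back (E w))) (moment-bound rare L back p) ⟩
        𝟙 ⊕ ι (count p L) ∎
        where
        open ≼-Reasoning
        F : Z-type → Vec V (length L) → ℚ⁺
        F Z f = h (size w L Z f) ↑ s ⊕ moments p L Z f

-- Crowding

count-positive : ∀ {A : Set} (p : A → Bool) {xs x} → x ∈ xs → T (p x) → 1 ≤ count p xs
count-positive p {xs} x∈xs px with filterᵇ p xs | ∈-filter⁺ (Bool.T? ∘ p) x∈xs px
... | _ ∷ _ | _ = s≤s z≤n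

count-mono-+ : ∀ {A : Set} {p q s : A → Bool} → (∀ x → T (p x) → T (q x) ⊎ T (s x)) →
  ∀ xs → count p xs ≤ count q xs + count s xs
count-mono-+ {p = p} {q} {s} p⊆q∪s xs = ι-cancel _ _ (begin
  ι (count p xs)                                        ≡⟨ sym (∑-⟪⟫ p xs) ⟩
  ∑ xs (λ x → ⟪ p x ⟫)                                  ≲⟨ ∑-mono xs (λ x → at (p x) (q x) (s x) (p⊆q∪s x)) ⟩
  ∑ xs (λ x → ⟪ q x ⟫ ⊕ ⟪ s x ⟫)                        ≡⟨ ∑-⊕ xs _ _ ⟩
  ∑ xs (λ x → ⟪ q x ⟫) ⊕ ∑ xs (λ x → ⟪ s x ⟫)           ≡⟨ cong₂ _⊕_ (∑-⟪⟫ q xs) (∑-⟪⟫ s xs) ⟩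
  ι (count q xs) ⊕ ι (count s xs)                       ≡⟨ sym (ι-+ (count q xs) _) ⟩
  ι (count q xs + count s xs)                           ∎)
  where
  open ≼-Reasoning
  at : ∀ a b c → (T a → T b ⊎ T c) → ⟪ a ⟫ ≼ ⟪ b ⟫ ⊕ ⟪ c ⟫
  at false b     c     _ = 𝟘≼ _
  at true  true  c     _ = a≼a⊕b 𝟙 _
  at true  false true  _ = b≼a⊕b 𝟘 𝟙
  at true  false false f with f tt
  ... | inj₁ ()
  ... | inj₂ ()

-- An elementary substitute for the exponential: in the induction the cross term y · 2S is at most y
-- because 2S is at most 1.
∏-1+ : ∀ ys → ∑ ys (λ y → y) ⊕ ∑ ys (λ y → y) ≼ 𝟙 →
  ∏ (map (𝟙 ⊕_) ys) ≼ 𝟙 ⊕ (∑ ys (λ y → y) ⊕ ∑ ys (λ y → y))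
∏-1+ []       _     = ≼-reflexive (sym (trans (cong (𝟙 ⊕_) (⊕-identityʳ 𝟘)) (⊕-identityʳ 𝟙)))
∏-1+ (y ∷ ys) small = begin
  (𝟙 ⊕ y) ⊗ ∏ (map (𝟙 ⊕_) ys)                   ≲⟨ ⊗-monoʳ (𝟙 ⊕ y) (∏-1+ ys small′) ⟩
  (𝟙 ⊕ y) ⊗ (𝟙 ⊕ (S ⊕ S))                       ≡⟨ solve 2 (λ y s → (con 1 :+ y) :* (con 1 :+ (s :+ s))
                                                    := con 1 :+ (y :+ (s :+ s)) :+ y :* (s :+ s)) refl y S ⟩
  𝟙 ⊕ (y ⊕ (S ⊕ S)) ⊕ y ⊗ (S ⊕ S)               ≲⟨ ⊕-monoʳ _
      (≼-trans (⊗-monoʳ y small′) (≼-reflexive (⊗-identityʳ y))) ⟩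
  𝟙 ⊕ (y ⊕ (S ⊕ S)) ⊕ y                         ≡⟨ solve 3 (λ o y s → o :+ (y :+ (s :+ s)) :+ y
                                                    := o :+ (y :+ s :+ (y :+ s))) refl 𝟙 y S ⟩
  𝟙 ⊕ (y ⊕ S ⊕ (y ⊕ S)) ∎
  where
  open ≼-Reasoning
  S = ∑ ys (λ y → y)
  small′ : S ⊕ S ≼ 𝟙
  small′ = ≼-trans (⊕-mono (b≼a⊕b y S) (b≼a⊕b y S)) small

inv2≼𝟙 : inv 2 ≼ 𝟙
inv2≼𝟙 = ⊗-cancelˡ-ι 2 (s≤s z≤n) (begin
  ι 2 ⊗ inv 2   ≡⟨ ι-inv 2 (s≤s z≤n) ⟩
  𝟙             ≲⟨ 1≼ι {2} (s≤s z≤n) ⟩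
  ι 2           ≡⟨ sym (⊗-identityʳ (ι 2)) ⟩
  ι 2 ⊗ 𝟙       ∎)
  where open ≼-Reasoning

inv2-↑-antitone : ∀ {m n} → m ≤ n → inv 2 ↑ n ≼ inv 2 ↑ m
inv2-↑-antitone {n = n} z≤n   = subst (inv 2 ↑ n ≼_) (𝟙-↑ n) (↑-mono n inv2≼𝟙)
inv2-↑-antitone (s≤s m≤n)     = ⊗-monoʳ (inv 2) (inv2-↑-antitone m≤n)

shortLists : {A : Set} → List A → ℕ → List (List A)
shortLists xs zero    = [] ∷ []
shortLists xs (suc d) = [] ∷ cartesianProductWith _∷_ xs (shortLists xs d)

∈-shortLists : ∀ {A : Set} {xs : List A} → (∀ x → x ∈ xs) → ∀ d U → length U ≤ d → U ∈ shortLists xs d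
∈-shortLists all zero    []      _         = here refl
∈-shortLists all (suc d) []      _         = here refl
∈-shortLists all (suc d) (x ∷ U) (s≤s U≤d) =
  there (∈-cartesianProductWith⁺ _∷_ (all x) (∈-shortLists all d U U≤d))

length-shortLists : ∀ {A : Set} (xs : List A) d → length (shortLists xs d) ≤ suc (length xs) ^ d
length-shortLists xs zero    = s≤s z≤n
length-shortLists xs (suc d) = ℕ.≤-trans
  (s≤s (ℕ.≤-reflexive (length-cartesianProductWith _∷_ xs (shortLists xs d))))
  (ℕ.+-mono-≤ (ℕ.m^n>0 (suc (length xs)) d) (ℕ.*-monoʳ-≤ (length xs) (length-shortLists xs d)))

2*16^u≰4^m : ∀ u m → m ≤ 2 * u → 2 * 16 ^ u ≤ 2 ^ m * 2 ^ m → ⊥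
2*16^u≰4^m u m m≤2u le = ℕ.<-irrefl refl (begin-strict
  16 ^ u                       <⟨ ℕ.m<m+n (16 ^ u) (ℕ.≤-trans (ℕ.m^n>0 16 u) (ℕ.m≤m+n (16 ^ u) 0)) ⟩
  2 * 16 ^ u                   ≤⟨ le ⟩
  2 ^ m * 2 ^ m                ≤⟨ ℕ.*-mono-≤ (ℕ.^-monoʳ-≤ 2 m≤2u) (ℕ.^-monoʳ-≤ 2 m≤2u) ⟩
  2 ^ (2 * u) * 2 ^ (2 * u)    ≡⟨ cong (λ k → k * k) (sym (ℕ.^-*-assoc 2 2 u)) ⟩
  4 ^ u * 4 ^ u                ≡⟨ sym (*-^ u 4 4) ⟩
  16 ^ u                       ∎)
  where open ℕ.≤-Reasoning

module Embedding {V : Set} (xs : List V) (xs-all : ∀ x → x ∈ xs) (xs! : Unique xs) (_≟_ : DecidableEquality V)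
  (b : V → V → Bool) (b-sym : ∀ x y → b x y ≡ b y x) (t r : ℕ) (l₀ : Fin t)
  {W : Set} (E : W → W → Bool) (E-sym : ∀ u v → E u v ≡ E v u)
  (χ : W → Fin r) (χ-proper : ∀ u v → T (E u v) → χ u ≢ χ v) where

  open Process xs _≟_ b b-sym t r E χ χ-proper

  Valid : (L : List W) → Z-type → Vec V (length L) → Set
  Valid []      Z []      = T (complete Z)
  Valid (w ∷ L) Z (x ∷ f) = T (choices w L Z f x) × Valid L Z f

  valid-complete : ∀ L Z f → Valid L Z f → T (complete Z)
  valid-complete []      Z []      c       = c
  valid-complete (w ∷ L) Z (x ∷ f) (_ , v) = valid-complete L Z f v

  valid-inParts : ∀ p L Z f → Valid L Z f → T (inParts (colours p L) Z (select p L f))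
  valid-inParts p []      Z []      _       = tt
  valid-inParts p (w ∷ L) Z (x ∷ f) (D , v) with p w
  ... | true  = T-∧⁺ (T-∧ˡ {part (χ w) Z x} (choices⊆candidates w L Z f x D)) (valid-inParts p L Z f v)
  ... | false = valid-inParts p L Z f v

  -- An entry of the block of colour `χ w` is adjacent to everything in the other parts, hence
  -- always a candidate. The index `l₀` provides such an entry.
  choice-exists : ∀ w L Z f → Valid L Z f → 1 ≤ count (choices w L Z f) xs
  choice-exists w L Z f v with count (choices w L Z f) xs | many-choices w L Z f
  ... | suc _ | _    = s≤s z≤n
  ... | zero  | c≤0 = ⊥-elim (ℕ.<-irrefl refl (ℕ.<-≤-trans
          (count-positive (candidates w L Z f) (xs-all _)
            (block-candidates (χ w) Z (valid-complete L Z f v) (colours (E w) L) (colours-proper w L)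
              (select (E w) L f) (valid-inParts (E w) L Z f v) l₀))
          c≤0))

  -- Every mean is over a non-empty set here, so none takes its default value and a choice no worse
  -- than average exists at each stage.
  outcome : 1 ≤ count complete Zs → ∀ L F → ∃ λ Z → ∃ λ f → Valid L Z f × F Z f ≼ 𝔼 L F
  outcome nonempty []      F with mean-attained Zs complete (λ Z → F Z []) nonempty
  ... | Z , c , bound = Z , [] , c , bound
  outcome nonempty (w ∷ L) F with outcome nonempty L (λ Z f → mean xs (choices w L Z f) (λ x → F Z (x ∷ f)))
  ... | Z , f , v , bound with mean-attained xs (choices w L Z f) (λ x → F Z (x ∷ f)) (choice-exists w L Z f v)
  ...   | x , D , bound′ = Z , x ∷ f , (D , v) , ≼-trans bound′ bound

  -- The reciprocal of 1 + 30/c. A hit multiplies by 16 = 1 + 15 and a given vertex is chosen with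
  -- probability at most 2/c, whence 30 = 15 · 2.
  shrink : ℕ → ℚ⁺
  shrink c = ι c ⊗ inv (c + 30)

  shrink-inverse : ∀ c → 1 ≤ c → shrink c ⊗ (𝟙 ⊕ ι 30 ⊗ inv c) ≡ 𝟙
  shrink-inverse c c≥1 = begin
    ι c ⊗ inv (c + 30) ⊗ (𝟙 ⊕ ι 30 ⊗ inv c)
      ≡⟨ solve 4 (λ c i y k → c :* i :* (con 1 :+ y :* k) := (c :+ (c :* k) :* y) :* i) refl (ι c)
           (inv (c + 30)) (ι 30) (inv c) ⟩
    (ι c ⊕ (ι c ⊗ inv c) ⊗ ι 30) ⊗ inv (c + 30)
      ≡⟨ cong (_⊗ inv (c + 30)) (trans (cong (ι c ⊕_)
           (trans (cong (_⊗ ι 30) (ι-inv c c≥1)) (⊗-identityˡ _))) (sym (ι-+ c 30))) ⟩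
    ι (c + 30) ⊗ inv (c + 30)
      ≡⟨ ι-inv (c + 30) (ℕ.≤-trans c≥1 (ℕ.m≤m+n c 30)) ⟩
    𝟙 ∎
    where open ≡-Reasoning

  boost : Bool → ℚ⁺
  boost b = if b then ι 16 else 𝟙

  boost-⟪⟫ : ∀ b → boost b ≡ 𝟙 ⊕ ι 15 ⊗ ⟪ b ⟫
  boost-⟪⟫ true  = cong (𝟙 ⊕_) (sym (⊗-identityʳ (ι 15)))
  boost-⟪⟫ false = sym (trans (cong (𝟙 ⊕_) (⊗-zeroʳ (ι 15))) (⊕-identityʳ 𝟙))

  -- An exponential supermartingale: 16 to the number of images in S, with a correction for the
  -- rate at which S may be hit.
  crowding : (V → Bool) → (L : List W) → Z-type → Vec V (length L) → ℚ⁺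
  crowding S []      Z []      = 𝟙
  crowding S (w ∷ L) Z (x ∷ f) = boost (S x) ⊗ shrink (size w L Z f) ↑ count S xs ⊗ crowding S L Z f

  size-positive : ∀ w L Z f → 1 ≤ size w L Z f
  size-positive w L Z f = ℕ.m≤n⊔m _ 1

  -- A union bound over the m elements of `S` gives 1 + 30m/c. Bernoulli's inequality makes it an
  -- m-th power, which the power of `shrink` cancels exactly.
  mean-boost : ∀ S w L Z f →
    mean xs (choices w L Z f) (λ x → boost (S x)) ≼ (𝟙 ⊕ ι 30 ⊗ inv (size w L Z f)) ↑ count S xs
  mean-boost S w L Z f = begin
    mean xs D (λ x → boost (S x))
      ≲⟨ mean-mono xs D (λ x → ≼-reflexive (boost-⟪⟫ (S x))) ⟩
    mean xs D (λ x → 𝟙 ⊕ ι 15 ⊗ ⟪ S x ⟫)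
      ≡⟨ trans (mean-⊕ xs D _ _) (cong (mean xs D (λ _ → 𝟙) ⊕_) (mean-⊗ xs D (ι 15) _)) ⟩
    mean xs D (λ _ → 𝟙) ⊕ ι 15 ⊗ mean xs D (λ x → ⟪ S x ⟫)
      ≲⟨ ⊕-mono (mean-const xs D 𝟙) (⊗-monoʳ (ι 15) hit) ⟩
    𝟙 ⊕ ι 15 ⊗ (ι 2 ⊗ inv c ⊗ ι m)
      ≡⟨ cong (𝟙 ⊕_) (trans (solve 4 (λ p q i k → p :* (q :* i :* k) := k :* ((p :* q) :* i)) refl (ι 15)
           (ι 2) (inv c) (ι m))
           (cong (λ u → ι m ⊗ (u ⊗ inv c)) (sym (ι-* 15 2)))) ⟩
    𝟙 ⊕ ι m ⊗ (ι 30 ⊗ inv c)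
      ≲⟨ bernoulli m _ ⟩
    (𝟙 ⊕ ι 30 ⊗ inv c) ↑ m ∎
    where
    open ≼-Reasoning
    D = choices w L Z f
    d = count D xs
    c = size w L Z f
    m = count S xs
    hit : mean xs D (λ x → ⟪ S x ⟫) ≼ ι 2 ⊗ inv c ⊗ ι m
    hit = begin
      inv d ⊗ ∑ xs (λ x → ⟪ D x ⟫ ⊗ ⟪ S x ⟫)
        ≲⟨ ⊗-monoʳ (inv d) (∑-mono xs λ x → ≼-trans (⊗-monoˡ ⟪ S x ⟫ (⟪⟫≼𝟙 (D x)))
             (≼-reflexive (⊗-identityˡ _))) ⟩
      inv d ⊗ ∑ xs (λ x → ⟪ S x ⟫)
        ≡⟨ cong (inv d ⊗_) (∑-⟪⟫ S xs) ⟩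
      inv d ⊗ ι m
        ≡⟨ sym (trans (cong (λ u → inv d ⊗ u ⊗ ι m) (ι-inv c (size-positive w L Z f)))
             (cong (_⊗ ι m) (⊗-identityʳ (inv d)))) ⟩
      inv d ⊗ (ι c ⊗ inv c) ⊗ ι m
        ≡⟨ cong (_⊗ ι m) (sym (⊗-assoc (inv d) (ι c) (inv c))) ⟩
      inv d ⊗ ι c ⊗ inv c ⊗ ι m
        ≲⟨ ⊗-monoˡ (ι m) (⊗-monoˡ (inv c) (inv-choices w L Z f)) ⟩
      ι 2 ⊗ inv c ⊗ ι m ∎

  -- The set may depend on `Z` but must not change during the embedding. The factor `G` lets the
  -- weight depend on the size of this random set.
  𝔼-crowding : ∀ L (S : Z-type → V → Bool) (G : Z-type → ℚ⁺) →
    𝔼 L (λ Z f → G Z ⊗ crowding (S Z) L Z f) ≼ 𝔼 [] (λ Z _ → G Z)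
  𝔼-crowding []      S G = 𝔼-mono [] {λ Z f → G Z ⊗ crowding
      (S Z) [] Z f} {λ Z _ → G Z} λ { Z [] → ≼-reflexive (⊗-identityʳ (G Z)) }
  𝔼-crowding (w ∷ L) S G = ≼-trans (𝔼-mono L step) (𝔼-crowding L S G)
    where
    open ≼-Reasoning
    step : ∀ Z f → mean xs (choices w L Z f) (λ x → G Z ⊗ crowding (S Z) (w ∷ L) Z (x ∷ f)) ≼ G Z ⊗ crowding
        (S Z) L Z f
    step Z f = begin
      mean xs D (λ x → G Z ⊗ (boost (S Z x) ⊗ q ⊗ K))
        ≲⟨ mean-mono xs D (λ x → ≼-reflexive
             (solve 4 (λ g u q k → g :* (u :* q :* k) := g :* k :* q :* u) refl (G Z) (boost (S Z x)) q K)) ⟩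
      mean xs D (λ x → G Z ⊗ K ⊗ q ⊗ boost (S Z x))
        ≡⟨ mean-⊗ xs D _ _ ⟩
      G Z ⊗ K ⊗ q ⊗ mean xs D (λ x → boost (S Z x))
        ≲⟨ ⊗-monoʳ _ (mean-boost (S Z) w L Z f) ⟩
      G Z ⊗ K ⊗ q ⊗ (𝟙 ⊕ ι 30 ⊗ inv c) ↑ m
        ≡⟨ trans (⊗-assoc (G Z ⊗ K) _ _) (cong (G Z ⊗ K ⊗_)
             (trans (sym (↑-⊗ (shrink c) _ m))
                 (trans (cong (_↑ m) (shrink-inverse c (size-positive w L Z f))) (𝟙-↑ m)))) ⟩
      G Z ⊗ K ⊗ 𝟙
        ≡⟨ ⊗-identityʳ _ ⟩
      G Z ⊗ K ∎
      where
      D = choices w L Z f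
      c = size w L Z f
      m = count (S Z) xs
      q = shrink c ↑ m
      K = crowding (S Z) L Z f

  module _ (d m₀ : ℕ) where

    -- A set of c elements tolerates crowding up to 2^c / 2, hence the weight 2^(-c). Sets below
    -- `m₀` are dropped, as their weight would be too large for the union bound.
    crowded : Fin r → List V → (L : List W) → Z-type → Vec V (length L) → ℚ⁺
    crowded i U L Z f = ⟪ m₀ ≤ᵇ count (candidate i Z U) xs ⟫ ⊗ inv 2 ↑ count (candidate i Z U) xs ⊗
      crowding (candidate i Z U) L Z f

    totalCrowding : (L : List W) → Z-type → Vec V (length L) → ℚ⁺
    totalCrowding L Z f = ∑ (allFin r) (λ i → ∑ (shortLists xs d) (λ U → crowded i U L Z f))

    𝔼-totalCrowding : ∀ L → 𝔼 L (totalCrowding L) ≼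
      ι (length (allFin r)) ⊗ (ι (length (shortLists xs d)) ⊗ inv 2 ↑ m₀)
    𝔼-totalCrowding L = begin
      𝔼 L (totalCrowding L)
        ≲⟨ 𝔼-∑ L (allFin r) _ ⟩
      ∑ (allFin r) (λ i → 𝔼 L (λ Z f → ∑ (shortLists xs d) (λ U → crowded i U L Z f)))
        ≲⟨ ∑-mono (allFin r) (λ i → 𝔼-∑ L (shortLists xs d) _) ⟩
      ∑ (allFin r) (λ i → ∑ (shortLists xs d) (λ U → 𝔼 L (crowded i U L)))
        ≲⟨ ∑-mono (allFin r) (λ i → ∑-mono (shortLists xs d) λ U → each i U) ⟩
      ∑ (allFin r) (λ i → ∑ (shortLists xs d) (λ U → inv 2 ↑ m₀))
        ≡⟨ trans (∑-const (allFin r) _) (cong (ι (length (allFin r)) ⊗_) (∑-const (shortLists xs d) _)) ⟩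
      ι (length (allFin r)) ⊗ (ι (length (shortLists xs d)) ⊗ inv 2 ↑ m₀) ∎
      where
      open ≼-Reasoning
      rare : ∀ c → ⟪ m₀ ≤ᵇ c ⟫ ⊗ inv 2 ↑ c ≼ inv 2 ↑ m₀
      rare c with m₀ ≤ᵇ c in eq
      ... | true  = ≼-trans (≼-reflexive (⊗-identityˡ _))
                      (inv2-↑-antitone (ℕ.≤ᵇ⇒≤ m₀ c (Equivalence.from Bool.T-≡ eq)))
      ... | false = subst (_≼ inv 2 ↑ m₀) (sym (⊗-zeroˡ _)) (𝟘≼ _)
      each : ∀ i U → 𝔼 L (crowded i U L) ≼ inv 2 ↑ m₀
      each i U = ≼-trans
        (𝔼-crowding L (λ Z → candidate i Z U)
            (λ Z → ⟪ m₀ ≤ᵇ count (candidate i Z U) xs ⟫ ⊗ inv 2 ↑ count (candidate i Z U) xs))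
        (≼-trans (𝔼-mono [] λ Z _ → rare (count (candidate i Z U) xs)) (𝔼-const [] _))

  hits : (V → Bool) → ∀ {m} → Vec V m → ℕ
  hits S []      = 0
  hits S (x ∷ f) = (if S x then 1 else 0) + hits S f

  count-used : ∀ S {m} (f : Vec V m) → count (λ x → S x ∧ not (unused f x)) xs ≤ hits S f
  count-used S []      = count-none xs
    where
    count-none : ∀ ys → count (λ x → S x ∧ false) ys ≤ 0
    count-none []       = z≤n
    count-none (y ∷ ys) rewrite Bool.∧-zeroʳ (S y) = count-none ys
  count-used S (y ∷ f) = ℕ.≤-trans
    (count-mono-+ {q = λ x → S x ∧ ⌊ x ≟ y ⌋} {s = λ x → S x ∧ not (unused f x)} split xs)
    (ℕ.+-mono-≤ single (count-used S f))
    where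
    split : ∀ x → T (S x ∧ not (not ⌊ x ≟ y ⌋ ∧ unused f x)) → T (S x ∧ ⌊ x ≟ y ⌋) ⊎ T (S x ∧ not (unused f x))
    split x h with S x | ⌊ x ≟ y ⌋
    ... | true | true  = inj₁ tt
    ... | true | false = inj₂ h
    single : count (λ x → S x ∧ ⌊ x ≟ y ⌋) xs ≤ (if S y then 1 else 0)
    single = ℕ.≤-trans (unique-⊆-length (Unique.filter⁺ (Bool.T? ∘ λ x → S x ∧ ⌊ x ≟ y ⌋) xs!) sub)
        (bound (S y))
      where
      bound : ∀ c → length (if c then y ∷ [] else []) ≤ (if c then 1 else 0)
      bound true  = ℕ.≤-refl
      bound false = ℕ.≤-refl
      sub : ∀ {x} → x ∈ filterᵇ (λ x → S x ∧ ⌊ x ≟ y ⌋) xs → x ∈ (if S y then y ∷ [] else [])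
      sub {x} x∈ with proj₂ (∈-filter⁻ (Bool.T? ∘ λ x → S x ∧ ⌊ x ≟ y ⌋) {xs = xs} x∈)
      ... | h with toWitness {a? = x ≟ y} (T-∧ʳ {S x} h)
      ...   | refl with S x
      ...     | true = here refl

  Good : (L : List W) → Z-type → Vec V (length L) → Set
  Good []      Z []      = ⊤
  Good (w ∷ L) Z (x ∷ f) = T (candidates w L Z f x) × T (unused f x) × Good L Z f

  choices-unused : ∀ w L Z f x → 2 * hits (candidates w L Z f) f ≤ count (candidates w L Z f) xs →
    T (choices w L Z f x) → T (unused f x)
  choices-unused w L Z f x few D with enoughUnused w L Z f in eq
  ... | true  = T-∧ʳ {candidates w L Z f x} D
  ... | false = ⊥-elim (subst T eq (ℕ.≤⇒≤ᵇ enough))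
    where
    C = candidates w L Z f
    c = count C xs
    c′ = count (λ x → C x ∧ unused f x) xs
    split : ∀ x → T (C x) → T (C x ∧ unused f x) ⊎ T (C x ∧ not (unused f x))
    split x Cx with C x | unused f x
    ... | true | true  = inj₁ tt
    ... | true | false = inj₂ tt
    c≤c′+u : c ≤ c′ + hits C f
    c≤c′+u = ℕ.≤-trans (count-mono-+ {q = λ x → C x ∧ unused f x} {s = λ x → C x ∧ not (unused f x)} split xs)
      (ℕ.+-monoʳ-≤ c′ (count-used C f))
    enough : c ≤ 2 * c′
    enough = ℕ.+-cancelʳ-≤ c c (2 * c′) (begin
      c + c                      ≤⟨ ℕ.+-mono-≤ c≤c′+u c≤c′+u ⟩
      c′ + u + (c′ + u)          ≡⟨ double c′ u ⟩
      2 * c′ + 2 * u             ≤⟨ ℕ.+-monoʳ-≤ (2 * c′) few ⟩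
      2 * c′ + c                 ∎)
      where
      open ℕ.≤-Reasoning
      u = hits C f
      double : ∀ a b → a + b + (a + b) ≡ 2 * a + 2 * b
      double = solve-∀

  select-lookup : ∀ w L f j → T (E w (List.lookup L j)) → ∀ x → T (adjacentTo (select (E w) L f) x) →
    T (b x (lookup f j))
  select-lookup w (u ∷ L) (y ∷ f) zero    e x h with E w u
  ... | true = T-∧ˡ h
  select-lookup w (u ∷ L) (y ∷ f) (suc j) e x h with E w u
  ... | true  = select-lookup w L f j e x (T-∧ʳ {b x y} h)
  ... | false = select-lookup w L f j e x h

  unused-lookup : ∀ {m} (f : Vec V m) x → T (unused f x) → ∀ j → x ≢ lookup f j
  unused-lookup f x h j refl with every-lookup (λ y → not ⌊ x ≟ y ⌋) f h j
  ... | ne with x ≟ x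
  ...   | no x≢x = x≢x refl

  good-injective : ∀ L Z f → Good L Z f → ∀ i j → i ≢ j → lookup f i ≢ lookup f j
  good-injective (w ∷ L) Z (x ∷ f) (_ , fresh , g) zero    zero    i≢j eq = i≢j refl
  good-injective (w ∷ L) Z (x ∷ f) (_ , fresh , g) zero    (suc j) i≢j eq = unused-lookup f x fresh j eq
  good-injective (w ∷ L) Z (x ∷ f) (_ , fresh , g) (suc i) zero    i≢j eq = unused-lookup f x fresh i (sym eq)
  good-injective (w ∷ L) Z (x ∷ f) (_ , fresh , g) (suc i) (suc j) i≢j eq =
    good-injective L Z f g i j (i≢j ∘ cong suc) eq

  good-adjacent : ∀ L Z f → Good L Z f → ∀ i j → i ≢ j → T (E (List.lookup L i) (List.lookup L j)) →
    T (b (lookup f i) (lookup f j))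
  good-adjacent (w ∷ L) Z (x ∷ f) (C , _ , g) zero    zero    i≢j e = ⊥-elim (i≢j refl)
  good-adjacent (w ∷ L) Z (x ∷ f) (C , _ , g) zero    (suc j) i≢j e =
    select-lookup w L f j e x (T-∧ʳ {part (χ w) Z x} C)
  good-adjacent (w ∷ L) Z (x ∷ f) (C , _ , g) (suc i) zero    i≢j e = subst T (b-sym x (lookup f i))
    (select-lookup w L f i (subst T (E-sym (List.lookup L i) w) e) x (T-∧ʳ {part (χ w) Z x} C))
  good-adjacent (w ∷ L) Z (x ∷ f) (C , _ , g) (suc i) (suc j) i≢j e =
    good-adjacent L Z f g i j (i≢j ∘ cong suc) e

  everything : W → Bool
  everything _ = true

  everything-count : ∀ L → count everything L ≡ length L
  everything-count L = cong length (filterᵇ-true L)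

  rate : ℕ → ℚ⁺
  rate c = ι 30 ⊗ inv c

  -- Multiplying by 1 + `rate` undoes every factor `shrink`, and only the boosts remain.
  crowding-hits : ∀ S L Z f →
    crowding S L Z f ⊗ ∏ (map (𝟙 ⊕_) (map rate (sizes everything L Z f))) ↑ count S xs ≡ ι 16 ↑ hits S f
  crowding-hits S []      Z []      = trans (⊗-identityˡ _) (𝟙-↑ (count S xs))
  crowding-hits S (w ∷ L) Z (x ∷ f) = begin
    boost (S x) ⊗ q ↑ m ⊗ K ⊗ (y ⊗ P) ↑ m
      ≡⟨ cong (boost (S x) ⊗ q ↑ m ⊗ K ⊗_) (↑-⊗ y P m) ⟩
    boost (S x) ⊗ q ↑ m ⊗ K ⊗ (y ↑ m ⊗ P ↑ m)
      ≡⟨ solve 5 (λ s q k y p → s :* q :* k :* (y :* p) := s :* (q :* y) :* (k :* p)) refl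
           (boost (S x)) (q ↑ m) K (y ↑ m) (P ↑ m) ⟩
    boost (S x) ⊗ (q ↑ m ⊗ y ↑ m) ⊗ (K ⊗ P ↑ m)
      ≡⟨ cong₂ (λ u v → boost (S x) ⊗ u ⊗ v)
           (trans (sym (↑-⊗ q y m)) (trans (cong (_↑ m) (shrink-inverse c (size-positive w L Z f))) (𝟙-↑ m)))
           (crowding-hits S L Z f) ⟩
    boost (S x) ⊗ 𝟙 ⊗ ι 16 ↑ hits S f
      ≡⟨ cong (_⊗ ι 16 ↑ hits S f) (⊗-identityʳ _) ⟩
    boost (S x) ⊗ ι 16 ↑ hits S f
      ≡⟨ count-hit (S x) ⟩
    ι 16 ↑ hits S (x ∷ f) ∎
    where
    open ≡-Reasoning
    c = size w L Z f
    q = shrink c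
    y = 𝟙 ⊕ rate c
    m = count S xs
    K = crowding S L Z f
    P = ∏ (map (𝟙 ⊕_) (map rate (sizes everything L Z f)))
    count-hit : ∀ c → boost c ⊗ ι 16 ↑ hits S f ≡ ι 16 ↑ ((if c then 1 else 0) + hits S f)
    count-hit true  = refl
    count-hit false = ⊗-identityˡ _

  -- The product of all 1 + `rate` is at most 2, so 16^u is at most 2^m / 2 times 2^m, that is, 4^m
  -- / 2. For m at most 2u this is impossible; the base 16 is what makes half of the set the
  -- threshold.
  few-hits : ∀ S L Z f →
    ∑ (map rate (sizes everything L Z f)) (λ y → y) ⊕ ∑ (map rate (sizes everything L Z f)) (λ y → y) ≼ 𝟙 →
    inv 2 ↑ count S xs ⊗ crowding S L Z f ≼ inv 2 → 2 * hits S f ≤ count S xs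
  few-hits S L Z f rates≼ crowding≼ with ℕ.≤-total (2 * hits S f) (count S xs)
  ... | inj₁ le = le
  ... | inj₂ m≤2u = ⊥-elim (2*16^u≰4^m u m m≤2u (ι-cancel (2 * 16 ^ u) (2 ^ m * 2 ^ m) weighted))
    where
    open ≼-Reasoning
    u = hits S f
    m = count S xs
    K = crowding S L Z f
    ys = map rate (sizes everything L Z f)
    P = ∏ (map (𝟙 ⊕_) ys)
    P≼2 : P ≼ ι 2
    P≼2 = ≼-trans (∏-1+ ys rates≼) (≼-trans (⊕-monoʳ 𝟙 rates≼) (≼-reflexive (cong (𝟙 ⊕_) (sym ι-1))))
    K≼ : K ≼ ι 2 ↑ m ⊗ inv 2
    K≼ = ≼-trans
      (≼-reflexive (sym (trans (sym (⊗-assoc (ι 2 ↑ m) (inv 2 ↑ m) K))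
        (trans (cong (_⊗ K) (trans (sym (↑-⊗ (ι 2) (inv 2) m))
            (trans (cong (_↑ m) (ι-inv 2 (s≤s z≤n))) (𝟙-↑ m))))
          (⊗-identityˡ K)))))
      (⊗-monoʳ (ι 2 ↑ m) crowding≼)
    weighted : ι (2 * 16 ^ u) ≼ ι (2 ^ m * 2 ^ m)
    weighted = begin
      ι (2 * 16 ^ u)                  ≡⟨ trans (ι-* 2 (16 ^ u)) (cong (ι 2 ⊗_) (ι-^ 16 u)) ⟩
      ι 2 ⊗ ι 16 ↑ u                  ≡⟨ cong (ι 2 ⊗_) (sym (crowding-hits S L Z f)) ⟩
      ι 2 ⊗ (K ⊗ P ↑ m)               ≲⟨ ⊗-monoʳ (ι 2) (⊗-mono K≼ (↑-mono m P≼2)) ⟩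
      ι 2 ⊗ (ι 2 ↑ m ⊗ inv 2 ⊗ ι 2 ↑ m)
        ≡⟨ solve 3 (λ p q k → p :* (k :* q :* k) := (p :* q) :* (k :* k)) refl (ι 2) (inv 2) (ι 2 ↑ m) ⟩
      (ι 2 ⊗ inv 2) ⊗ (ι 2 ↑ m ⊗ ι 2 ↑ m)
        ≡⟨ trans (cong (_⊗ (ι 2 ↑ m ⊗ ι 2 ↑ m)) (ι-inv 2 (s≤s z≤n))) (⊗-identityˡ _) ⟩
      ι 2 ↑ m ⊗ ι 2 ↑ m               ≡⟨ trans (cong (λ k → k ⊗ k) (sym (ι-^ 2 m)))
          (sym (ι-* (2 ^ m) (2 ^ m))) ⟩
      ι (2 ^ m * 2 ^ m) ∎

  select-length : ∀ p L f → length (select p L f) ≡ count p L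
  select-length p []      []      = refl
  select-length p (w ∷ L) (x ∷ f) with p w
  ... | true  = cong suc (select-length p L f)
  ... | false = select-length p L f

  module _ (θ : ℕ) (θ≥1 : 1 ≤ θ) (d m₀ n : ℕ) (n≥1 : 1 ≤ n) (θ-large : 180 * n ≤ θ)
    (m₀-small : ∀ c → c < m₀ → (c ⊔ 1) ^ suc d * (2 * n) < θ ^ suc d) where

    open Moments θ θ≥1

    private
      s : ℕ
      s = suc d

    FewHits : ∀ {m} → Z-type → Vec V m → Set
    FewHits Z f = ∀ i U → length U ≤ d → m₀ ≤ count (candidate i Z U) xs →
      2 * hits (candidate i Z U) f ≤ count (candidate i Z U) xs

    h≼1+h↑s : ∀ a → a ≼ 𝟙 ⊕ a ↑ s
    h≼1+h↑s a with ≼-total a 𝟙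
    ... | inj₁ a≼𝟙 = ≼-trans a≼𝟙 (a≼a⊕b 𝟙 _)
    ... | inj₂ 𝟙≼a = ≼-trans (≼-trans (≼-reflexive (sym (⊗-identityʳ a)))
        (↑-monoʳ {a} {1} {s} 𝟙≼a (s≤s z≤n))) (b≼a⊕b 𝟙 _)
    -- From h ≤ 1 + h^s the sum of all h is at most n + 2n. Twice the sum of the rates 30 h/θ is
    -- then at most 180 n/θ, the origin of the constant in `θ-large`.
    rates-small : ∀ L Z f → length L ≤ n → moments d everything L Z f ≼ ι (2 * n) →
      ∑ (map rate (sizes everything L Z f)) (λ y → y) ⊕ ∑ (map rate (sizes everything L Z f)) (λ y → y) ≼ 𝟙
    rates-small L Z f L≤n bound = begin
      ∑ (map rate cs) (λ y → y) ⊕ ∑ (map rate cs) (λ y → y)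
        ≡⟨ cong (λ k → k ⊕ k) rewritten ⟩
      ι 30 ⊗ inv θ ⊗ ∑ cs h ⊕ ι 30 ⊗ inv θ ⊗ ∑ cs h
        ≲⟨ ⊕-mono (⊗-monoʳ _ ∑h≼) (⊗-monoʳ _ ∑h≼) ⟩
      ι 30 ⊗ inv θ ⊗ ι (3 * n) ⊕ ι 30 ⊗ inv θ ⊗ ι (3 * n)
        ≡⟨ solve 3 (λ p q k → p :* q :* k :+ p :* q :* k := (p :* k :+ p :* k) :* q) refl (ι 30) (inv θ)
             (ι (3 * n)) ⟩
      (ι 30 ⊗ ι (3 * n) ⊕ ι 30 ⊗ ι (3 * n)) ⊗ inv θ
        ≡⟨ cong (_⊗ inv θ) (trans (cong₂ _⊕_ (sym (ι-* 30 (3 * n))) (sym (ι-* 30 (3 * n))))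
             (trans (sym (ι-+ (30 * (3 * n)) _)) (cong ι (total n)))) ⟩
      ι (180 * n) ⊗ inv θ
        ≲⟨ ⊗-monoˡ (inv θ) (ι-mono θ-large) ⟩
      ι θ ⊗ inv θ
        ≡⟨ ι-inv θ θ≥1 ⟩
      𝟙 ∎
      where
      open ≼-Reasoning
      cs = sizes everything L Z f
      total : ∀ n → 30 * (3 * n) + 30 * (3 * n) ≡ 180 * n
      total = solve-∀
      rewritten : ∑ (map rate cs) (λ y → y) ≡ ι 30 ⊗ inv θ ⊗ ∑ cs h
      rewritten = trans (∑-map rate cs (λ y → y)) (trans (∑-cong cs at) (∑-⊗ˡ cs _ h))
        where
        at : ∀ c → rate c ≡ ι 30 ⊗ inv θ ⊗ h c
        at c = sym (trans (solve 4 (λ p q u k → p :* q :* (u :* k) := (u :* q) :* (p :* k)) refl (ι 30)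
            (inv θ) (ι θ) (inv c))
          (trans (cong (_⊗ rate c) (ι-inv θ θ≥1)) (⊗-identityˡ _)))
      ∑h≼ : ∑ cs h ≼ ι (3 * n)
      ∑h≼ = begin
        ∑ cs h                                ≲⟨ ∑-mono cs (λ c → h≼1+h↑s (h c)) ⟩
        ∑ cs (λ c → 𝟙 ⊕ h c ↑ s)              ≡⟨ trans (∑-⊕ cs _ _)
            (cong₂ _⊕_ (trans (∑-const cs 𝟙) (⊗-identityʳ _)) (sym (∑-map h cs (_↑ s)))) ⟩
        ι (length cs) ⊕ moments d everything L Z f
          ≲⟨ ⊕-mono (ι-mono (ℕ.≤-trans (ℕ.≤-reflexive
               (trans (sizes-length everything L Z f) (everything-count L))) L≤n)) bound ⟩
        ι n ⊕ ι (2 * n)                       ≡⟨ sym (ι-+ n (2 * n)) ⟩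
        ι (3 * n) ∎

    -- Crowding is controlled only from `m₀` elements on. A smaller candidate set would exceed the
    -- whole moment budget with its single summand.
    size-large : ∀ c → h (c ⊔ 1) ↑ s ≼ ι (2 * n) → m₀ ≤ c
    size-large c bound with m₀ ℕ.≤? c
    ... | yes le = le
    ... | no m₀≰c = ⊥-elim (ℕ.<⇒≱ (m₀-small c (ℕ.≰⇒> m₀≰c)) (ι-cancel (θ ^ s) _ (begin
      ι (θ ^ s)                          ≡⟨ trans (ι-^ θ s) (cong (_↑ s) (sym θ≡)) ⟩
      (ι c⁺ ⊗ h c⁺) ↑ s                  ≡⟨ ↑-⊗ (ι c⁺) (h c⁺) s ⟩
      ι c⁺ ↑ s ⊗ h c⁺ ↑ s                ≲⟨ ⊗-monoʳ _ bound ⟩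
      ι c⁺ ↑ s ⊗ ι (2 * n)               ≡⟨ trans (cong (_⊗ ι (2 * n)) (sym (ι-^ c⁺ s)))
          (sym (ι-* (c⁺ ^ s) (2 * n))) ⟩
      ι (c⁺ ^ s * (2 * n)) ∎)))
      where
      open ≼-Reasoning
      c⁺ = c ⊔ 1
      θ≡ : ι c⁺ ⊗ h c⁺ ≡ ι θ
      θ≡ = trans (solve 3 (λ p q k → p :* (q :* k) := (p :* k) :* q) refl (ι c⁺) (ι θ) (inv c⁺))
        (trans (cong (_⊗ ι θ) (ι-inv c⁺ (ℕ.m≤n⊔m c 1))) (⊗-identityˡ _))

    crowded-few : ∀ L Z f → length L ≤ n → moments d everything L Z f ≼ ι (2 * n) →
      ι (4 * n) ⊗ totalCrowding d m₀ L Z f ≼ ι (2 * n) → FewHits Z f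
    crowded-few L Z f L≤n bound crowd i U U≤d m₀≤c =
      few-hits S L Z f (rates-small L Z f L≤n bound)
          (⊗-cancelˡ-ι (4 * n) (ℕ.≤-trans n≥1 (ℕ.m≤m+n n (3 * n))) (begin
        ι (4 * n) ⊗ (inv 2 ↑ c ⊗ K)
          ≡⟨ cong (λ k → ι (4 * n) ⊗ k) (sym (trans (cong (λ u → u ⊗ inv 2 ↑ c ⊗ K) on)
               (cong (_⊗ K) (⊗-identityˡ _)))) ⟩
        ι (4 * n) ⊗ crowded d m₀ i U L Z f
          ≲⟨ ⊗-monoʳ (ι (4 * n)) (≼-trans (∈-≼-∑ (λ U → crowded d m₀ i U L Z f) (∈-shortLists xs-all d U U≤d))
               (∈-≼-∑ (λ i → ∑ (shortLists xs d) (λ U → crowded d m₀ i U L Z f)) (∈-allFin i))) ⟩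
        ι (4 * n) ⊗ totalCrowding d m₀ L Z f
          ≲⟨ crowd ⟩
        ι (2 * n)
          ≡⟨ sym (trans (cong (λ k → ι k ⊗ inv 2) (four n)) (trans (cong (_⊗ inv 2) (ι-* (2 * n) 2))
               (trans (⊗-assoc _ _ _) (trans (cong (ι (2 * n) ⊗_) (ι-inv 2 (s≤s z≤n))) (⊗-identityʳ _))))) ⟩
        ι (4 * n) ⊗ inv 2 ∎))
      where
      open ≼-Reasoning
      S = candidate i Z U
      c = count S xs
      K = crowding S L Z f
      on : ⟪ m₀ ≤ᵇ c ⟫ ≡ 𝟙
      on = cong ⟪_⟫ (Equivalence.to Bool.T-≡ (ℕ.≤⇒≤ᵇ m₀≤c))
      four : ∀ n → 4 * n ≡ 2 * n * 2
      four = solve-∀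

    good : ∀ L Z f → Valid L Z f → BackDegree E d L → moments d everything L Z f ≼ ι (2 * n) →
      FewHits Z f → Good L Z f
    good []      Z []      _       _              _     _   = tt
    good (w ∷ L) Z (x ∷ f) (D , v) (deg≤d , back) bound few =
      choices⊆candidates w L Z f x D ,
      choices-unused w L Z f x
        (few′ (χ w) (select (E w) L f) (subst (_≤ d) (sym (select-length (E w) L f)) deg≤d)
          (size-large _ (≼-trans (a≼a⊕b _ _) bound)))
        D ,
      good L Z f v back (≼-trans (b≼a⊕b _ _) bound) few′
      where
      -- Hits only accumulate, so the bound for the full embedding passes to every earlier stage.
      few′ : FewHits Z f
      few′ i U U≤d m₀≤c = ℕ.≤-trans (ℕ.*-monoʳ-≤ 2
        (ℕ.m≤n+m (hits (candidate i Z U) f) (if candidate i Z U x then 1 else 0))) (few i U U≤d m₀≤c)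

    -- One outcome must satisfy both bounds, so they share one expectation. Under the weight 4n each
    -- part has mean at most n; an outcome of value at most 2n has moments at most 2n and total
    -- crowding at most 1/2.
    embedding : Rare d → 1 ≤ count complete Zs →
      4 * (length (allFin r) * length (shortLists xs d)) ≤ 2 ^ m₀ →
      ∀ L → length L ≤ n → BackDegree E d L → ∃ λ Z → ∃ λ f → Good L Z f
    embedding rare nonempty m₀-large L L≤n back
      with outcome nonempty L (λ Z f → moments d everything L Z f ⊕ ι (4 * n) ⊗ totalCrowding d m₀ L Z f)
    ... | Z , f , v , le = Z , f , good L Z f v back small
        (crowded-few L Z f L≤n small (≼-trans (b≼a⊕b _ _) le′))
      where
      open ≼-Reasoning
      A = length (allFin r)
      B = length (shortLists xs d)
      crowd : ι (4 * n) ⊗ (ι A ⊗ (ι B ⊗ inv 2 ↑ m₀)) ≼ ι n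
      crowd = begin
        ι (4 * n) ⊗ (ι A ⊗ (ι B ⊗ inv 2 ↑ m₀))
          ≡⟨ cong (_⊗ (ι A ⊗ (ι B ⊗ inv 2 ↑ m₀))) (ι-* 4 n) ⟩
        ι 4 ⊗ ι n ⊗ (ι A ⊗ (ι B ⊗ inv 2 ↑ m₀))
          ≡⟨ solve 5 (λ p q u v k → p :* q :* (u :* (v :* k)) := q :* (p :* (u :* v) :* k)) refl (ι 4) (ι n)
               (ι A) (ι B) (inv 2 ↑ m₀) ⟩
        ι n ⊗ (ι 4 ⊗ (ι A ⊗ ι B) ⊗ inv 2 ↑ m₀)
          ≡⟨ cong (λ k → ι n ⊗ (k ⊗ inv 2 ↑ m₀)) (trans (cong (ι 4 ⊗_) (sym (ι-* A B))) (sym (ι-* 4 (A * B)))) ⟩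
        ι n ⊗ (ι (4 * (A * B)) ⊗ inv 2 ↑ m₀)
          ≲⟨ ⊗-monoʳ (ι n) (⊗-monoˡ (inv 2 ↑ m₀) (ι-mono m₀-large)) ⟩
        ι n ⊗ (ι (2 ^ m₀) ⊗ inv 2 ↑ m₀)
          ≡⟨ cong (ι n ⊗_) (trans (cong (_⊗ inv 2 ↑ m₀) (ι-^ 2 m₀)) (trans (sym (↑-⊗ (ι 2) (inv 2) m₀))
               (trans (cong (_↑ m₀) (ι-inv 2 (s≤s z≤n))) (𝟙-↑ m₀)))) ⟩
        ι n ⊗ 𝟙
          ≡⟨ ⊗-identityʳ _ ⟩
        ι n ∎
      le′ : moments d everything L Z f ⊕ ι (4 * n) ⊗ totalCrowding d m₀ L Z f ≼ ι (2 * n)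
      le′ = begin
        moments d everything L Z f ⊕ ι (4 * n) ⊗ totalCrowding d m₀ L Z f
          ≲⟨ le ⟩
        𝔼 L (λ Z f → moments d everything L Z f ⊕ ι (4 * n) ⊗ totalCrowding d m₀ L Z f)
          ≡⟨ trans (𝔼-⊕ L _ _) (cong (𝔼 L (moments d everything L) ⊕_) (𝔼-⊗ L (ι (4 * n)) _)) ⟩
        𝔼 L (moments d everything L) ⊕ ι (4 * n) ⊗ 𝔼 L (totalCrowding d m₀ L)
          ≲⟨ ⊕-mono (≼-trans (moment-bound d rare L back everything)
                 (ι-mono (subst (_≤ n) (sym (everything-count L)) L≤n)))
               (≼-trans (⊗-monoʳ (ι (4 * n)) (𝔼-totalCrowding d m₀ L)) crowd) ⟩
        ι n ⊕ ι n
          ≡⟨ trans (sym (ι-+ n n)) (cong (λ k → ι (n + k)) (sym (ℕ.+-identityʳ n))) ⟩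
        ι (2 * n) ∎
      small : moments d everything L Z f ≼ ι (2 * n)
      small = ≼-trans (a≼a⊕b _ _) le′

-- From the number of cliques to the rarity of tuples with few candidates

module _ {V : Set} (xs : List V) (b : V → V → Bool) (b-sym : ∀ x y → b x y ≡ b y x) where

  count-complete : ∀ t r → count (Blocks.complete xs b b-sym t r) (Blocks.Zs xs b b-sym t r) ≡ cliques b
      (r * t) xs
  count-complete t r = ℕ.≤-antisym (ι-cancel _ _ (≼-reflexive eq)) (ι-cancel _ _ (≼-reflexive (sym eq)))
    where
    open Blocks xs b b-sym t r
    eq : ι (count complete Zs) ≡ ι (cliques b (r * t) xs)
    eq = begin
      ι (count complete Zs)                                       ≡⟨ sym (∑-⟪⟫ complete Zs) ⟩
      ∑ Zs (λ Z → ⟪ complete Z ⟫)                                 ≡⟨ sym (∑-vecs-concat xs t r _) ⟩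
      ∑ (vecs xs (r * t)) (λ v → ⟪ clique b (λ _ → true) v ⟫)     ≡⟨ sym (ι-cliques b (r * t) (λ _ → true) xs) ⟩
      ι (cliques b (r * t) (filterᵇ (λ _ → true) xs))             ≡⟨ cong (λ S → ι (cliques b (r * t) S))
          (filterᵇ-true xs) ⟩
      ι (cliques b (r * t) xs)                                    ∎
      where open ≡-Reasoning

module RareTuples {V : Set} (xs : List V) (_≟_ : DecidableEquality V)
  (b : V → V → Bool) (b-sym : ∀ x y → b x y ≡ b y x) (d r : ℕ)
  {W : Set} (E : W → W → Bool) (χ : W → Fin r) (χ-proper : ∀ u v → T (E u v) → χ u ≢ χ v)
  (θ : ℕ) (θ≥1 : 1 ≤ θ) where

  private
    s t : ℕ
    s = suc d
    t = s + s

  open Process xs _≟_ b b-sym t r E χ χ-proper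
  open Moments θ θ≥1

  -- As t = 2s, the weight h^(2s) is θ^t times `inv-count`. Restricting the blocks to complete ones
  -- costs the inverse density 2^e. The θ^m from the number of tuples cancels the normalisation,
  -- which leaves a comparison of powers of `R` only.
  rare : ∀ R e → 1 ≤ R → length xs ≡ R * θ → length Zs ≤ 2 ^ e * count complete Zs →
    (∀ m → m ≤ d → s * 2 ^ m * 2 ^ e * R ^ m ≤ R ^ t) → Rare d
  rare R e R≥1 N≡Rθ dense R-large i js js≢i js≤d = ⊗-cancelˡ-ι Y Y≥1 (begin
    ι Y ⊗ (ι s ⊗ ((ι 2 ⊗ inv θ) ↑ m ⊗ u))
      ≡⟨ cong (λ k → ι Y ⊗ (ι s ⊗ (k ⊗ u))) (↑-⊗ (ι 2) (inv θ) m) ⟩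
    ι Y ⊗ (ι s ⊗ (ι 2 ↑ m ⊗ inv θ ↑ m ⊗ u))
      ≡⟨ solve 5 (λ y s p q u → y :* (s :* (p :* q :* u)) := s :* p :* q :* (y :* u)) refl (ι Y) (ι s)
           (ι 2 ↑ m) (inv θ ↑ m) u ⟩
    ι s ⊗ ι 2 ↑ m ⊗ inv θ ↑ m ⊗ (ι Y ⊗ u)
      ≲⟨ ⊗-monoʳ _ uniform-bound ⟩
    ι s ⊗ ι 2 ↑ m ⊗ inv θ ↑ m ⊗ (ι θ ↑ t ⊗ (ι (2 ^ e) ⊗ ι (length Us)))
      ≡⟨ cong (λ k → ι s ⊗ ι 2 ↑ m ⊗ inv θ ↑ m ⊗ (ι θ ↑ t ⊗ (ι (2 ^ e) ⊗ k))) size-Us ⟩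
    ι s ⊗ ι 2 ↑ m ⊗ inv θ ↑ m ⊗ (ι θ ↑ t ⊗ (ι (2 ^ e) ⊗ (ι R ↑ m ⊗ ι θ ↑ m)))
      ≡⟨ solve 7 (λ s p q z f R k → s :* p :* q :* (z :* (f :* (R :* k))) := (k :* q) :*
           ((s :* p :* f :* R) :* z)) refl
           (ι s) (ι 2 ↑ m) (inv θ ↑ m) (ι θ ↑ t) (ι (2 ^ e)) (ι R ↑ m) (ι θ ↑ m) ⟩
    (ι θ ↑ m ⊗ inv θ ↑ m) ⊗ ((ι s ⊗ ι 2 ↑ m ⊗ ι (2 ^ e) ⊗ ι R ↑ m) ⊗ ι θ ↑ t)
      ≡⟨ trans (cong (_⊗ (ι s ⊗ ι 2 ↑ m ⊗ ι (2 ^ e) ⊗ ι R ↑ m ⊗ ι θ ↑ t))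
           (trans (sym (↑-⊗ (ι θ) (inv θ) m)) (trans (cong (_↑ m) (ι-inv θ θ≥1)) (𝟙-↑ m)))) (⊗-identityˡ _) ⟩
    (ι s ⊗ ι 2 ↑ m ⊗ ι (2 ^ e) ⊗ ι R ↑ m) ⊗ ι θ ↑ t
      ≡⟨ cong (_⊗ ι θ ↑ t) collect ⟩
    ι (s * 2 ^ m * 2 ^ e * R ^ m) ⊗ ι θ ↑ t
      ≲⟨ ⊗-monoˡ _ (ι-mono (R-large m js≤d)) ⟩
    ι (R ^ t) ⊗ ι θ ↑ t
      ≡⟨ trans (cong (_⊗ ι θ ↑ t) (ι-^ R t)) (sym (size-power t)) ⟩
    ι (length xs ^ t)
      ≡⟨ cong ι (sym (length-vecs xs t)) ⟩
    ι Y
      ≡⟨ sym (⊗-identityʳ _) ⟩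
    ι Y ⊗ 𝟙 ∎)
    where
    open ≼-Reasoning
    m = length js
    Us = lists xs m
    q = count complete Zs
    Y = length (vecs xs t)
    u = uniform js (λ Z U → h (positive-count i Z U) ↑ s ⊗ h (positive-count i Z U) ↑ s)
    B = ∑ Zs (λ Z → ⟪ complete Z ⟫ ⊗ ∑ Us (λ U → ⟪ inParts js Z U ⟫ ⊗ inv-count i Z U))

    Y≥1 : 1 ≤ Y
    Y≥1 = subst (1 ≤_) (sym (trans (length-vecs xs t) (cong (_^ t) N≡Rθ)))
      (ℕ.m^n>0 (R * θ) {{ℕ.>-nonZero (ℕ.*-mono-≤ R≥1 θ≥1)}} t)

    size-power : ∀ k → ι (length xs ^ k) ≡ ι R ↑ k ⊗ ι θ ↑ k
    size-power k = trans (cong (λ N → ι (N ^ k)) N≡Rθ)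
      (trans (ι-^ (R * θ) k) (trans (cong (_↑ k) (ι-* R θ)) (↑-⊗ (ι R) (ι θ) k)))

    size-Us : ι (length Us) ≡ ι R ↑ m ⊗ ι θ ↑ m
    size-Us = trans (cong ι (length-lists xs m)) (size-power m)

    collect : ι s ⊗ ι 2 ↑ m ⊗ ι (2 ^ e) ⊗ ι R ↑ m ≡ ι (s * 2 ^ m * 2 ^ e * R ^ m)
    collect = sym (trans (ι-* (s * 2 ^ m * 2 ^ e) (R ^ m)) (cong₂ _⊗_
      (trans (ι-* (s * 2 ^ m) (2 ^ e)) (cong (_⊗ ι (2 ^ e)) (trans (ι-* s (2 ^ m)) (cong (ι s ⊗_) (ι-^ 2 m)))))
      (ι-^ R m)))

    moment : ∀ c → h c ↑ s ⊗ h c ↑ s ≡ ι θ ↑ t ⊗ inv c ↑ t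
    moment c = trans (sym (↑-+ (h c) s s)) (↑-⊗ (ι θ) (inv c) t)

    factor : u ≡ ι θ ↑ t ⊗ (inv q ⊗ B)
    factor = trans
      (𝔼-cong [] (λ Z _ → trans
        (∑-cong Us (λ U → trans (cong (⟪ inParts js Z U ⟫ ⊗_) (moment (positive-count i Z U)))
          (⊗-exchange ⟪ inParts js Z U ⟫ (ι θ ↑ t) (inv-count i Z U))))
        (∑-⊗ˡ Us (ι θ ↑ t) _)))
      (𝔼-⊗ [] (ι θ ↑ t) (λ Z _ → ∑ Us (λ U → ⟪ inParts js Z U ⟫ ⊗ inv-count i Z U)))

    density : inv q ⊗ ι (length Zs) ≼ ι (2 ^ e)
    density = begin
      inv q ⊗ ι (length Zs)        ≲⟨ ⊗-monoʳ (inv q) (ι-mono dense) ⟩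
      inv q ⊗ ι (2 ^ e * q)        ≡⟨ cong (inv q ⊗_) (ι-* (2 ^ e) q) ⟩
      inv q ⊗ (ι (2 ^ e) ⊗ ι q)    ≡⟨ solve 3 (λ p f k → p :* (f :* k) := f :* (k :* p)) refl (inv q)
          (ι (2 ^ e)) (ι q) ⟩
      ι (2 ^ e) ⊗ (ι q ⊗ inv q)    ≲⟨ ⊗-monoʳ (ι (2 ^ e)) (inv-ι-≼ q) ⟩
      ι (2 ^ e) ⊗ 𝟙                ≡⟨ ⊗-identityʳ _ ⟩
      ι (2 ^ e)                    ∎

    uniform-bound : ι Y ⊗ u ≼ ι θ ↑ t ⊗ (ι (2 ^ e) ⊗ ι (length Us))
    uniform-bound = begin
      ι Y ⊗ u
        ≡⟨ cong (ι Y ⊗_) factor ⟩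
      ι Y ⊗ (ι θ ↑ t ⊗ (inv q ⊗ B))
        ≡⟨ solve 4 (λ y z p k → y :* (z :* (p :* k)) := z :* (p :* (y :* k))) refl (ι Y) (ι θ ↑ t) (inv q) B ⟩
      ι θ ↑ t ⊗ (inv q ⊗ (ι Y ⊗ B))
        ≲⟨ ⊗-monoʳ (ι θ ↑ t) (⊗-monoʳ (inv q) (dependent-random-choice i js js≢i)) ⟩
      ι θ ↑ t ⊗ (inv q ⊗ (ι (length Zs) ⊗ ι (length Us)))
        ≡⟨ cong (ι θ ↑ t ⊗_) (sym (⊗-assoc (inv q) _ _)) ⟩
      ι θ ↑ t ⊗ (inv q ⊗ ι (length Zs) ⊗ ι (length Us))
        ≲⟨ ⊗-monoʳ (ι θ ↑ t) (⊗-monoˡ (ι (length Us)) density) ⟩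
      ι θ ↑ t ⊗ (ι (2 ^ e) ⊗ ι (length Us)) ∎

-- Numerical parameters

n<2^n : ∀ n → n < 2 ^ n
n<2^n zero    = s≤s z≤n
n<2^n (suc n) = ℕ.≤-trans (ℕ.+-mono-≤ (ℕ.m^n>0 2 n) (n<2^n n))
  (ℕ.≤-reflexive (cong (2 ^ n +_) (sym (ℕ.+-identityʳ (2 ^ n)))))

log₄ : ∀ n → 1 ≤ n → ∃ λ a → 4 ^ a ≤ n × n < 4 ^ suc a
log₄ (suc zero)    _ = 0 , s≤s z≤n , s≤s (s≤s z≤n)
log₄ (suc (suc n)) _ with log₄ (suc n) (s≤s z≤n)
... | a , lo , hi with suc (suc n) ℕ.<? 4 ^ suc a
...   | yes lt = a , ℕ.m≤n⇒m≤1+n lo , lt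
...   | no ≮  = suc a , ℕ.≮⇒≥ ≮ ,
        ℕ.≤-trans (s≤s hi) (ℕ.+-mono-≤ (ℕ.m^n>0 4 (suc a)) (ℕ.m≤m+n (4 ^ suc a) _))

-- The numerical choices of the proof: the host has R θ vertices, candidate sets are expected to have
-- at least about θ elements, and those with fewer than m₀ elements never occur.
record Parameters (d r n bound : ℕ) : Set where
  field
    R θ m₀   : ℕ
    n≥1      : 1 ≤ n
    R≥1      : 1 ≤ R
    θ≥1      : 1 ≤ θ
    θ-large  : 180 * n ≤ θ
    R-large  : ∀ m → m ≤ d → suc d * 2 ^ m *
      2 ^ (r * (suc d + suc d) * (r * (suc d + suc d) + r * (suc d + suc d))) * R ^ m ≤ R ^ (suc d + suc d)
    m₀-small : ∀ c → c < m₀ → (c ⊔ 1) ^ suc d * (2 * n) < θ ^ suc d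
    m₀-large : ∀ S → S ≤ suc (R * θ) ^ d → 4 * (r * S) ≤ 2 ^ m₀
    host     : R * θ ≤ bound

module Numerics (d′ r′ : ℕ) where

  private
    d r s t : ℕ
    d = suc d′
    r = suc r′
    s = suc d
    t = s + s

  cliqueSize loss gain E₀ : ℕ
  cliqueSize = r * t
  loss       = cliqueSize * (cliqueSize + cliqueSize)
  -- Chosen such that `gain * s` equals `s + s + loss`. Since m is less than s, a factor R^s of R^t
  -- is free to absorb the loss.
  gain       = 2 + 8 * (r * r) * s
  E₀         = 2 ^ (10 * r)

  gain-suffices : ∀ m → m ≤ d → s * 2 ^ m * 2 ^ loss * (2 ^ gain) ^ m ≤ (2 ^ gain) ^ t
  gain-suffices m m≤d = begin
    s * 2 ^ m * 2 ^ loss * R ^ m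
      ≤⟨ ℕ.*-mono-≤ (ℕ.*-monoˡ-≤ (2 ^ loss) (ℕ.*-mono-≤ (ℕ.<⇒≤ (n<2^n s)) (ℕ.^-monoʳ-≤ 2 m≤s)))
                    (ℕ.^-monoʳ-≤ R {{ℕ.>-nonZero (ℕ.m^n>0 2 gain)}} m≤s) ⟩
    2 ^ s * 2 ^ s * 2 ^ loss * R ^ s
      ≡⟨ cong (_* R ^ s) (trans (cong (_* 2 ^ loss) (sym (ℕ.^-distribˡ-+-* 2 s s)))
           (sym (ℕ.^-distribˡ-+-* 2 (s + s) loss))) ⟩
    2 ^ (s + s + loss) * R ^ s
      ≡⟨ cong (λ k → 2 ^ k * R ^ s) (exponent r s) ⟩
    2 ^ (gain * s) * R ^ s
      ≡⟨ cong (_* R ^ s) (sym (ℕ.^-*-assoc 2 gain s)) ⟩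
    R ^ s * R ^ s
      ≡⟨ sym (ℕ.^-distribˡ-+-* R s s) ⟩
    R ^ t ∎
    where
    open ℕ.≤-Reasoning
    R = 2 ^ gain
    m≤s : m ≤ s
    m≤s = ℕ.m≤n⇒m≤1+n m≤d
    exponent : ∀ r s → s + s + r * (s + s) * (r * (s + s) + r * (s + s)) ≡ (2 + 8 * (r * r) * s) * s
    exponent = solve-∀

  r²-bound : 27 * (r * r) ≤ E₀
  r²-bound = begin
    27 * (r * r)                 ≤⟨ ℕ.*-mono-≤ (ℕ.m≤m+n 27 5) (ℕ.*-mono-≤ (ℕ.<⇒≤ (n<2^n r)) (ℕ.<⇒≤ (n<2^n r))) ⟩
    2 ^ 5 * (2 ^ r * 2 ^ r)      ≡⟨ cong (2 ^ 5 *_) (sym (ℕ.^-distribˡ-+-* 2 r r)) ⟩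
    2 ^ 5 * 2 ^ (r + r)          ≡⟨ sym (ℕ.^-distribˡ-+-* 2 5 (r + r)) ⟩
    2 ^ (5 + (r + r))            ≤⟨ ℕ.^-monoʳ-≤ 2 exponent ⟩
    2 ^ (10 * r)                 ∎
    where
    open ℕ.≤-Reasoning
    split : ∀ r′ → 10 * suc r′ ≡ (5 + (suc r′ + suc r′)) + (3 + 8 * r′)
    split = solve-∀
    exponent : 5 + (r + r) ≤ 10 * r
    exponent = ℕ.≤-trans (ℕ.m≤m+n _ (3 + 8 * r′)) (ℕ.≤-reflexive (sym (split r′)))

  -- As s is at most 2d, the left side 11 + 8r²s is at most 27dr². Of the 9, eight pay for the
  -- factor 256 in `θ` and one for doubling the host in `1+N₀≤n²`.
  gain-bound : gain + 9 ≤ d * E₀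
  gain-bound = begin
    gain + 9
      ≤⟨ ℕ.m≤m+n _ (11 * d′ + 11 * (r′ + r′ + r′ * r′) * d + 8 * (r * r) * d′) ⟩
    gain + 9 + (11 * d′ + 11 * (r′ + r′ + r′ * r′) * d + 8 * (r * r) * d′)
      ≡⟨ split d′ r′ ⟩
    d * (27 * (r * r))     ≤⟨ ℕ.*-monoʳ-≤ d r²-bound ⟩
    d * E₀                 ∎
    where
    open ℕ.≤-Reasoning
    split : ∀ d′ r′ → 2 + 8 * (suc r′ * suc r′) * suc (suc d′) + 9 +
        (11 * d′ + 11 * (r′ + r′ + r′ * r′) * suc d′ + 8 * (suc r′ * suc r′) * d′)
      ≡ suc d′ * (27 * (suc r′ * suc r′))
    split = solve-∀

  1024≤E₀ : 1024 ≤ E₀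
  1024≤E₀ = ℕ.^-monoʳ-≤ 2 {10} {10 * r} (ℕ.≤-trans (ℕ.m≤m+n 10 (10 * r′)) (ℕ.≤-reflexive (sym (ℕ.*-suc 10 r′))))

  r≤E₀ : r ≤ E₀
  r≤E₀ = ℕ.≤-trans (ℕ.<⇒≤ (n<2^n r)) (ℕ.^-monoʳ-≤ 2 (ℕ.m≤n*m r 10))

  module _ (n : ℕ) (n-large : 2 ^ (d * d * E₀) ≤ n) where

    ddE≥dE : d * E₀ ≤ d * d * E₀
    ddE≥dE = ℕ.*-monoˡ-≤ E₀ (ℕ.m≤m*n d d)

    n≥1 : 1 ≤ n
    n≥1 = ℕ.≤-trans (ℕ.m^n>0 2 (d * d * E₀)) n-large

    r≤n : r ≤ n
    r≤n = ℕ.≤-trans r≤E₀ (ℕ.≤-trans (ℕ.m≤n*m E₀ d) (ℕ.≤-trans ddE≥dE (ℕ.≤-trans (ℕ.<⇒≤ (n<2^n _)) n-large)))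

    N₀ θ m₀ a : ℕ
    -- The least power of two above 180.
    θ  = 256 * n
    N₀ = 2 ^ gain * θ
    a  = proj₁ (log₄ n n≥1)
    -- This lies between √n / 2 and √n: small enough for m₀² ≤ n, which `m₀-small` needs, and large
    -- enough for 2^m₀ to beat the number of tuples.
    m₀ = 2 ^ a

    θ≥1 : 1 ≤ θ
    θ≥1 = ℕ.*-mono-≤ {1} {256} (s≤s z≤n) n≥1

    θ-large : 180 * n ≤ θ
    θ-large = ℕ.*-monoˡ-≤ n (ℕ.m≤m+n 180 76)

    N₀-eq : ∀ g n → 2 ^ g * (256 * n) ≡ 2 ^ (g + 8) * n
    N₀-eq g n = trans (sym (ℕ.*-assoc (2 ^ g) 256 n)) (cong (_* n) (sym (ℕ.^-distribˡ-+-* 2 g 8)))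

    N₀≤ : N₀ ≤ 2 ^ (d * E₀) * n
    N₀≤ = ℕ.≤-trans (ℕ.≤-reflexive (N₀-eq gain n))
      (ℕ.*-monoˡ-≤ n (ℕ.^-monoʳ-≤ 2 (ℕ.≤-trans (ℕ.+-monoʳ-≤ gain (ℕ.m≤m+n 8 1)) gain-bound)))

    1+N₀≤n² : suc N₀ ≤ n * n
    1+N₀≤n² = begin
      1 + N₀                       ≤⟨ ℕ.+-monoˡ-≤ N₀ (ℕ.*-mono-≤ (ℕ.m^n>0 2 gain) θ≥1) ⟩
      N₀ + N₀                      ≡⟨ cong (N₀ +_) (sym (ℕ.+-identityʳ N₀)) ⟩
      2 * N₀                       ≡⟨ cong (2 *_) (N₀-eq gain n) ⟩
      2 * (2 ^ (gain + 8) * n)     ≡⟨ sym (ℕ.*-assoc 2 (2 ^ (gain + 8)) n) ⟩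
      2 ^ suc (gain + 8) * n       ≡⟨ cong (λ k → 2 ^ k * n) (sym (ℕ.+-suc gain 8)) ⟩
      2 ^ (gain + 9) * n           ≤⟨ ℕ.*-monoˡ-≤ n
          (ℕ.≤-trans (ℕ.^-monoʳ-≤ 2 (ℕ.≤-trans gain-bound ddE≥dE)) n-large) ⟩
      n * n                        ∎
      where open ℕ.≤-Reasoning

    m₀²≤n : m₀ * m₀ ≤ n
    m₀²≤n = ℕ.≤-trans (ℕ.≤-reflexive (sym (*-^ a 2 2))) (proj₁ (proj₂ (log₄ n n≥1)))

    m₀≤θ : m₀ ≤ θ
    m₀≤θ = ℕ.≤-trans (ℕ.m≤m*n m₀ m₀ {{ℕ.>-nonZero (ℕ.m^n>0 2 a)}}) (ℕ.≤-trans m₀²≤n (ℕ.m≤n*m n 256))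

    m₀-small : ∀ c → c < m₀ → (c ⊔ 1) ^ suc d * (2 * n) < θ ^ suc d
    m₀-small c c<m₀ = begin-strict
      (c ⊔ 1) ^ suc d * (2 * n)            ≤⟨ ℕ.*-monoˡ-≤ (2 * n)
          (ℕ.^-monoˡ-≤ (suc d) (ℕ.⊔-lub (ℕ.<⇒≤ c<m₀) (ℕ.m^n>0 2 a))) ⟩
      m₀ * (m₀ * m₀ ^ d′) * (2 * n)        ≡⟨ cong (_* (2 * n)) (sym (ℕ.*-assoc m₀ m₀ _)) ⟩
      m₀ * m₀ * m₀ ^ d′ * (2 * n)          ≤⟨ ℕ.*-monoˡ-≤ (2 * n) (ℕ.*-mono-≤ m₀²≤n (ℕ.^-monoˡ-≤ d′ m₀≤θ)) ⟩
      n * X * (2 * n)                      ≡⟨ regroup n X ⟩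
      2 * Y                                <⟨ ℕ.*-monoˡ-< Y {{ℕ.>-nonZero Y≥1}} {2} {65536}
          (s≤s (s≤s (s≤s z≤n))) ⟩
      65536 * Y                            ≡⟨ expand n X ⟩
      256 * n * (256 * n * X)              ∎
      where
      open ℕ.≤-Reasoning
      X = θ ^ d′
      Y = n * n * X
      Y≥1 : 1 ≤ Y
      Y≥1 = ℕ.*-mono-≤ (ℕ.*-mono-≤ n≥1 n≥1) (ℕ.m^n>0 θ {{ℕ.>-nonZero θ≥1}} d′)
      regroup : ∀ n X → n * X * (2 * n) ≡ 2 * (n * n * X)
      regroup = solve-∀
      expand : ∀ n X → 65536 * (n * n * X) ≡ 256 * n * (256 * n * X)
      expand = solve-∀

    -- The hypothesis on n bounds d² 2^(10r) by 2 (a + 1), and 2^(10r) is at least 1024. So `d` is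
    -- at most `a`, and `a` is past the start of `quadratic≤exponential`.
    a-large : 511 + d ≤ a
    a-large = ℕ.≤-pred (ℕ.*-cancelˡ-< 2 (511 + d) (suc a) (begin-strict
      2 * (511 + d)            ≤⟨ ℕ.m≤m+n _ (1022 * d′) ⟩
      2 * (511 + d) + 1022 * d′  ≡⟨ split d′ ⟩
      1024 * d                 ≤⟨ ℕ.*-mono-≤ 1024≤E₀ (ℕ.m≤m*n d d) ⟩
      E₀ * (d * d)             ≡⟨ ℕ.*-comm E₀ (d * d) ⟩
      d * d * E₀               <⟨ exponent ⟩
      2 * suc a                ∎))
      where
      open ℕ.≤-Reasoning
      split : ∀ d′ → 2 * (511 + suc d′) + 1022 * d′ ≡ 1024 * suc d′
      split = solve-∀
      exponent : d * d * E₀ < 2 * suc a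
      exponent = ℕ.≰⇒> λ le → ℕ.<-irrefl refl (ℕ.<-≤-trans (ℕ.≤-<-trans n-large (proj₂ (proj₂ (log₄ n n≥1))))
        (ℕ.≤-trans (ℕ.≤-reflexive (ℕ.^-*-assoc 2 2 (suc a))) (ℕ.^-monoʳ-≤ 2 le)))

    quadratic≤exponential : ∀ k → 4 * ((9 + k) * (9 + k)) + 6 * (9 + k) + 4 ≤ 2 ^ (9 + k)
    quadratic≤exponential zero    = ℕ.m≤m+n 382 130
    quadratic≤exponential (suc k) = begin
      4 * ((10 + k) * (10 + k)) + 6 * (10 + k) + 4
        ≤⟨ ℕ.m≤m+n _ (4 * (k * k) + 70 * k + 300) ⟩
      4 * ((10 + k) * (10 + k)) + 6 * (10 + k) + 4 + (4 * (k * k) + 70 * k + 300)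
        ≡⟨ split k ⟩
      2 * (4 * ((9 + k) * (9 + k)) + 6 * (9 + k) + 4)
        ≤⟨ ℕ.*-monoʳ-≤ 2 (quadratic≤exponential k) ⟩
      2 * 2 ^ (9 + k)
        ≡⟨ cong (2 ^_) (sym (ℕ.+-suc 9 k)) ⟩
      2 ^ (9 + suc k) ∎
      where
      open ℕ.≤-Reasoning
      split : ∀ k → 4 * ((10 + k) * (10 + k)) + 6 * (10 + k) + 4 + (4 * (k * k) + 70 * k + 300)
        ≡ 2 * (4 * ((9 + k) * (9 + k)) + 6 * (9 + k) + 4)
      split = solve-∀

    -- The host has at most n² vertices, so the left side is at most 4 n^(2d+1). Its binary
    -- logarithm is quadratic in `a` because d ≤ a, whereas `m₀` is exponential in `a`.
    m₀-large : ∀ S → S ≤ suc N₀ ^ d → 4 * (r * S) ≤ 2 ^ m₀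
    m₀-large S S≤ = begin
      4 * (r * S)                              ≤⟨ ℕ.*-monoʳ-≤ 4 (ℕ.*-mono-≤ r≤n S≤) ⟩
      4 * (n * suc N₀ ^ d)                     ≤⟨ ℕ.*-monoʳ-≤ 4 (ℕ.*-monoʳ-≤ n (ℕ.^-monoˡ-≤ d 1+N₀≤n²)) ⟩
      4 * (n * (n * n) ^ d)                    ≡⟨ cong (λ k → 4 * (n * k))
          (trans (*-^ d n n) (sym (ℕ.^-distribˡ-+-* n d d))) ⟩
      4 * n ^ suc (d + d)                      ≤⟨ ℕ.*-monoʳ-≤ 4
          (ℕ.^-monoˡ-≤ (suc (d + d)) (ℕ.<⇒≤ (proj₂ (proj₂ (log₄ n n≥1))))) ⟩
      4 * (4 ^ suc a) ^ suc (d + d)            ≡⟨ cong (4 *_) (ℕ.^-*-assoc 4 (suc a) (suc (d + d))) ⟩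
      4 ^ suc (suc a * suc (d + d))            ≡⟨ ℕ.^-*-assoc 2 2 (suc (suc a * suc (d + d))) ⟩
      2 ^ (2 * suc (suc a * suc (d + d)))      ≤⟨ ℕ.^-monoʳ-≤ 2 exponent ⟩
      2 ^ m₀                                   ∎
      where
      open ℕ.≤-Reasoning
      d≤a : d ≤ a
      d≤a = ℕ.≤-trans (ℕ.m≤n+m d 511) a-large
      9≤a : 9 ≤ a
      9≤a = ℕ.≤-trans (ℕ.≤-trans (ℕ.m≤m+n 9 502) (ℕ.m≤m+n 511 d)) a-large
      expand : ∀ a → 2 * suc (suc a * suc (a + a)) ≡ 4 * (a * a) + 6 * a + 4
      expand = solve-∀
      exponent : 2 * suc (suc a * suc (d + d)) ≤ m₀
      exponent = begin
        2 * suc (suc a * suc (d + d))    ≤⟨ ℕ.*-monoʳ-≤ 2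
            (s≤s (ℕ.*-monoʳ-≤ (suc a) (s≤s (ℕ.+-mono-≤ d≤a d≤a)))) ⟩
        2 * suc (suc a * suc (a + a))    ≡⟨ expand a ⟩
        4 * (a * a) + 6 * a + 4          ≤⟨ subst (λ k → 4 * (k * k) + 6 * k + 4 ≤ 2 ^ k) (ℕ.m+[n∸m]≡n 9≤a)
                                              (quadratic≤exponential (a ℕ.∸ 9)) ⟩
        2 ^ a                            ∎

    parameters : Parameters d r n (2 ^ (d * E₀) * n)
    parameters = record
      { R = 2 ^ gain ; θ = θ ; m₀ = m₀ ; n≥1 = n≥1 ; R≥1 = ℕ.m^n>0 2 gain ; θ≥1 = θ≥1 ; θ-large = θ-large
      ; R-large = gain-suffices ; m₀-small = m₀-small ; m₀-large = m₀-large ; host = N₀≤ }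

-- Monochromatic copies

-- The diagonal of b is irrelevant, since φ is injective and F has no loops.
Copy : ∀ {k} {V : Set} → Graph k → (V → V → Bool) → Set
Copy {k} {V} F b = Σ (Fin k → V) λ φ → Injective _≡_ _≡_ φ × (∀ u v → T (adj F u v) → T (b (φ u) (φ v)))

length-allFin : ∀ k → length (allFin k) ≡ k
length-allFin k = length-tabulate (λ i → i)

monochromatic-cliques : ∀ {V : Set} (a : V → V → Bool) m S →
  length S ^ m ≤ 2 ^ (m * (m + m)) * cliques a m S ⊎
  length S ^ m ≤ 2 ^ (m * (m + m)) * cliques (λ u v → not (a u v)) m S
monochromatic-cliques a zero    S = inj₁ (s≤s z≤n)
monochromatic-cliques a (suc M) S = many-cliques a M (suc M) (suc M) ℕ.≤-refl ℕ.≤-refl S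

module _ (d r n bound : ℕ) (parameters : Parameters d r n bound) where

  open Parameters parameters

  private
    s t e N : ℕ
    s = suc d
    t = s + s
    e = r * t * (r * t + r * t)
    N = R * θ

    xs : List (Fin N)
    xs = allFin N

    l₀ : Fin t
    l₀ = zero

  dense⇒copy : ∀ b → (∀ u v → b u v ≡ b v u) → N ^ (r * t) ≤ 2 ^ e * cliques b (r * t) xs →
    ∀ {k} → k ≤ n → (F : Graph k) → Degenerate d F → Colorable r F → Copy F b
  dense⇒copy b b-sym dense {k} k≤n F deg (χ , χ-proper) with degenerate⇒order F deg
  ... | L , complete-L , L! , back = φ , φ-injective , φ-adjacent
    where
    module B = Blocks xs b b-sym t r
    module R = RareTuples xs _≟_ b b-sym d r (adj F) χ χ-proper θ θ≥1
    module G = Embedding xs ∈-allFin (Unique.allFin⁺ N) _≟_ b b-sym t r l₀ (adj F) (adjSym F) χ χ-proper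

    Zs-size : length B.Zs ≡ N ^ (r * t)
    Zs-size = trans (length-vecs (vecs xs t) r)
      (trans (cong (_^ r) (trans (length-vecs xs t) (cong (_^ t) (length-allFin N))))
        (trans (ℕ.^-*-assoc N t r) (cong (N ^_) (ℕ.*-comm t r))))

    Zs-dense : length B.Zs ≤ 2 ^ e * count B.complete B.Zs
    Zs-dense = ℕ.≤-trans (ℕ.≤-reflexive Zs-size) (ℕ.≤-trans dense
      (ℕ.≤-reflexive (cong (2 ^ e *_) (sym (count-complete xs b b-sym t r)))))

    N≥1 : 1 ≤ N
    N≥1 = ℕ.*-mono-≤ R≥1 θ≥1

    complete-exists : 1 ≤ count B.complete B.Zs
    complete-exists with count B.complete B.Zs | Zs-dense
    ... | suc _ | _  = s≤s z≤n
    ... | zero  | le = ⊥-elim (ℕ.<-irrefl refl (ℕ.<-≤-trans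
            (subst (1 ≤_) (sym Zs-size) (ℕ.m^n>0 N {{ℕ.>-nonZero N≥1}} (r * t)))
            (ℕ.≤-trans le (ℕ.≤-reflexive (ℕ.*-zeroʳ (2 ^ e))))))

    L≤n : length L ≤ n
    L≤n = ℕ.≤-trans (unique-⊆-length L! (λ _ → ∈-allFin _)) (ℕ.≤-trans (ℕ.≤-reflexive (length-allFin k)) k≤n)

    result : ∃ λ Z → ∃ λ f → G.Good L Z f
    result = G.embedding θ θ≥1 d m₀ n n≥1 θ-large m₀-small
      (R.rare R e R≥1 (length-allFin N) Zs-dense R-large) complete-exists
      (subst (λ k → 4 * (k * length (shortLists xs d)) ≤ 2 ^ m₀) (sym (length-allFin r))
        (m₀-large (length (shortLists xs d))
          (subst (λ k → length (shortLists xs d) ≤ suc k ^ d) (length-allFin N) (length-shortLists xs d))))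
      L L≤n back

    Z = proj₁ result
    f = proj₁ (proj₂ result)

    index : Fin k → Fin (length L)
    index u = Any.index (complete-L u)

    index-lookup : ∀ u → u ≡ List.lookup L (index u)
    index-lookup u = lookup-index (complete-L u)

    index-injective : ∀ {u v} → index u ≡ index v → u ≡ v
    index-injective {u} {v} eq = trans (index-lookup u) (trans (cong (List.lookup L) eq) (sym (index-lookup v)))

    φ : Fin k → Fin N
    φ u = lookup f (index u)

    φ-injective : Injective _≡_ _≡_ φ
    φ-injective {u} {v} eq with index u ≟ index v
    ... | yes i≡j = index-injective i≡j
    ... | no  i≢j = ⊥-elim (G.good-injective L Z f (proj₂ (proj₂ result)) (index u) (index v) i≢j eq)

    φ-adjacent : ∀ u v → T (adj F u v) → T (b (φ u) (φ v))
    φ-adjacent u v u~v = G.good-adjacent L Z f (proj₂ (proj₂ result)) (index u) (index v)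
      (λ i≡j → irreflexive (index-injective i≡j))
          (subst₂ (λ x y → T (adj F x y)) (index-lookup u) (index-lookup v) u~v)
      where
      irreflexive : u ≢ v
      irreflexive refl = subst T (irref F u) u~v

  -- The colour is fixed by its number of cliques before any `F` is considered, so the same colour
  -- serves every graph of the family.
  monochromatic-copies : ∀ a → (∀ u v → a u v ≡ a v u) →
    (∀ {k} → k ≤ n → (F : Graph k) → Degenerate d F → Colorable r F → Copy F a) ⊎
    (∀ {k} → k ≤ n → (F : Graph k) → Degenerate d F → Colorable r F → Copy F (λ u v → not (a u v)))
  monochromatic-copies a a-sym with monochromatic-cliques a (r * t) xs
  ... | inj₁ dense = inj₁ (dense⇒copy a a-sym
      (ℕ.≤-trans (ℕ.≤-reflexive (cong (_^ (r * t)) (sym (length-allFin N)))) dense))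
  ... | inj₂ dense = inj₂ (dense⇒copy (λ u v → not (a u v)) (λ u v → cong not (a-sym u v))
          (ℕ.≤-trans (ℕ.≤-reflexive (cong (_^ (r * t)) (sym (length-allFin N)))) dense))

0-degenerate-edgeless : ∀ {k} (F : Graph k) → Degenerate 0 F → ∀ u v → T (adj F u v) → ⊥
0-degenerate-edgeless F deg u v e with degenerate⇒order F deg
... | L , complete-L , _ , back = go L back (complete-L u) (complete-L v) e
  where
  isolated : ∀ {w L} → count (adj F w) L ≤ 0 → ∀ {x} → x ∈ L → T (adj F w x) → ⊥
  isolated deg≤0 x∈L w~x = ℕ.n≮0 (ℕ.<-≤-trans (count-positive (adj F _) x∈L w~x) deg≤0)
  go : ∀ L → BackDegree (adj F) 0 L → ∀ {u v} → u ∈ L → v ∈ L → T (adj F u v) → ⊥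
  go (w ∷ L) (deg≤0 , back) (here refl) (here refl) e = subst T (irref F w) e
  go (w ∷ L) (deg≤0 , back) (here refl) (there v∈L) e = isolated deg≤0 v∈L e
  go (w ∷ L) (deg≤0 , back) (there u∈L) (here refl) e = isolated deg≤0 u∈L (subst T (adjSym F _ w) e)
  go (w ∷ L) (deg≤0 , back) (there u∈L) (there v∈L) e = go L back u∈L v∈L e

-- The embedding argument runs on exactly `R * θ` vertices; a larger host is restricted to its first
-- vertices.
copy⇒⊑ : ∀ {k m N} (m≤N : m ≤ N) (F : Graph k) (χ : EdgeColoring2 N) c →
  Copy F (λ u v → if c then col χ (inject≤ u m≤N) (inject≤ v m≤N) else not
      (col χ (inject≤ u m≤N) (inject≤ v m≤N))) →
  F ⊑ colorClass χ c
copy⇒⊑ m≤N F χ c (φ , φ-injective , φ-adjacent) = ψ , ψ-injective , ψ-adjacent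
  where
  ψ = λ u → inject≤ (φ u) m≤N
  ψ-injective : Injective _≡_ _≡_ ψ
  ψ-injective eq = φ-injective (inject≤-injective m≤N m≤N _ _ eq)
  ψ-adjacent : ∀ u v → T (adj F u v) → T (adj (colorClass χ c) (ψ u) (ψ v))
  ψ-adjacent u v e with ψ u ≟ ψ v
  ... | no  _  = φ-adjacent u v e
  ... | yes eq with ψ-injective {u} {v} eq
  ...   | refl = ⊥-elim (subst T (irref F u) e)

theorem1p1 : ∃ λ (c : ℕ) → ∀ (d r n : ℕ) → 2 ^ (d * d * 2 ^ (c * r)) ≤ n →
    ∀ {N : ℕ} → 2 ^ (d * 2 ^ (c * r)) * n ≤ N → (χ : EdgeColoring2 N) →
    UniversalDegCol d r n (colorClass χ true) ⊎ UniversalDegCol d r n (colorClass χ false)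
theorem1p1 = 10 , theorem
  where
  theorem : ∀ (d r n : ℕ) → 2 ^ (d * d * 2 ^ (10 * r)) ≤ n →
    ∀ {N : ℕ} → 2 ^ (d * 2 ^ (10 * r)) * n ≤ N → (χ : EdgeColoring2 N) →
    UniversalDegCol d r n (colorClass χ true) ⊎ UniversalDegCol d r n (colorClass χ false)
  -- For d = 0 only n vertices are guaranteed, too few for the parameters, but then `F` has no edges
  -- and any injection will do.
  theorem zero r n _ {N} n≤N χ = inj₁ λ k≤n F deg _ →
    copy⇒⊑ (ℕ.≤-trans k≤n (ℕ.≤-trans (ℕ.≤-reflexive (sym (ℕ.+-identityʳ n))) n≤N)) F χ true
      (id , id , λ u v e → ⊥-elim (0-degenerate-edgeless F deg u v e))
  -- A graph coloured with no colours has no vertices.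
  theorem (suc d) zero n _ n≤N χ = inj₁ λ k≤n F deg (colour , _) →
    (λ u → ⊥-elim (noColour (colour u))) , (λ {u} _ → ⊥-elim (noColour (colour u))) , λ u v e → ⊥-elim
        (noColour (colour u))
    where
    noColour : Fin 0 → ⊥
    noColour ()
  theorem (suc d) (suc r) n n-large {N} N-large χ = conclude (Numerics.parameters d r n n-large)
    where
    conclude : Parameters (suc d) (suc r) n (2 ^ (suc d * 2 ^ (10 * suc r)) * n) →
      UniversalDegCol (suc d) (suc r) n (colorClass χ true) ⊎ UniversalDegCol (suc d) (suc r) n
          (colorClass χ false)
    conclude p = Sum.map
      (λ copies k≤n F deg colouring → copy⇒⊑ N₀≤N F χ true (copies k≤n F deg colouring))
      (λ copies k≤n F deg colouring → copy⇒⊑ N₀≤N F χ false (copies k≤n F deg colouring))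
      (monochromatic-copies (suc d) (suc r) n _ p
        (λ u v → col χ (inject≤ u N₀≤N) (inject≤ v N₀≤N)) (λ u v → colSym χ _ _))
      where N₀≤N = ℕ.≤-trans (Parameters.host p) N-large
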